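{- For every integer $n\ge1$, the Ehrhart polynomial $H_{1,n}$ has all its complex roots on the line $R=\{z\in\mathbb{C}:\operatorname{Re}(z)=-\tfrac12\}$, and $H_{1,n}$ $R$-interlaces $H_{1,n+1}$.
   Context: For a finite simple undirected graph $G=(V,E)$, let $\mathbb{Z}^{|V|}$ be the lattice with basis $(e_v)_{v\in V}$. The symmetric edge polytope $P_G\subset\mathbb{R}^{|V|}$ is the convex hull of all vectors $e_{v_1}-e_{v_2}$ with $\{v_1,v_2\}\in E$ (both orders). The Ehrhart polynomial $H_G$ is the polynomial with $H_G(s)=|sP_G\cap\mathbb{Z}^{|V|}|$ for all integers $s\ge 0$. For the complete bipartite graph $K_{a,b}$ with parts of sizes $a$ and $b$, write $H_{a,b}=H_{K_{a,b}}$. Interlacing: let $L=\alpha+\mathbb{R}\beta$ be a line in $\mathbb{C}$ ($\alpha,\beta\in\mathbb{C}$, $\beta\ne0$), and let $f,g\in\mathbb{C}[x]$ with $m=\deg f=\deg g+1$ have all their zeros on $L$. Let $\alpha+t_1\beta,\dots,\alpha+t_m\beta$ and $\alpha+s_1\beta,\dots,\alpha+s_{m-1}\beta$ ($t_i,s_j\in\mathbb{R}$) be the zeros of $f$ and $g$, listed with multiplicity. Then $f$ is $L$-interlaced by $g$ (equivalently, $g$ $L$-interlaces $f$) if, after relabeling, $t_1\le s_1\le t_2\le\cdots\le t_{m-1}\le s_{m-1}\le t_m$. -}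

module Defs where

open import Data.Empty using (⊥)
open import Data.Fin using (Fin; inject₁; splitAt)
import Data.Fin as Fin
open import Data.Integer using (ℤ; +_)
open import Data.List using (List; []; _∷_; length; map)
open import Data.List.Membership.Propositional using (_∈_)
open import Data.List.Relation.Unary.Unique.Propositional using (Unique)
open import Data.Nat as ℕ using (ℕ; zero; suc; _⊔_)
import Data.Nat.Properties as ℕ
open import Data.Product using (Σ; ∃; ∃₂; _×_; _,_)
open import Data.Rational as ℚ using (ℚ; 0ℚ; 1ℚ; ½; _/_)
import Data.Rational.Properties as ℚ
open import Data.Rational.Solver using (module +-*-Solver)
open import Data.Sum using (_⊎_; inj₁; inj₂)
open import Data.Unit using (⊤; tt)
open import Data.Vec using (Vec; lookup)
open import Data.Vec.Functional using (Vector; foldr)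
open import Function.Bundles using (_⇔_; mk⇔)
open import Level using (0ℓ)
open import Relation.Binary.Core using (Rel)
open import Relation.Binary.Definitions using (Symmetric; Irreflexive; Decidable)
open import Relation.Binary.PropositionalEquality
  using (_≡_; refl; sym; cong; cong₂; subst; module ≡-Reasoning)
open import Relation.Nullary using (yes; no; ¬_)
open import Relation.Unary using (Pred)

-- Real numbers: Cauchy sequences of rationals, with setoid equality _≈_.
record ℝ : Set where
  constructor mkℝ
  field
    seq    : ℕ → ℚ
    cauchy : ∀ ε → 0ℚ ℚ.< ε → ∃ λ N → ∀ m n → N ℕ.≤ m → N ℕ.≤ n →
             ℚ.∣ seq m ℚ.- seq n ∣ ℚ.< ε

open ℝ public

infix 4 _≈_ _≤_ _<_ _#_

_≈_ : Rel ℝ 0ℓ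
x ≈ y = ∀ ε → 0ℚ ℚ.< ε → ∃ λ N → ∀ n → N ℕ.≤ n →
        ℚ.∣ seq x n ℚ.- seq y n ∣ ℚ.< ε

_≤_ : Rel ℝ 0ℓ
x ≤ y = ∀ ε → 0ℚ ℚ.< ε → ∃ λ N → ∀ n → N ℕ.≤ n →
        seq x n ℚ.< seq y n ℚ.+ ε

_<_ : Rel ℝ 0ℓ
x < y = ∃ λ ε → 0ℚ ℚ.< ε × ∃ λ N → ∀ n → N ℕ.≤ n →
        seq x n ℚ.+ ε ℚ.< seq y n

-- Apartness; classically this is ¬ (x ≈ y).
_#_ : Rel ℝ 0ℓ
x # y = x < y ⊎ y < x

private
  half>0 : ∀ {ε} → 0ℚ ℚ.< ε → 0ℚ ℚ.< ε ℚ.* ½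
  half>0 {ε} 0<ε = subst (ℚ._< ε ℚ.* ½) (ℚ.*-zeroˡ ½) (ℚ.*-monoˡ-<-pos ½ 0<ε)

  half+half : ∀ ε → ε ℚ.* ½ ℚ.+ ε ℚ.* ½ ≡ ε
  half+half = solve 1 (λ ε → ε :* con ½ :+ ε :* con ½ := ε) refl
    where open +-*-Solver

  -- δ = (ε/2)/B
  scaled : ∀ ε B → 0ℚ ℚ.< ε → 0ℚ ℚ.< B →
           ∃ λ δ → 0ℚ ℚ.< δ × B ℚ.* δ ≡ ε ℚ.* ½
  scaled ε B 0<ε 0<B = δ , 0<δ , Bδ
    where
    instance
      B⁺ : ℚ.Positive B
      B⁺ = ℚ.positive 0<B
      B≢0 : ℚ.NonZero B
      B≢0 = ℚ.pos⇒nonZero B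
      B⁻¹⁺ : ℚ.Positive (ℚ.1/ B)
      B⁻¹⁺ = ℚ.1/pos⇒pos B
    δ : ℚ
    δ = (ℚ.1/ B) ℚ.* (ε ℚ.* ½)
    0<δ : 0ℚ ℚ.< δ
    0<δ = subst (ℚ._< δ) (ℚ.*-zeroʳ (ℚ.1/ B)) (ℚ.*-monoʳ-<-pos (ℚ.1/ B) (half>0 0<ε))
    Bδ : B ℚ.* δ ≡ ε ℚ.* ½
    Bδ = begin
      B ℚ.* ((ℚ.1/ B) ℚ.* (ε ℚ.* ½))  ≡⟨ ℚ.*-assoc B (ℚ.1/ B) (ε ℚ.* ½) ⟨
      B ℚ.* (ℚ.1/ B) ℚ.* (ε ℚ.* ½)    ≡⟨ cong (ℚ._* (ε ℚ.* ½)) (ℚ.*-inverseʳ B) ⟩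
      1ℚ ℚ.* (ε ℚ.* ½)                ≡⟨ ℚ.*-identityˡ (ε ℚ.* ½) ⟩
      ε ℚ.* ½                         ∎
      where open ≡-Reasoning

  eventually-bounded : ∀ x → ∃₂ λ B N → 0ℚ ℚ.< B ×
                       (∀ n → N ℕ.≤ n → ℚ.∣ seq x n ∣ ℚ.≤ B)
  eventually-bounded x with cauchy x 1ℚ (ℚ.positive⁻¹ 1ℚ)
  ... | N , close = 1ℚ ℚ.+ ℚ.∣ seq x N ∣ , N
      , ℚ.+-mono-<-≤ (ℚ.positive⁻¹ 1ℚ) (ℚ.0≤∣p∣ (seq x N)) , bound
    where
    open ℚ.≤-Reasoning
    bound : ∀ n → N ℕ.≤ n → ℚ.∣ seq x n ∣ ℚ.≤ 1ℚ ℚ.+ ℚ.∣ seq x N ∣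
    bound n N≤n = begin
      ℚ.∣ seq x n ∣
        ≡⟨ cong ℚ.∣_∣ (solve 2 (λ a b → a := (a :- b) :+ b) refl (seq x n) (seq x N)) ⟩
      ℚ.∣ (seq x n ℚ.- seq x N) ℚ.+ seq x N ∣
        ≤⟨ ℚ.∣p+q∣≤∣p∣+∣q∣ (seq x n ℚ.- seq x N) (seq x N) ⟩
      ℚ.∣ seq x n ℚ.- seq x N ∣ ℚ.+ ℚ.∣ seq x N ∣
        ≤⟨ ℚ.+-monoˡ-≤ ℚ.∣ seq x N ∣ (ℚ.<⇒≤ (close n N N≤n ℕ.≤-refl)) ⟩
      1ℚ ℚ.+ ℚ.∣ seq x N ∣ ∎
      where open +-*-Solver

fromℚ : ℚ → ℝ
fromℚ q = mkℝ (λ _ → q) λ ε 0<ε → 0 , λ _ _ _ _ →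
  subst (λ d → ℚ.∣ d ∣ ℚ.< ε) (sym (ℚ.+-inverseʳ q)) 0<ε

fromℤ : ℤ → ℝ
fromℤ i = fromℚ (i / 1)

0ᴿ 1ᴿ : ℝ
0ᴿ = fromℚ 0ℚ
1ᴿ = fromℚ 1ℚ

infixl 6 _+ᴿ_ _-ᴿ_
infixl 7 _*ᴿ_
infix  8 -ᴿ_

_+ᴿ_ : ℝ → ℝ → ℝ
seq    (x +ᴿ y) n = seq x n ℚ.+ seq y n
cauchy (x +ᴿ y) ε 0<ε
  with cauchy x (ε ℚ.* ½) (half>0 0<ε) | cauchy y (ε ℚ.* ½) (half>0 0<ε)
... | M , x-close | N , y-close = M ⊔ N , λ m n K≤m K≤n → begin-strict
  ℚ.∣ (seq x m ℚ.+ seq y m) ℚ.- (seq x n ℚ.+ seq y n) ∣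
    ≡⟨ cong ℚ.∣_∣ (solve 4 (λ a b c d → (a :+ b) :- (c :+ d) := (a :- c) :+ (b :- d))
                     refl (seq x m) (seq y m) (seq x n) (seq y n)) ⟩
  ℚ.∣ (seq x m ℚ.- seq x n) ℚ.+ (seq y m ℚ.- seq y n) ∣
    ≤⟨ ℚ.∣p+q∣≤∣p∣+∣q∣ (seq x m ℚ.- seq x n) (seq y m ℚ.- seq y n) ⟩
  ℚ.∣ seq x m ℚ.- seq x n ∣ ℚ.+ ℚ.∣ seq y m ℚ.- seq y n ∣
    <⟨ ℚ.+-mono-< (x-close m n (ℕ.m⊔n≤o⇒m≤o M N K≤m) (ℕ.m⊔n≤o⇒m≤o M N K≤n))
                  (y-close m n (ℕ.m⊔n≤o⇒n≤o M N K≤m) (ℕ.m⊔n≤o⇒n≤o M N K≤n)) ⟩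
  ε ℚ.* ½ ℚ.+ ε ℚ.* ½
    ≡⟨ half+half ε ⟩
  ε ∎
  where open ℚ.≤-Reasoning
        open +-*-Solver

-ᴿ_ : ℝ → ℝ
seq    (-ᴿ x) n = ℚ.- seq x n
cauchy (-ᴿ x) ε 0<ε with cauchy x ε 0<ε
... | N , close = N , λ m n N≤m N≤n → begin-strict
  ℚ.∣ (ℚ.- seq x m) ℚ.- (ℚ.- seq x n) ∣
    ≡⟨ cong ℚ.∣_∣ (solve 2 (λ a b → (:- a) :- (:- b) := b :- a) refl (seq x m) (seq x n)) ⟩
  ℚ.∣ seq x n ℚ.- seq x m ∣
    <⟨ close n m N≤n N≤m ⟩
  ε ∎
  where open ℚ.≤-Reasoning
        open +-*-Solver

_-ᴿ_ : ℝ → ℝ → ℝ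
x -ᴿ y = x +ᴿ (-ᴿ y)

private
  ∣p*q∣-bound : ∀ p q P Q → 0ℚ ℚ.< P → ℚ.∣ p ∣ ℚ.≤ P → ℚ.∣ q ∣ ℚ.< Q →
                ℚ.∣ p ℚ.* q ∣ ℚ.< P ℚ.* Q
  ∣p*q∣-bound p q P Q 0<P p≤P q<Q = begin-strict
    ℚ.∣ p ℚ.* q ∣          ≡⟨ ℚ.∣p*q∣≡∣p∣*∣q∣ p q ⟩
    ℚ.∣ p ∣ ℚ.* ℚ.∣ q ∣    ≤⟨ ℚ.*-monoʳ-≤-nonNeg ℚ.∣ q ∣ {{ℚ.nonNegative (ℚ.0≤∣p∣ q)}} p≤P ⟩
    P ℚ.* ℚ.∣ q ∣          <⟨ ℚ.*-monoʳ-<-pos P {{ℚ.positive 0<P}} q<Q ⟩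
    P ℚ.* Q                ∎
    where open ℚ.≤-Reasoning

  split-product : ∀ a b c d →
    a ℚ.* b ℚ.- c ℚ.* d ≡ a ℚ.* (b ℚ.- d) ℚ.+ d ℚ.* (a ℚ.- c)
  split-product = solve 4
    (λ a b c d → a :* b :- c :* d := a :* (b :- d) :+ d :* (a :- c)) refl
    where open +-*-Solver

  product-close : ∀ ε B C δ₁ δ₂ a b c d → 0ℚ ℚ.< B → 0ℚ ℚ.< C →
    C ℚ.* δ₁ ≡ ε ℚ.* ½ → B ℚ.* δ₂ ≡ ε ℚ.* ½ →
    ℚ.∣ a ∣ ℚ.≤ B → ℚ.∣ d ∣ ℚ.≤ C → ℚ.∣ a ℚ.- c ∣ ℚ.< δ₁ → ℚ.∣ b ℚ.- d ∣ ℚ.< δ₂ →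
    ℚ.∣ a ℚ.* b ℚ.- c ℚ.* d ∣ ℚ.< ε
  product-close ε B C δ₁ δ₂ a b c d 0<B 0<C Cδ₁ Bδ₂ a≤B d≤C ac bd = begin-strict
    ℚ.∣ a ℚ.* b ℚ.- c ℚ.* d ∣
      ≡⟨ cong ℚ.∣_∣ (split-product a b c d) ⟩
    ℚ.∣ a ℚ.* (b ℚ.- d) ℚ.+ d ℚ.* (a ℚ.- c) ∣
      ≤⟨ ℚ.∣p+q∣≤∣p∣+∣q∣ (a ℚ.* (b ℚ.- d)) (d ℚ.* (a ℚ.- c)) ⟩
    ℚ.∣ a ℚ.* (b ℚ.- d) ∣ ℚ.+ ℚ.∣ d ℚ.* (a ℚ.- c) ∣
      <⟨ ℚ.+-mono-< (∣p*q∣-bound a (b ℚ.- d) B δ₂ 0<B a≤B bd)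
                    (∣p*q∣-bound d (a ℚ.- c) C δ₁ 0<C d≤C ac) ⟩
    B ℚ.* δ₂ ℚ.+ C ℚ.* δ₁
      ≡⟨ cong₂ ℚ._+_ Bδ₂ Cδ₁ ⟩
    ε ℚ.* ½ ℚ.+ ε ℚ.* ½
      ≡⟨ half+half ε ⟩
    ε ∎
    where open ℚ.≤-Reasoning

_*ᴿ_ : ℝ → ℝ → ℝ
seq    (x *ᴿ y) n = seq x n ℚ.* seq y n
cauchy (x *ᴿ y) ε 0<ε =
  let B , M₁ , 0<B , x-bound = eventually-bounded x
      C , M₂ , 0<C , y-bound = eventually-bounded y
      δ₁ , 0<δ₁ , Cδ₁ = scaled ε C 0<ε 0<C
      δ₂ , 0<δ₂ , Bδ₂ = scaled ε B 0<ε 0<B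
      N₁ , x-close = cauchy x δ₁ 0<δ₁
      N₂ , y-close = cauchy y δ₂ 0<δ₂
      M = M₁ ⊔ M₂
      N = N₁ ⊔ N₂
  in M ⊔ N , λ m n K≤m K≤n →
    let M≤m = ℕ.m⊔n≤o⇒m≤o M N K≤m
        M≤n = ℕ.m⊔n≤o⇒m≤o M N K≤n
        N≤m = ℕ.m⊔n≤o⇒n≤o M N K≤m
        N≤n = ℕ.m⊔n≤o⇒n≤o M N K≤n
    in product-close ε B C δ₁ δ₂ (seq x m) (seq y m) (seq x n) (seq y n)
         0<B 0<C Cδ₁ Bδ₂
         (x-bound m (ℕ.m⊔n≤o⇒m≤o M₁ M₂ M≤m))
         (y-bound n (ℕ.m⊔n≤o⇒n≤o M₁ M₂ M≤n))
         (x-close m n (ℕ.m⊔n≤o⇒m≤o N₁ N₂ N≤m) (ℕ.m⊔n≤o⇒m≤o N₁ N₂ N≤n))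
         (y-close m n (ℕ.m⊔n≤o⇒n≤o N₁ N₂ N≤m) (ℕ.m⊔n≤o⇒n≤o N₁ N₂ N≤n))

∑ᴿ : ∀ {n} → Vector ℝ n → ℝ
∑ᴿ = foldr _+ᴿ_ 0ᴿ

record ℂ : Set where
  constructor _+i_
  field
    re im : ℝ

open ℂ public

infix 4 _≈ᶜ_ _#ᶜ_
infix 5 _+i_

_≈ᶜ_ _#ᶜ_ : Rel ℂ 0ℓ
z ≈ᶜ w = re z ≈ re w × im z ≈ im w
z #ᶜ w = re z # re w ⊎ im z # im w

fromℝ : ℝ → ℂ
fromℝ x = x +i 0ᴿ

0ᶜ 1ᶜ 𝕚 : ℂ
0ᶜ = fromℝ 0ᴿ
1ᶜ = fromℝ 1ᴿ
𝕚  = 0ᴿ +i 1ᴿ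

infixl 6 _+ᶜ_
infixl 7 _*ᶜ_
infix  8 -ᶜ_

_+ᶜ_ _*ᶜ_ : ℂ → ℂ → ℂ
z +ᶜ w = (re z +ᴿ re w) +i (im z +ᴿ im w)
z *ᶜ w = (re z *ᴿ re w -ᴿ im z *ᴿ im w) +i (re z *ᴿ im w +ᴿ im z *ᴿ re w)

-ᶜ_ : ℂ → ℂ
-ᶜ z = (-ᴿ re z) +i (-ᴿ im z)

-- ℂ[x]: coefficient lists, constant term first; trailing zeros are
-- allowed, and equality is coefficientwise.
ℂ[x] : Set
ℂ[x] = List ℂ

coeff : ℂ[x] → ℕ → ℂ
coeff []      _       = 0ᶜ
coeff (a ∷ _) zero    = a
coeff (_ ∷ p) (suc k) = coeff p k

infix 4 _≈ₚ_

_≈ₚ_ : Rel ℂ[x] 0ℓ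
p ≈ₚ q = ∀ k → coeff p k ≈ᶜ coeff q k

eval : ℂ[x] → ℂ → ℂ
eval []      _ = 0ᶜ
eval (a ∷ p) z = a +ᶜ z *ᶜ eval p z

infixl 6 _+ₚ_
infixl 7 _*ₚ_ _·ₚ_

_+ₚ_ : ℂ[x] → ℂ[x] → ℂ[x]
[]      +ₚ q       = q
(a ∷ p) +ₚ []      = a ∷ p
(a ∷ p) +ₚ (b ∷ q) = (a +ᶜ b) ∷ (p +ₚ q)

_·ₚ_ : ℂ → ℂ[x] → ℂ[x]
c ·ₚ p = map (c *ᶜ_) p

_*ₚ_ : ℂ[x] → ℂ[x] → ℂ[x]
[]      *ₚ q = []
(a ∷ p) *ₚ q = (a ·ₚ q) +ₚ (0ᶜ ∷ (p *ₚ q))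

1ₚ : ℂ[x]
1ₚ = 1ᶜ ∷ []

∏ₚ : ∀ {n} → Vector ℂ[x] n → ℂ[x]
∏ₚ = foldr _*ₚ_ 1ₚ

x-_ : ℂ → ℂ[x]
x- z = (-ᶜ z) ∷ 1ᶜ ∷ []

HasDegree : ℂ[x] → ℕ → Set
HasDegree f m = coeff f m #ᶜ 0ᶜ × (∀ k → m ℕ.< k → coeff f k ≈ᶜ 0ᶜ)

-- f has degree m, and z lists the zeros of f with multiplicity.
record HasZeros (f : ℂ[x]) {m : ℕ} (z : Vector ℂ m) : Set where
  field
    degree        : HasDegree f m
    factorisation : f ≈ₚ coeff f m ·ₚ ∏ₚ (λ i → x- z i)

record Line : Set where
  field
    α β : ℂ
    β≠0 : β #ᶜ 0ᶜ

  point : ℝ → ℂ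
  point t = α +ᶜ fromℝ t *ᶜ β

open Line using (point)

infix 4 _∈ᴸ_

_∈ᴸ_ : ℂ → Line → Set
z ∈ᴸ L = ∃ λ t → z ≈ᶜ point L t

-- g L-interlaces f.  Quantifying over the enumerations t and s absorbs
-- the relabelling; deg f = suc k and deg g = k are part of HasZeros.
_Interlaces[_]_ : ℂ[x] → Line → ℂ[x] → Set
g Interlaces[ L ] f =
  ∃ λ k → Σ (Vector ℝ (suc k)) λ t → Σ (Vector ℝ k) λ s →
    HasZeros f (λ i → point L (t i)) ×
    HasZeros g (λ i → point L (s i)) ×
    (∀ i → t (inject₁ i) ≤ s i × s i ≤ t (Fin.suc i))

-½ : ℝ
-½ = fromℚ (ℚ.- ½)

Re=-½ : Line
Re=-½ = record
  { α   = fromℝ -½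
  ; β   = 𝕚
  ; β≠0 = inj₂ (inj₂ (½ , ℚ.positive⁻¹ ½ , 0 , λ _ _ →
            ℚ.+-monoʳ-< ½ {0ℚ} {½} (ℚ.positive⁻¹ ½)))
  }

private
  ≈-pointwise : ∀ x y → (∀ n → seq x n ≡ seq y n) → x ≈ y
  ≈-pointwise x y eq ε 0<ε = 0 , λ n _ →
    subst (λ q → ℚ.∣ seq x n ℚ.- q ∣ ℚ.< ε) (eq n)
      (subst (λ d → ℚ.∣ d ∣ ℚ.< ε) (sym (ℚ.+-inverseʳ (seq x n))) 0<ε)

-- The line really is {z ∣ Re z = -1/2}.
∈Re=-½ : ∀ z → z ∈ᴸ Re=-½ ⇔ re z ≈ -½
∈Re=-½ z = mk⇔ to from
  where
  open +-*-Solver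
  re-eq : ∀ q → ℚ.- ½ ℚ.+ (q ℚ.* 0ℚ ℚ.- 0ℚ ℚ.* 1ℚ) ≡ ℚ.- ½
  re-eq = solve 1 (λ q → con (ℚ.- ½) :+ (q :* con 0ℚ :- con 0ℚ :* con 1ℚ)
                           := con (ℚ.- ½)) refl
  im-eq : ∀ q → q ≡ 0ℚ ℚ.+ (q ℚ.* 1ℚ ℚ.+ 0ℚ ℚ.* 0ℚ)
  im-eq = solve 1 (λ q → q := con 0ℚ :+ (q :* con 1ℚ :+ con 0ℚ :* con 0ℚ)) refl
  to : z ∈ᴸ Re=-½ → re z ≈ -½
  to (t , eq , _) ε 0<ε with eq ε 0<ε
  ... | N , close = N , λ n N≤n →
    subst (λ q → ℚ.∣ seq (re z) n ℚ.- q ∣ ℚ.< ε) (re-eq (seq t n)) (close n N≤n)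
  from : re z ≈ -½ → z ∈ᴸ Re=-½
  from eq = im z , re≈ , ≈-pointwise (im z) (im (point Re=-½ (im z))) (λ n → im-eq (seq (im z) n))
    where
    re≈ : re z ≈ re (point Re=-½ (im z))
    re≈ ε 0<ε with eq ε 0<ε
    ... | N , close = N , λ n N≤n →
      subst (λ q → ℚ.∣ seq (re z) n ℚ.- q ∣ ℚ.< ε)
        (sym (re-eq (seq (im z) n))) (close n N≤n)

record Graph : Set₁ where
  field
    order  : ℕ
    Adj    : Rel (Fin order) 0ℓ
    adj?   : Decidable Adj
    symm   : Symmetric Adj
    irrefl : Irreflexive _≡_ Adj

Opposite : ∀ {A B : Set} → Rel (A ⊎ B) 0ℓ
Opposite (inj₁ _) (inj₁ _) = ⊥
Opposite (inj₁ _) (inj₂ _) = ⊤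
Opposite (inj₂ _) (inj₁ _) = ⊤
Opposite (inj₂ _) (inj₂ _) = ⊥

opposite? : ∀ {A B : Set} → Decidable (Opposite {A} {B})
opposite? (inj₁ _) (inj₁ _) = no λ ()
opposite? (inj₁ _) (inj₂ _) = yes tt
opposite? (inj₂ _) (inj₁ _) = yes tt
opposite? (inj₂ _) (inj₂ _) = no λ ()

opposite-sym : ∀ {A B : Set} → Symmetric (Opposite {A} {B})
opposite-sym {x = inj₁ _} {inj₂ _} _ = tt
opposite-sym {x = inj₂ _} {inj₁ _} _ = tt

opposite-irrefl : ∀ {A B : Set} (x : A ⊎ B) → ¬ Opposite x x
opposite-irrefl (inj₁ _) ()
opposite-irrefl (inj₂ _) ()

-- The complete bipartite graph; the parts are the first a and the last
-- b elements of Fin (a + b).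
K : ℕ → ℕ → Graph
K a b = record
  { order  = a ℕ.+ b
  ; Adj    = λ u v → Opposite (splitAt a u) (splitAt a v)
  ; adj?   = λ u v → opposite? (splitAt a u) (splitAt a v)
  ; symm   = λ {u} {v} → opposite-sym {x = splitAt a u} {splitAt a v}
  ; irrefl = λ { {u} refl → opposite-irrefl (splitAt a u) }
  }

infix 4 _≈ᵛ_

_≈ᵛ_ : ∀ {n} → Rel (Vector ℝ n) 0ℓ
x ≈ᵛ y = ∀ u → x u ≈ y u

ConvexHull : ∀ {n} → Pred (Vector ℝ n) 0ℓ → Pred (Vector ℝ n) 0ℓ
ConvexHull {n} S x =
  ∃ λ k → Σ (Vector ℝ k) λ c → Σ (Vector (Vector ℝ n) k) λ p →
    (∀ j → 0ᴿ ≤ c j) × ∑ᴿ c ≈ 1ᴿ × (∀ j → S (p j)) ×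
    x ≈ᵛ (λ u → ∑ᴿ (λ j → c j *ᴿ p j u))

e : ∀ {n} → Fin n → Vector ℝ n
e v u with v Fin.≟ u
... | yes _ = 1ᴿ
... | no  _ = 0ᴿ

module _ (G : Graph) where
  open Graph G

  EdgeVector : Pred (Vector ℝ order) 0ℓ
  EdgeVector x = ∃₂ λ v w → Adj v w × x ≈ᵛ (λ u → e v u -ᴿ e w u)

  SymmetricEdgePolytope : Pred (Vector ℝ order) 0ℓ
  SymmetricEdgePolytope = ConvexHull EdgeVector

Dilate : ∀ {n} → ℕ → Pred (Vector ℝ n) 0ℓ → Pred (Vector ℝ n) 0ℓ
Dilate s P x = ∃ λ y → P y × x ≈ᵛ (λ u → fromℤ (+ s) *ᴿ y u)

LatticePoint : ∀ {n} → Pred (Vector ℝ n) 0ℓ → Pred (Vec ℤ n) 0ℓ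
LatticePoint P x = P (λ u → fromℤ (lookup x u))

HasCardinality : {A : Set} → Pred A 0ℓ → ℕ → Set
HasCardinality {A} S N = Σ (List A) λ xs →
  Unique xs × (∀ x → x ∈ xs ⇔ S x) × length xs ≡ N

IsEhrhartPolynomial : Graph → ℂ[x] → Set
IsEhrhartPolynomial G H = ∀ (s : ℕ) → ∃ λ N →
  HasCardinality (LatticePoint (Dilate s (SymmetricEdgePolytope G))) N ×
  eval H (fromℝ (fromℤ (+ s))) ≈ᶜ fromℝ (fromℤ (+ N))

{-# OPTIONS --safe #-}

-- The polytope of K(1,n) is a cross-polytope: its s-th dilate contains an
-- integer point x exactly when Σ x = 0 and Σ_{i ≥ 1} |x_i| ≤ s.  Hence H_{1,n}(s)
-- is a Delannoy number, and h_n = n! · H_{1,n} satisfies h₀ = 1, h₁ = 2x + 1 and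
--   h_{n+2} = (2x + 1) h_{n+1} + (n + 1)² h_n.
-- Substituting x = −1/2 + it turns h_n into iⁿ p_n(t), where the p_n are real with
--   p_{n+2} = 2t p_{n+1} − (n + 1)² p_n.
-- At a root of p_{n+1} the sign of p_{n+2} is opposite to that of p_n, so the
-- intermediate value theorem, applied between consecutive roots of p_{n+1} and
-- outside the extreme ones, produces n + 2 roots of p_{n+2} that interlace those
-- of p_{n+1}.  A polynomial is determined by its values at the naturals and, up
-- to its leading coefficient, by deg-many distinct roots, which transfers this
-- to any Ehrhart polynomial of K(1,n).

module Submission where

open import Algebra.Bundles using (CommutativeRing)
import Algebra.Properties.Semiring.Sum
import Algebra.Solver.Ring
open import Algebra.Solver.Ring.AlmostCommutativeRing
  using (_-Raw-AlmostCommutative⟶_; fromCommutativeRing)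
open import Algebra.Structures using (IsGroup; IsAbelianGroup; IsRing)
open import Data.Fin as Fin using (Fin; zero; suc; toℕ; fromℕ<; inject₁)
import Data.Fin.Properties as Fin
open import Data.Integer as ℤ using (ℤ; +_; -[1+_])
import Data.Integer.Properties as ℤ
open import Data.List using (List; []; _∷_; _++_; length; map)
open import Data.Nat as ℕ using (ℕ; zero; suc; z≤n; s≤s)
import Data.Nat.Properties as ℕ
open import Data.Product using (∃; ∃₂; _×_; _,_; proj₁; proj₂)
open import Data.Rational as ℚ using (ℚ; 0ℚ; 1ℚ; ½)
import Data.Rational.Properties as ℚ
open import Data.Sum using (_⊎_; inj₁; inj₂)
open import Data.Vec using (Vec; []; _∷_; lookup)
open import Data.Vec.Functional using (Vector; foldr; tail)
open import Function using (_∘_)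
open import Function.Bundles using (_⇔_; mk⇔; Equivalence)
open import Level using (0ℓ)
import Relation.Binary.Reasoning.Setoid
open import Relation.Binary.PropositionalEquality as ≡ using (_≡_; _≢_)
open import Relation.Nullary using (¬_; Dec; yes; no; contradiction)
open import Relation.Unary using (Pred)

-- Order and equality of these reals are undecidable, and this shapes the proof. Signs are carried
-- as rational margins (`Pos`) instead of being decided, and interlacing is kept strict throughout
-- the induction: strict inequalities make differences of roots cancellable (`Regular`), which
-- stands in for the absence of zero divisors. Bisection still works because the p_n have rational
-- coefficients, so their signs at rational points are decidable.
--
-- An arbitrary complex zero z is never matched with one of the known zeros. If Re z were apart from
-- -1/2, every linear factor would be cancellable at z, which is absurd; and a real that is neither
-- positive nor negative equals 0, so this refutation yields the equation.
--
-- The Delannoy rule steps in n and s together, while the recurrence for h_n keeps s fixed. The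
-- bridge is the identity `delannoy-exchange`.

-- Rational inequalities, null sequences and the embedding of ℤ in ℚ

module Rationals where

  open import Data.Nat using (_⊔_)
  open import Data.Rational using (_/_; ∣_∣; _+_; _*_; _-_; -_; _<_; _≤_)
  open import Data.Rational.Solver using (module +-*-Solver)
  import Data.Rational.Unnormalised as ℚᵘ
  import Data.Rational.Unnormalised.Properties as ℚᵘ
  open ≡ using (refl; sym; trans; cong; cong₂; subst; subst₂)
  open +-*-Solver using (solve; _:+_; _:*_; _:-_; :-_; _:=_; con)

  p<q⇒0<q-p : ∀ {p q} → p < q → 0ℚ < q - p
  p<q⇒0<q-p {p} {q} p<q = subst (_< q - p) (ℚ.+-inverseʳ p) (ℚ.+-monoˡ-< (- p) p<q)

  p≤q⇒0≤q-p : ∀ {p q} → p ≤ q → 0ℚ ≤ q - p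
  p≤q⇒0≤q-p {p} {q} p≤q = subst (_≤ q - p) (ℚ.+-inverseʳ p) (ℚ.+-monoˡ-≤ (- p) p≤q)

  -- The difference is passed as a separate `d`, written in a form that is visibly positive; the
  -- ring solver then proves the equation `d ≡ q - p`.
  0<d⇒p<q : ∀ {p q d} → 0ℚ < d → d ≡ q - p → p < q
  0<d⇒p<q {p} {q} 0<d refl = subst₂ _<_ (ℚ.+-identityˡ p)
    (solve 2 (λ p q → (q :- p) :+ p := q) refl p q) (ℚ.+-monoˡ-< p 0<d)

  0≤d⇒p≤q : ∀ {p q d} → 0ℚ ≤ d → d ≡ q - p → p ≤ q
  0≤d⇒p≤q {p} {q} 0≤d refl = subst₂ _≤_ (ℚ.+-identityˡ p)
    (solve 2 (λ p q → (q :- p) :+ p := q) refl p q) (ℚ.+-monoˡ-≤ p 0≤d)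

  0<p+q : ∀ {p q} → 0ℚ < p → 0ℚ < q → 0ℚ < p + q
  0<p+q 0<p 0<q = ℚ.+-mono-< 0<p 0<q

  0≤p+q : ∀ {p q} → 0ℚ ≤ p → 0ℚ ≤ q → 0ℚ ≤ p + q
  0≤p+q 0≤p 0≤q = ℚ.+-mono-≤ 0≤p 0≤q

  0<p*q : ∀ {p q} → 0ℚ < p → 0ℚ < q → 0ℚ < p * q
  0<p*q {p} {q} 0<p 0<q = ℚ.positive⁻¹ (p * q) {{ℚ.pos*pos⇒pos p {{ℚ.positive 0<p}} q {{ℚ.positive 0<q}}}}

  0≤p*q : ∀ {p q} → 0ℚ ≤ p → 0ℚ ≤ q → 0ℚ ≤ p * q
  0≤p*q {p} {q} 0≤p 0≤q = ℚ.nonNegative⁻¹ (p * q)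
    {{ℚ.nonNeg*nonNeg⇒nonNeg p {{ℚ.nonNegative 0≤p}} q {{ℚ.nonNegative 0≤q}}}}

  0≤p² : ∀ p → 0ℚ ≤ p * p
  0≤p² p with ℚ.≤-total 0ℚ p
  ... | inj₁ 0≤p = 0≤p*q 0≤p 0≤p
  ... | inj₂ p≤0 = subst (0ℚ ≤_) (solve 1 (λ p → (:- p) :* (:- p) := p :* p) refl p)
                     (0≤p*q (ℚ.neg-antimono-≤ p≤0) (ℚ.neg-antimono-≤ p≤0))

  0<½ : 0ℚ < ½
  0<½ = ℚ.positive⁻¹ ½

  0<1 : 0ℚ < 1ℚ
  0<1 = ℚ.positive⁻¹ 1ℚ

  2ℚ : ℚ
  2ℚ = 1ℚ + 1ℚ

  0<2 : 0ℚ < 2ℚ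
  0<2 = ℚ.positive⁻¹ 2ℚ

  0<p*½ : ∀ {p} → 0ℚ < p → 0ℚ < p * ½
  0<p*½ 0<p = 0<p*q 0<p 0<½

  p*½+p*½≡p : ∀ p → p * ½ + p * ½ ≡ p
  p*½+p*½≡p = solve 1 (λ p → p :* con ½ :+ p :* con ½ := p) refl

  recip : ∀ p → 0ℚ < p → ∃ λ r → 0ℚ < r × p * r ≡ 1ℚ
  recip p 0<p = ℚ.1/ p , ℚ.positive⁻¹ (ℚ.1/ p) {{ℚ.1/pos⇒pos p}} , ℚ.*-inverseʳ p
    where
    instance
      p⁺ : ℚ.Positive p
      p⁺ = ℚ.positive 0<p
      p≢0 : ℚ.NonZero p
      p≢0 = ℚ.pos⇒nonZero p

  p≤∣p∣ : ∀ p → p ≤ ∣ p ∣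
  p≤∣p∣ p with ℚ.≤-total 0ℚ p
  ... | inj₁ 0≤p = ℚ.≤-reflexive (sym (ℚ.0≤p⇒∣p∣≡p 0≤p))
  ... | inj₂ p≤0 = ℚ.≤-trans p≤0 (ℚ.0≤∣p∣ p)

  ∣p∣<q : ∀ {p q} → - q < p → p < q → ∣ p ∣ < q
  ∣p∣<q {p} {q} -q<p p<q with ℚ.∣p∣≡p∨∣p∣≡-p p
  ... | inj₁ eq = subst (_< q) (sym eq) p<q
  ... | inj₂ eq = subst₂ _<_ (sym eq) (solve 1 (λ q → :- (:- q) := q) refl q) (ℚ.neg-antimono-< -q<p)

  ∣p∣<q⇒p<q : ∀ {p q} → ∣ p ∣ < q → p < q
  ∣p∣<q⇒p<q {p} = ℚ.≤-<-trans (p≤∣p∣ p)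

  ∣p∣<q⇒-q<p : ∀ {p q} → ∣ p ∣ < q → - q < p
  ∣p∣<q⇒-q<p {p} {q} h = subst (- q <_) (solve 1 (λ p → :- (:- p) := p) refl p)
    (ℚ.neg-antimono-< (∣p∣<q⇒p<q (subst (_< q) (sym (ℚ.∣-p∣≡∣p∣ p)) h)))

  Eventually : (ℕ → Set) → Set
  Eventually P = ∃ λ N → ∀ n → N ℕ.≤ n → P n

  always : ∀ {P} → (∀ n → P n) → Eventually P
  always p = 0 , λ n _ → p n

  eventually-map : ∀ {P Q : ℕ → Set} → (∀ n → P n → Q n) → Eventually P → Eventually Q
  eventually-map f (N , p) = N , λ n N≤n → f n (p n N≤n)

  eventually-zip : ∀ {P Q S : ℕ → Set} → (∀ n → P n → Q n → S n) →
                   Eventually P → Eventually Q → Eventually S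
  eventually-zip f (M , p) (N , q) = M ⊔ N , λ n K≤n →
    f n (p n (ℕ.m⊔n≤o⇒m≤o M N K≤n)) (q n (ℕ.m⊔n≤o⇒n≤o M N K≤n))

  eventually-witness : ∀ {P : ℕ → Set} → Eventually P → ∃ P
  eventually-witness (N , p) = N , p N ℕ.≤-refl

  Small : (ℕ → ℚ) → Set
  Small s = ∀ ε → 0ℚ < ε → Eventually λ n → ∣ s n ∣ < ε

  Bounded : (ℕ → ℚ) → Set
  Bounded s = ∃ λ B → 0ℚ < B × Eventually λ n → ∣ s n ∣ ≤ B

  small-resp : ∀ {s t} → (∀ n → s n ≡ t n) → Small s → Small t
  small-resp eq small ε 0<ε = eventually-map (λ n → subst (λ q → ∣ q ∣ < ε) (eq n)) (small ε 0<ε)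

  small-0 : Small λ _ → 0ℚ
  small-0 ε 0<ε = always λ _ → 0<ε

  small-+ : ∀ {s t} → Small s → Small t → Small λ n → s n + t n
  small-+ {s} {t} s-small t-small ε 0<ε = eventually-zip
    (λ n s<ε t<ε → ℚ.≤-<-trans (ℚ.∣p+q∣≤∣p∣+∣q∣ (s n) (t n))
      (subst (∣ s n ∣ + ∣ t n ∣ <_) (p*½+p*½≡p ε) (ℚ.+-mono-< s<ε t<ε)))
    (s-small (ε * ½) (0<p*½ 0<ε)) (t-small (ε * ½) (0<p*½ 0<ε))

  small-neg : ∀ {s} → Small s → Small λ n → - s n
  small-neg {s} small ε 0<ε =
    eventually-map (λ n → subst (_< ε) (sym (ℚ.∣-p∣≡∣p∣ (s n)))) (small ε 0<ε)

  ∣p*q∣< : ∀ {p q B δ} → 0ℚ < B → ∣ p ∣ ≤ B → ∣ q ∣ < δ → ∣ p * q ∣ < B * δ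
  ∣p*q∣< {p} {q} {B} {δ} 0<B p≤B q<δ = begin-strict
    ∣ p * q ∣      ≡⟨ ℚ.∣p*q∣≡∣p∣*∣q∣ p q ⟩
    ∣ p ∣ * ∣ q ∣  ≤⟨ ℚ.*-monoʳ-≤-nonNeg ∣ q ∣ {{ℚ.nonNegative (ℚ.0≤∣p∣ q)}} p≤B ⟩
    B * ∣ q ∣      <⟨ ℚ.*-monoʳ-<-pos B {{ℚ.positive 0<B}} q<δ ⟩
    B * δ          ∎
    where open ℚ.≤-Reasoning

  small-* : ∀ {s t} → Bounded s → Small t → Small λ n → s n * t n
  small-* (B , 0<B , s≤B) small ε 0<ε with recip B 0<B
  ... | r , 0<r , Br≡1 = eventually-zip
    (λ n s≤B t<δ → subst (_ <_) eq (∣p*q∣< 0<B s≤B t<δ)) s≤B (small (r * ε) (0<p*q 0<r 0<ε))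
    where
    eq : B * (r * ε) ≡ ε
    eq = trans (sym (ℚ.*-assoc B r ε)) (trans (cong (_* ε) Br≡1) (ℚ.*-identityˡ ε))

  ι : ℤ → ℚ
  ι i = i / 1

  private
    toℚᵘ-ι : ∀ i → ℚ.toℚᵘ (ι i) ℚᵘ.≃ ℚᵘ.mkℚᵘ i 0
    toℚᵘ-ι i = ℚ.toℚᵘ-fromℚᵘ (ℚᵘ.mkℚᵘ i 0)

  ι-+ : ∀ i j → ι (i ℤ.+ j) ≡ ι i + ι j
  ι-+ i j = ℚ.toℚᵘ-injective (begin
    ℚ.toℚᵘ (ι (i ℤ.+ j))                ≈⟨ toℚᵘ-ι (i ℤ.+ j) ⟩
    ℚᵘ.mkℚᵘ (i ℤ.+ j) 0
      ≡⟨ cong (λ k → ℚᵘ.mkℚᵘ k 0) (sym (cong₂ ℤ._+_ (ℤ.*-identityʳ i) (ℤ.*-identityʳ j))) ⟩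
    ℚᵘ.mkℚᵘ i 0 ℚᵘ.+ ℚᵘ.mkℚᵘ j 0        ≈⟨ ℚᵘ.+-cong (toℚᵘ-ι i) (toℚᵘ-ι j) ⟨
    ℚ.toℚᵘ (ι i) ℚᵘ.+ ℚ.toℚᵘ (ι j)      ≈⟨ ℚ.toℚᵘ-homo-+ (ι i) (ι j) ⟨
    ℚ.toℚᵘ (ι i + ι j)                  ∎)
    where open ℚᵘ.≃-Reasoning

  ι-* : ∀ i j → ι (i ℤ.* j) ≡ ι i * ι j
  ι-* i j = ℚ.toℚᵘ-injective (begin
    ℚ.toℚᵘ (ι (i ℤ.* j))                ≈⟨ toℚᵘ-ι (i ℤ.* j) ⟩
    ℚᵘ.mkℚᵘ i 0 ℚᵘ.* ℚᵘ.mkℚᵘ j 0        ≈⟨ ℚᵘ.*-cong (toℚᵘ-ι i) (toℚᵘ-ι j) ⟨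
    ℚ.toℚᵘ (ι i) ℚᵘ.* ℚ.toℚᵘ (ι j)      ≈⟨ ℚ.toℚᵘ-homo-* (ι i) (ι j) ⟨
    ℚ.toℚᵘ (ι i * ι j)                  ∎)
    where open ℚᵘ.≃-Reasoning

  ι-neg : ∀ i → ι (ℤ.- i) ≡ - ι i
  ι-neg i = ℚ.toℚᵘ-injective (begin
    ℚ.toℚᵘ (ι (ℤ.- i))   ≈⟨ toℚᵘ-ι (ℤ.- i) ⟩
    ℚᵘ.- ℚᵘ.mkℚᵘ i 0     ≈⟨ ℚᵘ.-‿cong (toℚᵘ-ι i) ⟨
    ℚᵘ.- ℚ.toℚᵘ (ι i)    ≈⟨ ℚ.toℚᵘ-homo‿- (ι i) ⟨
    ℚ.toℚᵘ (- ι i)       ∎)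
    where open ℚᵘ.≃-Reasoning

  ι-mono-≤ : ∀ {i j} → i ℤ.≤ j → ι i ≤ ι j
  ι-mono-≤ {i} {j} i≤j = ℚ.toℚᵘ-cancel-≤ (begin
    ℚ.toℚᵘ (ι i)   ≃⟨ toℚᵘ-ι i ⟩
    ℚᵘ.mkℚᵘ i 0    ≤⟨ ℚᵘ.*≤* (ℤ.*-monoʳ-≤-nonNeg (+ 1) i≤j) ⟩
    ℚᵘ.mkℚᵘ j 0    ≃⟨ toℚᵘ-ι j ⟨
    ℚ.toℚᵘ (ι j)   ∎)
    where open ℚᵘ.≤-Reasoning

  ι-cancel-≤ : ∀ {i j} → ι i ≤ ι j → i ℤ.≤ j
  ι-cancel-≤ {i} {j} ιi≤ιj = ℤ.*-cancelʳ-≤-pos i j (+ 1) (ℚᵘ.drop-*≤* (begin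
    ℚᵘ.mkℚᵘ i 0    ≃⟨ toℚᵘ-ι i ⟨
    ℚ.toℚᵘ (ι i)   ≤⟨ ℚ.toℚᵘ-mono-≤ ιi≤ιj ⟩
    ℚ.toℚᵘ (ι j)   ≃⟨ toℚᵘ-ι j ⟩
    ℚᵘ.mkℚᵘ j 0    ∎))
    where open ℚᵘ.≤-Reasoning

  ι-suc : ∀ n → ι (+ suc n) ≡ 1ℚ + ι (+ n)
  ι-suc n = ι-+ (+ 1) (+ n)

  0≤ι : ∀ n → 0ℚ ≤ ι (+ n)
  0≤ι n = ι-mono-≤ {+ 0} {+ n} (ℤ.+≤+ z≤n)

  0<ι : ∀ n → 0ℚ < ι (+ suc n)
  0<ι n = ℚ.<-≤-trans 0<1 (ι-mono-≤ {+ 1} {+ suc n} (ℤ.+≤+ (s≤s z≤n)))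

  -- Denominators are at least 1, so the absolute value of the numerator is a bound.
  archimedean : ∀ q → ∃ λ n → q ≤ ι (+ n)
  archimedean (ℚ.mkℚ i d-1 _) = ℤ.∣ i ∣ , ℚ.toℚᵘ-cancel-≤ (begin
    ℚᵘ.mkℚᵘ i d-1              ≤⟨ ℚᵘ.*≤* (le i d-1) ⟩
    ℚᵘ.mkℚᵘ (+ ℤ.∣ i ∣) 0      ≃⟨ toℚᵘ-ι (+ ℤ.∣ i ∣) ⟨
    ℚ.toℚᵘ (ι (+ ℤ.∣ i ∣))     ∎)
    where
    open ℚᵘ.≤-Reasoning
    le : ∀ i d → i ℤ.* + 1 ℤ.≤ + ℤ.∣ i ∣ ℤ.* + suc d
    le (+ n) d = subst₂ ℤ._≤_ (ℤ.pos-* n 1) (ℤ.pos-* n (suc d)) (ℤ.+≤+ (ℕ.*-monoʳ-≤ n (s≤s z≤n)))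
    le -[1+ n ] d = ℤ.≤-trans (ℤ.≤-reflexive (ℤ.*-identityʳ -[1+ n ]))
      (ℤ.≤-trans (ℤ.-≤+ {n} {0}) (subst (+ 0 ℤ.≤_) (ℤ.pos-* (suc n) (suc d)) (ℤ.+≤+ z≤n)))

  ½^ : ℕ → ℚ
  ½^ zero    = 1ℚ
  ½^ (suc n) = ½ * ½^ n

  0<½^ : ∀ n → 0ℚ < ½^ n
  0<½^ zero    = 0<1
  0<½^ (suc n) = 0<p*q 0<½ (0<½^ n)

  -- In the induction step the left side drops by n · 2⁻ⁿ / 2. The resulting bound 2⁻ⁿ ≤ 1/(n + 1)
  -- reduces the smallness of 2⁻ⁿ to the archimedean property.
  ½^-≤ : ∀ n → ι (+ suc n) * ½^ n ≤ 1ℚ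
  ½^-≤ zero    = ℚ.≤-refl
  ½^-≤ (suc n) = ℚ.≤-trans (0≤d⇒p≤q (0≤p*q (0≤p*q (ℚ.<⇒≤ 0<½) (0≤ι n)) (ℚ.<⇒≤ (0<½^ n)))
    (trans (solve 2 (λ m h → con ½ :* m :* h
                     := (con 1ℚ :+ m) :* h :- (con 1ℚ :+ (con 1ℚ :+ m)) :* (con ½ :* h))
             refl (ι (+ n)) (½^ n))
           (cong₂ _-_ (cong (_* ½^ n) (sym (ι-suc n)))
              (cong (_* ½^ (suc n)) (sym (trans (ι-suc (suc n)) (cong (λ q → 1ℚ + q) (ι-suc n))))))))
    (½^-≤ n)

  ½^-small : Small ½^
  ½^-small ε 0<ε with recip ε 0<ε
  ... | r , 0<r , εr≡1 with archimedean r
  ... | M , r≤M = M , λ n M≤n → subst (_< ε) (sym (ℚ.0≤p⇒∣p∣≡p (ℚ.<⇒≤ (0<½^ n)))) (lt n M≤n)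
    where
    open ℚ.≤-Reasoning
    r<n+1 : ∀ n → M ℕ.≤ n → r < ι (+ suc n)
    r<n+1 n M≤n = ℚ.≤-<-trans (ℚ.≤-trans r≤M (ι-mono-≤ (ℤ.+≤+ M≤n)))
      (0<d⇒p<q 0<1 (trans (solve 1 (λ m → con 1ℚ := (con 1ℚ :+ m) :- m) refl (ι (+ n)))
                          (cong (_- ι (+ n)) (sym (ι-suc n)))))
    lt : ∀ n → M ℕ.≤ n → ½^ n < ε
    lt n M≤n = begin-strict
      ½^ n                            ≡⟨ ℚ.*-identityˡ (½^ n) ⟨
      1ℚ * ½^ n                       ≡⟨ cong (_* ½^ n) εr≡1 ⟨
      ε * r * ½^ n                    ≡⟨ ℚ.*-assoc ε r (½^ n) ⟩
      ε * (r * ½^ n)                  <⟨ ℚ.*-monoʳ-<-pos ε {{ℚ.positive 0<ε}}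
                                           (ℚ.*-monoˡ-<-pos (½^ n) {{ℚ.positive (0<½^ n)}} (r<n+1 n M≤n)) ⟩
      ε * (ι (+ suc n) * ½^ n)        ≤⟨ ℚ.*-monoˡ-≤-nonNeg ε {{ℚ.nonNegative (ℚ.<⇒≤ 0<ε)}} (½^-≤ n) ⟩
      ε * 1ℚ                          ≡⟨ ℚ.*-identityʳ ε ⟩
      ε                               ∎

-- Polynomial algebra and the three-term recurrence over a commutative ring receiving ℚ

module Polynomials where

  open import Data.Maybe using (Maybe; just; nothing)
  open Rationals

  2^_ : ℕ → ℚ
  2^ zero  = 1ℚ
  2^ suc n = 2ℚ ℚ.* 2^ n

  -- Instantiated at ℚ, ℝ and ℂ. In the abstract ring there are no Cauchy proofs for the type
  -- checker to compare; `κ` provides the rational constants of the recurrence and the coefficients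
  -- of the solver.
  module ℚ-Algebra
    (R : CommutativeRing 0ℓ 0ℓ)
    (κ-morphism : ℚ.+-*-rawRing -Raw-AlmostCommutative⟶ fromCommutativeRing R)
    where

    open CommutativeRing R public hiding (zero)
    open _-Raw-AlmostCommutative⟶_ κ-morphism public
      renaming (⟦_⟧ to κ; +-homo to κ-+; *-homo to κ-*; -‿homo to κ-neg; 0-homo to κ-0; 1-homo to κ-1)

    κ-cong : ∀ {p q} → p ≡.≡ q → κ p ≈ κ q
    κ-cong ≡.refl = refl

    κ≟ : ∀ p q → Maybe (κ p ≈ κ q)
    κ≟ p q with p ℚ.≟ q
    ... | yes p≡q = just (κ-cong p≡q)
    ... | no  _   = nothing

    module Solver = Algebra.Solver.Ring ℚ.+-*-rawRing (fromCommutativeRing R) κ-morphism κ≟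
    open Solver using (solve; _:+_; _:*_; _:-_; :-_; _:=_)
    open Relation.Binary.Reasoning.Setoid setoid

    Poly : Set
    Poly = List Carrier

    coeff : Poly → ℕ → Carrier
    coeff []      _       = 0#
    coeff (a ∷ _) zero    = a
    coeff (_ ∷ p) (suc k) = coeff p k

    eval : Poly → Carrier → Carrier
    eval []      _ = 0#
    eval (a ∷ p) x = a + x * eval p x

    infixl 6 _+ₚ_
    infixl 7 _*ₚ_ _·ₚ_

    _+ₚ_ : Poly → Poly → Poly
    []      +ₚ q       = q
    (a ∷ p) +ₚ []      = a ∷ p
    (a ∷ p) +ₚ (b ∷ q) = (a + b) ∷ (p +ₚ q)

    _·ₚ_ : Carrier → Poly → Poly
    c ·ₚ p = map (c *_) p

    _*ₚ_ : Poly → Poly → Poly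
    []      *ₚ q = []
    (a ∷ p) *ₚ q = (a ·ₚ q) +ₚ (0# ∷ (p *ₚ q))

    1ₚ : Poly
    1ₚ = 1# ∷ []

    ∏ₚ : ∀ {n} → Vector Poly n → Poly
    ∏ₚ = foldr _*ₚ_ 1ₚ

    x-_ : Carrier → Poly
    x- z = (- z) ∷ 1# ∷ []

    ∏ : ∀ {n} → Vector Carrier n → Carrier
    ∏ = foldr _*_ 1#

    coeff-+ₚ : ∀ p q k → coeff (p +ₚ q) k ≈ coeff p k + coeff q k
    coeff-+ₚ []      q       k       = sym (+-identityˡ _)
    coeff-+ₚ (a ∷ p) []      k       = sym (+-identityʳ _)
    coeff-+ₚ (a ∷ p) (b ∷ q) zero    = refl
    coeff-+ₚ (a ∷ p) (b ∷ q) (suc k) = coeff-+ₚ p q k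

    coeff-·ₚ : ∀ c p k → coeff (c ·ₚ p) k ≈ c * coeff p k
    coeff-·ₚ c []      k       = sym (zeroʳ c)
    coeff-·ₚ c (a ∷ p) zero    = refl
    coeff-·ₚ c (a ∷ p) (suc k) = coeff-·ₚ c p k

    coeff-linear-suc : ∀ a b q k →
      coeff ((a ∷ b ∷ []) *ₚ q) (suc k) ≈ a * coeff q (suc k) + b * coeff q k
    coeff-linear-suc a b q k = begin
      coeff ((a ·ₚ q) +ₚ (0# ∷ ((b ·ₚ q) +ₚ (0# ∷ [])))) (suc k)
        ≈⟨ coeff-+ₚ (a ·ₚ q) _ (suc k) ⟩
      coeff (a ·ₚ q) (suc k) + coeff ((b ·ₚ q) +ₚ (0# ∷ [])) k
        ≈⟨ +-cong (coeff-·ₚ a q (suc k)) (coeff-+ₚ (b ·ₚ q) (0# ∷ []) k) ⟩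
      a * coeff q (suc k) + (coeff (b ·ₚ q) k + coeff (0# ∷ []) k)
        ≈⟨ +-congˡ (+-cong (coeff-·ₚ b q k) (coeff-0 k)) ⟩
      a * coeff q (suc k) + (b * coeff q k + 0#)
        ≈⟨ +-congˡ (+-identityʳ _) ⟩
      a * coeff q (suc k) + b * coeff q k ∎
      where
      coeff-0 : ∀ k → coeff (0# ∷ []) k ≈ 0#
      coeff-0 zero    = refl
      coeff-0 (suc k) = refl

    eval-+ₚ : ∀ p q x → eval (p +ₚ q) x ≈ eval p x + eval q x
    eval-+ₚ []      q       x = sym (+-identityˡ _)
    eval-+ₚ (a ∷ p) []      x = sym (+-identityʳ _)
    eval-+ₚ (a ∷ p) (b ∷ q) x = begin
      (a + b) + x * eval (p +ₚ q) x             ≈⟨ +-congˡ (*-congˡ (eval-+ₚ p q x)) ⟩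
      (a + b) + x * (eval p x + eval q x)
        ≈⟨ solve 5 (λ a b x p q → (a :+ b) :+ x :* (p :+ q) := (a :+ x :* p) :+ (b :+ x :* q))
             refl a b x (eval p x) (eval q x) ⟩
      (a + x * eval p x) + (b + x * eval q x)   ∎

    eval-·ₚ : ∀ c p x → eval (c ·ₚ p) x ≈ c * eval p x
    eval-·ₚ c []      x = sym (zeroʳ c)
    eval-·ₚ c (a ∷ p) x = begin
      c * a + x * eval (c ·ₚ p) x  ≈⟨ +-congˡ (*-congˡ (eval-·ₚ c p x)) ⟩
      c * a + x * (c * eval p x)
        ≈⟨ solve 4 (λ c a x p → c :* a :+ x :* (c :* p) := c :* (a :+ x :* p))
             refl c a x (eval p x) ⟩
      c * (a + x * eval p x)       ∎

    eval-*ₚ : ∀ p q x → eval (p *ₚ q) x ≈ eval p x * eval q x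
    eval-*ₚ []      q x = sym (zeroˡ _)
    eval-*ₚ (a ∷ p) q x = begin
      eval ((a ·ₚ q) +ₚ (0# ∷ (p *ₚ q))) x               ≈⟨ eval-+ₚ (a ·ₚ q) _ x ⟩
      eval (a ·ₚ q) x + (0# + x * eval (p *ₚ q) x)
        ≈⟨ +-cong (eval-·ₚ a q x) (+-congˡ (*-congˡ (eval-*ₚ p q x))) ⟩
      a * eval q x + (0# + x * (eval p x * eval q x))
        ≈⟨ +-congˡ (+-identityˡ _) ⟩
      a * eval q x + x * (eval p x * eval q x)
        ≈⟨ solve 4 (λ a x p q → a :* q :+ x :* (p :* q) := (a :+ x :* p) :* q)
             refl a x (eval p x) (eval q x) ⟩
      (a + x * eval p x) * eval q x                      ∎

    eval-linear : ∀ a b x → eval (a ∷ b ∷ []) x ≈ a + x * b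
    eval-linear a b x = +-congˡ (*-congˡ (trans (+-congˡ (zeroʳ x)) (+-identityʳ b)))

    eval-1ₚ : ∀ x → eval 1ₚ x ≈ 1#
    eval-1ₚ x = trans (+-congˡ (zeroʳ x)) (+-identityʳ 1#)

    eval-∏ₚ : ∀ {n} (z : Vector Carrier n) x → eval (∏ₚ (λ i → x- z i)) x ≈ ∏ (λ i → x - z i)
    eval-∏ₚ {zero}  z x = eval-1ₚ x
    eval-∏ₚ {suc n} z x = begin
      eval ((x- z zero) *ₚ ∏ₚ (λ i → x- z (suc i))) x
        ≈⟨ eval-*ₚ (x- z zero) (∏ₚ (λ i → x- z (suc i))) x ⟩
      eval (x- z zero) x * eval (∏ₚ (λ i → x- z (suc i))) x
        ≈⟨ *-cong (trans (eval-linear (- z zero) 1# x)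
                    (trans (+-congˡ (*-identityʳ x)) (+-comm (- z zero) x)))
                  (eval-∏ₚ (z ∘ suc) x) ⟩
      (x - z zero) * ∏ (λ i → x - z (suc i)) ∎

    DegreeBelow : Poly → ℕ → Set
    DegreeBelow p n = ∀ k → n ℕ.≤ k → coeff p k ≈ 0#

    -- Division by a nonzero element is replaced by cancellation. Positive rationals, positive reals
    -- and complex numbers of positive norm are shown to be cancellable, and products inherit the
    -- property.
    record Regular (a : Carrier) : Set where
      constructor regular
      field cancel : ∀ y → a * y ≈ 0# → y ≈ 0#

    open Regular

    *-regular : ∀ {a b} → Regular a → Regular b → Regular (a * b)
    *-regular {a} {b} a-reg b-reg = regular λ y eq →
      cancel b-reg y (cancel a-reg (b * y) (trans (sym (*-assoc a b y)) eq))

    1-regular : Regular 1#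
    1-regular = regular λ y eq → trans (sym (*-identityˡ y)) eq

    ∏-regular : ∀ {n} (f : Vector Carrier n) → (∀ i → Regular (f i)) → Regular (∏ f)
    ∏-regular {zero}  f reg = 1-regular
    ∏-regular {suc n} f reg = *-regular (reg zero) (∏-regular (f ∘ suc) (reg ∘ suc))

    κ-regular : ∀ {q} → 0ℚ ℚ.< q → Regular (κ q)
    κ-regular {q} 0<q = let r , _ , qr≡1 = recip q 0<q in regular λ y eq → begin
      y                 ≈⟨ *-identityˡ y ⟨
      1# * y            ≈⟨ *-congʳ (trans (sym κ-1) (trans (κ-cong (≡.trans (≡.sym qr≡1) (ℚ.*-comm q r))) (κ-* r q))) ⟩
      κ r * κ q * y     ≈⟨ *-assoc (κ r) (κ q) y ⟩
      κ r * (κ q * y)   ≈⟨ *-congˡ eq ⟩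
      κ r * 0#          ≈⟨ zeroʳ (κ r) ⟩
      0#                ∎

    regular-0⇒1≈0 : ∀ {a} → Regular a → a ≈ 0# → 1# ≈ 0#
    regular-0⇒1≈0 {a} a-reg a≈0 = cancel a-reg 1# (trans (*-congʳ a≈0) (zeroˡ 1#))

    0*x+y*0 : ∀ {a b c d} → b ≈ 0# → d ≈ 0# → a * b + c * d ≈ 0#
    0*x+y*0 {a} {b} {c} {d} b≈0 d≈0 = begin
      a * b + c * d    ≈⟨ +-cong (*-congˡ b≈0) (*-congˡ d≈0) ⟩
      a * 0# + c * 0#  ≈⟨ +-cong (zeroʳ a) (zeroʳ c) ⟩
      0# + 0#          ≈⟨ +-identityˡ 0# ⟩
      0#               ∎

    -- (a² + b²) (c + id) is the conjugate of a + ib times (a + ib)(c + id).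
    conjugate-cancel : ∀ a b c d → a * c - b * d ≈ 0# → a * d + b * c ≈ 0# →
      (a * a + b * b) * c ≈ 0# × (a * a + b * b) * d ≈ 0#
    conjugate-cancel a b c d re≈0 im≈0 =
        (begin
          (a * a + b * b) * c
            ≈⟨ solve 4 (λ a b c d → (a :* a :+ b :* b) :* c
                          := a :* (a :* c :- b :* d) :+ b :* (a :* d :+ b :* c)) refl a b c d ⟩
          a * (a * c - b * d) + b * (a * d + b * c)  ≈⟨ 0*x+y*0 re≈0 im≈0 ⟩
          0# ∎)
      , (begin
          (a * a + b * b) * d
            ≈⟨ solve 4 (λ a b c d → (a :* a :+ b :* b) :* d
                          := a :* (a :* d :+ b :* c) :+ (:- b) :* (a :* c :- b :* d)) refl a b c d ⟩
          a * (a * d + b * c) + (- b) * (a * c - b * d)  ≈⟨ 0*x+y*0 im≈0 re≈0 ⟩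
          0# ∎)

    -- Horner's scheme: the values at a of the successive tails of p are the coefficients of the
    -- quotient by x - a. The list keeps the length of p and ends in a zero, so its degree is
    -- tracked by `DegreeBelow` and not by its length.
    quotient : Poly → Carrier → Poly
    quotient []      a = []
    quotient (c ∷ p) a = eval p a ∷ quotient p a

    eval-quotient : ∀ p a x → eval p x ≈ (x - a) * eval (quotient p a) x + eval p a
    eval-quotient []      a x = sym (trans (+-identityʳ _) (zeroʳ _))
    eval-quotient (c ∷ p) a x = begin
      c + x * eval p x
        ≈⟨ +-congˡ (*-congˡ (eval-quotient p a x)) ⟩
      c + x * ((x - a) * eval (quotient p a) x + eval p a)
        ≈⟨ solve 5 (λ c x a q r → c :+ x :* ((x :- a) :* q :+ r)
                     := (x :- a) :* (r :+ x :* q) :+ (c :+ a :* r))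
             refl c x a (eval (quotient p a) x) (eval p a) ⟩
      (x - a) * (eval p a + x * eval (quotient p a) x) + (c + a * eval p a) ∎

    eval-0 : ∀ p → DegreeBelow p 0 → ∀ x → eval p x ≈ 0#
    eval-0 []      p≈0 x = refl
    eval-0 (a ∷ p) p≈0 x = begin
      a + x * eval p x  ≈⟨ +-cong (p≈0 0 z≤n) (*-congˡ (eval-0 p (λ k _ → p≈0 (suc k) z≤n) x)) ⟩
      0# + x * 0#       ≈⟨ trans (+-identityˡ _) (zeroʳ x) ⟩
      0#                ∎

    quotient-degree : ∀ n p a → DegreeBelow p (suc n) → DegreeBelow (quotient p a) n
    quotient-degree n       []      a deg k       _         = refl
    quotient-degree zero    (c ∷ p) a deg zero    _         = eval-0 p (λ k _ → deg (suc k) (s≤s z≤n)) a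
    quotient-degree zero    (c ∷ p) a deg (suc k) _         =
      quotient-degree zero p a (λ k _ → deg (suc k) (s≤s z≤n)) k z≤n
    quotient-degree (suc n) (c ∷ p) a deg (suc k) (s≤s n≤k) =
      quotient-degree n p a (λ j n≤j → deg (suc j) (s≤s n≤j)) k n≤k

    0-a*0≈0 : ∀ a → 0# - a * 0# ≈ 0#
    0-a*0≈0 a = trans (+-congˡ (-‿cong (zeroʳ a))) (-‿inverseʳ 0#)

    coeff-quotient : ∀ p a k →
      coeff p (suc k) ≈ coeff (quotient p a) k - a * coeff (quotient p a) (suc k)
    coeff-quotient []          a k    = sym (0-a*0≈0 a)
    coeff-quotient (c ∷ [])    a zero    = sym (0-a*0≈0 a)
    coeff-quotient (c ∷ [])    a (suc k) = sym (0-a*0≈0 a)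
    coeff-quotient (c ∷ d ∷ p) a zero =
      solve 2 (λ d y → d := (d :+ y) :- y) refl d (a * eval p a)
    coeff-quotient (c ∷ d ∷ p) a (suc k) = coeff-quotient (d ∷ p) a k

    quotient≈0⇒coeff≈0 : ∀ p a → eval p a ≈ 0# → DegreeBelow (quotient p a) 0 → DegreeBelow p 0
    quotient≈0⇒coeff≈0 []      a root q≈0 k       _ = refl
    quotient≈0⇒coeff≈0 (c ∷ p) a root q≈0 zero    _ = begin
      c                 ≈⟨ solve 2 (λ c y → c := (c :+ y) :- y) refl c (a * eval p a) ⟩
      (c + a * eval p a) - a * eval p a
                        ≈⟨ +-cong root (-‿cong (*-congˡ (q≈0 0 z≤n))) ⟩
      0# - a * 0#       ≈⟨ 0-a*0≈0 a ⟩
      0#                ∎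
    quotient≈0⇒coeff≈0 (c ∷ p) a root q≈0 (suc k) _ = begin
      coeff (c ∷ p) (suc k)
        ≈⟨ coeff-quotient (c ∷ p) a k ⟩
      coeff (quotient (c ∷ p) a) k - a * coeff (quotient (c ∷ p) a) (suc k)
        ≈⟨ +-cong (q≈0 k z≤n) (-‿cong (*-congˡ (q≈0 (suc k) z≤n))) ⟩
      0# - a * 0#
        ≈⟨ 0-a*0≈0 a ⟩
      0# ∎

    -- Dividing by x - z₀ lowers the degree bound by one, and because zᵢ - z₀ can be cancelled, the
    -- remaining zᵢ are roots of the quotient.
    roots⇒coeff≈0 : ∀ n p (z : Vector Carrier n) → DegreeBelow p n →
      (∀ i j → i Fin.< j → Regular (z j - z i)) →
      (∀ i → eval p (z i) ≈ 0#) → DegreeBelow p 0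
    roots⇒coeff≈0 zero    p z deg z-reg root = deg
    roots⇒coeff≈0 (suc n) p z deg z-reg root =
      quotient≈0⇒coeff≈0 p a (root zero)
        (roots⇒coeff≈0 n q (z ∘ suc) (quotient-degree n p a deg)
          (λ i j i<j → z-reg (suc i) (suc j) (s≤s i<j))
          (λ i → cancel (z-reg zero (suc i) (s≤s z≤n)) (eval q (z (suc i))) (vanish (suc i))))
      where
      a = z zero
      q = quotient p a
      vanish : ∀ i → (z i - a) * eval q (z i) ≈ 0#
      vanish i = begin
        (z i - a) * eval q (z i)             ≈⟨ +-identityʳ _ ⟨
        (z i - a) * eval q (z i) + 0#        ≈⟨ +-congˡ (root zero) ⟨
        (z i - a) * eval q (z i) + eval p a  ≈⟨ eval-quotient p a (z i) ⟨
        eval p (z i)                         ≈⟨ root i ⟩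
        0#                                   ∎

    infix 4 _≈ₚ_

    _≈ₚ_ : Poly → Poly → Set
    p ≈ₚ q = ∀ k → coeff p k ≈ coeff q k

    infixl 6 _-ₚ_

    _-ₚ_ : Poly → Poly → Poly
    p -ₚ q = p +ₚ (- 1#) ·ₚ q

    -1*x : ∀ x → (- 1#) * x ≈ - x
    -1*x x = begin
      (- 1#) * x          ≈⟨ solve 2 (λ u x → (:- u) :* x := :- (u :* x)) refl 1# x ⟩
      - (1# * x)          ≈⟨ -‿cong (*-identityˡ x) ⟩
      - x                 ∎

    coeff--ₚ : ∀ p q k → coeff (p -ₚ q) k ≈ coeff p k - coeff q k
    coeff--ₚ p q k = trans (coeff-+ₚ p _ k)
      (+-congˡ (trans (coeff-·ₚ (- 1#) q k) (-1*x _)))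

    eval--ₚ : ∀ p q x → eval (p -ₚ q) x ≈ eval p x - eval q x
    eval--ₚ p q x = trans (eval-+ₚ p _ x)
      (+-congˡ (trans (eval-·ₚ (- 1#) q x) (-1*x _)))

    x≈y⇒x-y≈0 : ∀ {x y} → x ≈ y → x - y ≈ 0#
    x≈y⇒x-y≈0 x≈y = trans (+-congʳ x≈y) (-‿inverseʳ _)

    x-y≈0⇒x≈y : ∀ {x y} → x - y ≈ 0# → x ≈ y
    x-y≈0⇒x≈y {x} {y} eq = begin
      x            ≈⟨ solve 2 (λ x y → x := (x :- y) :+ y) refl x y ⟩
      (x - y) + y  ≈⟨ +-congʳ eq ⟩
      0# + y       ≈⟨ +-identityˡ y ⟩
      y            ∎

    interpolation-unique : ∀ n p q (z : Vector Carrier n) → DegreeBelow p n → DegreeBelow q n →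
      (∀ i j → i Fin.< j → Regular (z j - z i)) →
      (∀ i → eval p (z i) ≈ eval q (z i)) → p ≈ₚ q
    interpolation-unique n p q z deg-p deg-q z-reg agree k = x-y≈0⇒x≈y (begin
      coeff p k - coeff q k  ≈⟨ coeff--ₚ p q k ⟨
      coeff (p -ₚ q) k
        ≈⟨ roots⇒coeff≈0 n (p -ₚ q) z
             (λ j n≤j → trans (coeff--ₚ p q j)
                (x≈y⇒x-y≈0 (trans (deg-p j n≤j) (sym (deg-q j n≤j)))))
             z-reg
             (λ i → trans (eval--ₚ p q (z i)) (x≈y⇒x-y≈0 (agree i)))
             k z≤n ⟩
      0# ∎)

    length-degree : ∀ p n → length p ℕ.≤ n → DegreeBelow p n
    length-degree []      n       _         k       _         = refl
    length-degree (a ∷ p) (suc n) (s≤s l≤n) (suc k) (s≤s n≤k) = length-degree p n l≤n k n≤k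

    linear-*ₚ-degree : ∀ a b q n → DegreeBelow q n → DegreeBelow ((a ∷ b ∷ []) *ₚ q) (suc n)
    linear-*ₚ-degree a b q n deg (suc k) (s≤s n≤k) = trans (coeff-linear-suc a b q k)
      (0*x+y*0 (deg (suc k) (ℕ.m≤n⇒m≤1+n n≤k)) (deg k n≤k))

    linear-*ₚ-leading : ∀ a b q n → DegreeBelow q (suc n) →
      coeff ((a ∷ b ∷ []) *ₚ q) (suc n) ≈ b * coeff q n
    linear-*ₚ-leading a b q n deg = begin
      coeff ((a ∷ b ∷ []) *ₚ q) (suc n)    ≈⟨ coeff-linear-suc a b q n ⟩
      a * coeff q (suc n) + b * coeff q n  ≈⟨ +-congʳ (trans (*-congˡ (deg (suc n) ℕ.≤-refl)) (zeroʳ a)) ⟩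
      0# + b * coeff q n                   ≈⟨ +-identityˡ _ ⟩
      b * coeff q n                        ∎

    ∏ₚ-degree : ∀ {n} (z : Vector Carrier n) → DegreeBelow (∏ₚ (λ i → x- z i)) (suc n)
    ∏ₚ-degree {zero}  z (suc k) _ = refl
    ∏ₚ-degree {suc n} z = linear-*ₚ-degree _ _ (∏ₚ (λ i → x- z (suc i))) (suc n) (∏ₚ-degree (z ∘ suc))

    ∏ₚ-monic : ∀ {n} (z : Vector Carrier n) → coeff (∏ₚ (λ i → x- z i)) n ≈ 1#
    ∏ₚ-monic {zero}  z = refl
    ∏ₚ-monic {suc n} z = begin
      coeff (∏ₚ (λ i → x- z i)) (suc n)
        ≈⟨ linear-*ₚ-leading _ _ (∏ₚ (λ i → x- z (suc i))) n (∏ₚ-degree (z ∘ suc)) ⟩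
      1# * coeff (∏ₚ (λ i → x- z (suc i))) n  ≈⟨ *-identityˡ _ ⟩
      coeff (∏ₚ (λ i → x- z (suc i))) n       ≈⟨ ∏ₚ-monic (z ∘ suc) ⟩
      1#                                      ∎

    *-zero-congʳ : ∀ {x y} → y ≈ 0# → x * y ≈ 0#
    *-zero-congʳ {x} y≈0 = trans (*-congˡ y≈0) (zeroʳ x)

    *-zero-congˡ : ∀ {x y} → x ≈ 0# → x * y ≈ 0#
    *-zero-congˡ {x} {y} x≈0 = trans (*-congʳ x≈0) (zeroˡ y)

    ∏-zero : ∀ {n} (f : Vector Carrier n) i → f i ≈ 0# → ∏ f ≈ 0#
    ∏-zero f zero    fi≈0 = *-zero-congˡ fi≈0
    ∏-zero f (suc i) fi≈0 = *-zero-congʳ (∏-zero (f ∘ suc) i fi≈0)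

    -- The product is monic, so p minus the right-hand side has no term of degree n: its degree is
    -- below n, and it vanishes at n separated points.
    factorisation : ∀ n p (z : Vector Carrier n) → DegreeBelow p (suc n) →
      (∀ i j → i Fin.< j → Regular (z j - z i)) → (∀ i → eval p (z i) ≈ 0#) →
      p ≈ₚ coeff p n ·ₚ ∏ₚ (λ i → x- z i)
    factorisation n p z deg z-reg root k = x-y≈0⇒x≈y (trans (sym (coeff--ₚ p q k))
      (roots⇒coeff≈0 n (p -ₚ q) z deg′ z-reg root′ k z≤n))
      where
      π = ∏ₚ (λ i → x- z i)
      q = coeff p n ·ₚ π
      deg′ : DegreeBelow (p -ₚ q) n
      deg′ k n≤k with ℕ.m≤n⇒m<n∨m≡n n≤k
      ... | inj₁ n<k = trans (coeff--ₚ p q k) (x≈y⇒x-y≈0 (trans (deg k n<k)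
             (sym (trans (coeff-·ₚ (coeff p n) π k) (*-zero-congʳ (∏ₚ-degree z k n<k))))))
      ... | inj₂ ≡.refl = trans (coeff--ₚ p q k) (x≈y⇒x-y≈0
             (sym (trans (coeff-·ₚ (coeff p n) π k) (trans (*-congˡ (∏ₚ-monic z)) (*-identityʳ _)))))
      root′ : ∀ i → eval (p -ₚ q) (z i) ≈ 0#
      root′ i = trans (eval--ₚ p q (z i)) (x≈y⇒x-y≈0 (trans (root i) (sym (begin
        eval q (z i)                      ≈⟨ eval-·ₚ (coeff p n) π (z i) ⟩
        coeff p n * eval π (z i)          ≈⟨ *-congˡ (eval-∏ₚ z (z i)) ⟩
        coeff p n * ∏ (λ j → z i - z j)   ≈⟨ *-zero-congʳ (∏-zero (λ j → z i - z j) i (-‿inverseʳ (z i))) ⟩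
        0#                                ∎))))

    eval-cong : ∀ p {x y} → x ≈ y → eval p x ≈ eval p y
    eval-cong []      x≈y = refl
    eval-cong (a ∷ p) x≈y = +-congˡ (*-cong x≈y (eval-cong p x≈y))

    eval-congₚ : ∀ p q → p ≈ₚ q → ∀ x → eval p x ≈ eval q x
    eval-congₚ p q p≈q x = x-y≈0⇒x≈y (trans (sym (eval--ₚ p q x))
      (eval-0 (p -ₚ q) (λ k _ → trans (coeff--ₚ p q k) (x≈y⇒x-y≈0 (p≈q k))) x))

    -- With `b` = 1 and `v n` = (n + 1)² this is h_n of the overview; with `b` = 0 and `v n` = -(n +
    -- 1)² it is p_n. `value` exists beside `eval (poly n)` because a plain recursion commutes at
    -- once with homomorphisms and with taking terms of Cauchy sequences.
    module Recurrence (b : ℚ) (v : ℕ → ℚ) where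

      value : ℕ → Carrier → Carrier
      value zero          x = 1#
      value (suc zero)    x = κ 2ℚ * x + κ b
      value (suc (suc n)) x = (κ 2ℚ * x + κ b) * value (suc n) x + κ (v n) * value n x

      poly : ℕ → Poly
      poly zero          = 1ₚ
      poly (suc zero)    = κ b ∷ κ 2ℚ ∷ []
      poly (suc (suc n)) = (κ b ∷ κ 2ℚ ∷ []) *ₚ poly (suc n) +ₚ κ (v n) ·ₚ poly n

      value-cong : ∀ n {x y} → x ≈ y → value n x ≈ value n y
      value-cong zero          x≈y = refl
      value-cong (suc zero)    x≈y = +-congʳ (*-congˡ x≈y)
      value-cong (suc (suc n)) x≈y = +-cong
        (*-cong (+-congʳ (*-congˡ x≈y)) (value-cong (suc n) x≈y)) (*-congˡ (value-cong n x≈y))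

      eval-poly : ∀ n x → eval (poly n) x ≈ value n x
      eval-poly zero       x = eval-1ₚ x
      eval-poly (suc zero) x = trans (eval-linear (κ b) (κ 2ℚ) x)
        (trans (+-comm _ _) (+-congʳ (*-comm x (κ 2ℚ))))
      eval-poly (suc (suc n)) x = trans (eval-+ₚ ((κ b ∷ κ 2ℚ ∷ []) *ₚ poly (suc n)) (κ (v n) ·ₚ poly n) x)
        (+-cong (trans (eval-*ₚ (κ b ∷ κ 2ℚ ∷ []) (poly (suc n)) x)
                   (*-cong (eval-poly 1 x) (eval-poly (suc n) x)))
                (trans (eval-·ₚ (κ (v n)) (poly n) x) (*-congˡ (eval-poly n x))))

      poly-degree : ∀ n → DegreeBelow (poly n) (suc n)
      poly-degree zero       (suc k)       _ = refl
      poly-degree (suc zero) (suc zero)    (s≤s ())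
      poly-degree (suc zero) (suc (suc k)) _ = refl
      poly-degree (suc (suc n)) k n<k = begin
        coeff (poly (suc (suc n))) k
          ≈⟨ coeff-+ₚ ((κ b ∷ κ 2ℚ ∷ []) *ₚ poly (suc n)) (κ (v n) ·ₚ poly n) k ⟩
        coeff ((κ b ∷ κ 2ℚ ∷ []) *ₚ poly (suc n)) k + coeff (κ (v n) ·ₚ poly n) k
          ≈⟨ +-cong (linear-*ₚ-degree (κ b) (κ 2ℚ) (poly (suc n)) (suc (suc n)) (poly-degree (suc n)) k n<k)
                    (trans (coeff-·ₚ (κ (v n)) (poly n) k)
                      (*-zero-congʳ (poly-degree n k (ℕ.≤-trans (ℕ.n≤1+n _) (ℕ.≤-trans (ℕ.n≤1+n _) n<k))))) ⟩
        0# + 0#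
          ≈⟨ +-identityˡ 0# ⟩
        0# ∎

      poly-leading : ∀ n → coeff (poly n) n ≈ κ (2^ n)
      poly-leading zero       = sym κ-1
      poly-leading (suc zero) = κ-cong (≡.sym (ℚ.*-identityʳ 2ℚ))
      poly-leading (suc (suc n)) = begin
        coeff (poly (suc (suc n))) (suc (suc n))
          ≈⟨ coeff-+ₚ ((κ b ∷ κ 2ℚ ∷ []) *ₚ poly (suc n)) (κ (v n) ·ₚ poly n) (suc (suc n)) ⟩
        coeff ((κ b ∷ κ 2ℚ ∷ []) *ₚ poly (suc n)) (suc (suc n)) + coeff (κ (v n) ·ₚ poly n) (suc (suc n))
          ≈⟨ +-cong (linear-*ₚ-leading (κ b) (κ 2ℚ) (poly (suc n)) (suc n) (poly-degree (suc n)))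
                    (trans (coeff-·ₚ (κ (v n)) (poly n) (suc (suc n)))
                      (*-zero-congʳ (poly-degree n (suc (suc n)) (ℕ.n≤1+n _)))) ⟩
        κ 2ℚ * coeff (poly (suc n)) (suc n) + 0#
          ≈⟨ +-identityʳ _ ⟩
        κ 2ℚ * coeff (poly (suc n)) (suc n)
          ≈⟨ *-congˡ (poly-leading (suc n)) ⟩
        κ 2ℚ * κ (2^ suc n)
          ≈⟨ κ-* 2ℚ (2^ suc n) ⟨
        κ (2^ suc (suc n)) ∎

      poly-factorisation : ∀ n (z : Vector Carrier n) →
        (∀ i j → i Fin.< j → Regular (z j - z i)) → (∀ i → value n (z i) ≈ 0#) →
        poly n ≈ₚ coeff (poly n) n ·ₚ ∏ₚ (λ i → x- z i)
      poly-factorisation n z z-reg root = factorisation n (poly n) z (poly-degree n) z-reg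
        (λ i → trans (eval-poly n (z i)) (root i))

      value-factorisation : ∀ n (z : Vector Carrier n) →
        (∀ i j → i Fin.< j → Regular (z j - z i)) → (∀ i → value n (z i) ≈ 0#) →
        ∀ x → value n x ≈ κ (2^ n) * ∏ (λ i → x - z i)
      value-factorisation n z z-reg root x = begin
        value n x        ≈⟨ eval-poly n x ⟨
        eval (poly n) x
          ≈⟨ eval-congₚ (poly n) (coeff (poly n) n ·ₚ ∏ₚ (λ i → x- z i)) (poly-factorisation n z z-reg root) x ⟩
        eval (coeff (poly n) n ·ₚ ∏ₚ (λ i → x- z i)) x
          ≈⟨ eval-·ₚ (coeff (poly n) n) (∏ₚ (λ i → x- z i)) x ⟩
        coeff (poly n) n * eval (∏ₚ (λ i → x- z i)) x
          ≈⟨ *-cong (poly-leading n) (eval-∏ₚ z x) ⟩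
        κ (2^ n) * ∏ (λ i → x - z i) ∎

      -- At x every factor of the factorised value is cancellable, so the product can vanish only if
      -- 1 does. In an arbitrary ring that is as close to a contradiction as one gets.
      root-not-separated : ∀ n (z : Vector Carrier n) →
        (∀ i j → i Fin.< j → Regular (z j - z i)) → (∀ i → value n (z i) ≈ 0#) →
        Regular (κ (2^ n)) → ∀ x → (∀ i → Regular (x - z i)) → value n x ≈ 0# → 1# ≈ 0#
      root-not-separated n z z-reg root 2^n-reg x x-reg x-root = regular-0⇒1≈0
        (*-regular 2^n-reg (∏-regular (λ i → x - z i) x-reg))
        (trans (sym (value-factorisation n z z-reg root x)) x-root)

    infixr 8 _^_

    _^_ : Carrier → ℕ → Carrier
    x ^ zero  = 1#
    x ^ suc n = x * x ^ n

    -- Multiplying the variable by a square root of −1 flips the sign of the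
    -- coefficients v.
    rotation : ∀ w i x t → i * i ≈ - 1# → κ 2ℚ * x + κ 1ℚ ≈ i * (κ 2ℚ * t + κ 0ℚ) → ∀ n →
      Recurrence.value 1ℚ w n x ≈ i ^ n * Recurrence.value 0ℚ (λ k → ℚ.- w k) n t
    rotation w i x t i²≈-1 eq zero          = sym (*-identityˡ 1#)
    rotation w i x t i²≈-1 eq (suc zero)    = trans eq (*-congʳ (sym (*-identityʳ i)))
    rotation w i x t i²≈-1 eq (suc (suc n)) = begin
      (κ 2ℚ * x + κ 1ℚ) * Recurrence.value 1ℚ w (suc n) x + κ (w n) * Recurrence.value 1ℚ w n x
        ≈⟨ +-cong (*-cong eq (rotation w i x t i²≈-1 eq (suc n))) (*-congˡ (rotation w i x t i²≈-1 eq n)) ⟩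
      (i * l) * ((i * p) * b) + κ (w n) * (p * a)
        -- The term with w carries only i to the power n. Rewriting 1 · y as (-1)(-y) and -1 as i²
        -- supplies the two missing factors and turns w into -w.
        ≈⟨ +-congˡ (begin
             κ (w n) * (p * a)               ≈⟨ *-identityˡ _ ⟨
             1# * (κ (w n) * (p * a))
               ≈⟨ solve 2 (λ o y → o :* y := (:- o) :* (:- y)) refl 1# (κ (w n) * (p * a)) ⟩
             (- 1#) * (- (κ (w n) * (p * a)))  ≈⟨ *-congʳ (sym i²≈-1) ⟩
             (i * i) * (- (κ (w n) * (p * a)))
               ≈⟨ solve 4 (λ i w p a → (i :* i) :* (:- (w :* (p :* a))) := (i :* i) :* (p :* ((:- w) :* a)))
                    refl i (κ (w n)) p a ⟩
             (i * i) * (p * ((- κ (w n)) * a))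
               ≈⟨ *-congˡ (*-congˡ (*-congʳ (sym (κ-neg (w n))))) ⟩
             (i * i) * (p * (κ (ℚ.- w n) * a)) ∎) ⟩
      (i * l) * ((i * p) * b) + (i * i) * (p * (κ (ℚ.- w n) * a))
        ≈⟨ solve 6 (λ i l p b w a → (i :* l) :* ((i :* p) :* b) :+ (i :* i) :* (p :* (w :* a))
                      := (i :* (i :* p)) :* (l :* b :+ w :* a)) refl i l p b (κ (ℚ.- w n)) a ⟩
      (i * (i * p)) * (l * b + κ (ℚ.- w n) * a) ∎
      where
      l = κ 2ℚ * t + κ 0ℚ
      p = i ^ n
      a = Recurrence.value 0ℚ (λ k → ℚ.- w k) n t
      b = Recurrence.value 0ℚ (λ k → ℚ.- w k) (suc n) t

  module Transfer
    (R : CommutativeRing 0ℓ 0ℓ)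
    (κ-morphism-R : ℚ.+-*-rawRing -Raw-AlmostCommutative⟶ fromCommutativeRing R)
    (S : CommutativeRing 0ℓ 0ℓ)
    (κ-morphism-S : ℚ.+-*-rawRing -Raw-AlmostCommutative⟶ fromCommutativeRing S)
    where

    private
      module R = ℚ-Algebra R κ-morphism-R
      module S = ℚ-Algebra S κ-morphism-S

    record Homomorphism : Set where
      field
        φ      : R.Carrier → S.Carrier
        φ-cong : ∀ x y → x R.≈ y → φ x S.≈ φ y
        φ-+    : ∀ x y → φ (x R.+ y) S.≈ φ x S.+ φ y
        φ-*    : ∀ x y → φ (x R.* y) S.≈ φ x S.* φ y
        φ-κ    : ∀ q → φ (R.κ q) S.≈ S.κ q

      φ-0 : φ R.0# S.≈ S.0#
      φ-0 = S.trans (φ-cong _ _ (R.sym R.κ-0)) (S.trans (φ-κ 0ℚ) S.κ-0)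

      φ-1 : φ R.1# S.≈ S.1#
      φ-1 = S.trans (φ-cong _ _ (R.sym R.κ-1)) (S.trans (φ-κ 1ℚ) S.κ-1)

      φ-value : ∀ b v n x → φ (R.Recurrence.value b v n x) S.≈ S.Recurrence.value b v n (φ x)
      φ-value b v zero          x = φ-1
      φ-value b v (suc zero)    x =
        S.trans (φ-+ _ _) (S.+-cong (S.trans (φ-* _ _) (S.*-congʳ (φ-κ 2ℚ))) (φ-κ b))
      φ-value b v (suc (suc n)) x = S.trans (φ-+ _ _) (S.+-cong
        (S.trans (φ-* _ _) (S.*-cong (φ-value b v 1 x) (φ-value b v (suc n) x)))
        (S.trans (φ-* _ _) (S.*-cong (φ-κ (v n)) (φ-value b v n x))))

      -- The equation between x and t says 2x + 1 = 2it, that is, x = -1/2 + it with the denominator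
      -- cleared.
      rotation-root : ∀ i → i S.* i S.≈ S.- S.1# → ∀ x t →
        S.κ 2ℚ S.* x S.+ S.κ 1ℚ S.≈ i S.* (S.κ 2ℚ S.* φ t S.+ S.κ 0ℚ) → ∀ w n →
        R.Recurrence.value 0ℚ (λ k → ℚ.- w k) n t R.≈ R.0# → S.Recurrence.value 1ℚ w n x S.≈ S.0#
      rotation-root i i²≈-1 x t eq w n root = S.trans (S.rotation w i x (φ t) i²≈-1 eq n)
        (S.*-zero-congʳ (S.trans (S.sym (φ-value 0ℚ (λ k → ℚ.- w k) n t)) (S.trans (φ-cong _ _ root) φ-0)))

  ℚ-morphism : ℚ.+-*-rawRing -Raw-AlmostCommutative⟶ fromCommutativeRing ℚ.+-*-commutativeRing
  ℚ-morphism = record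
    { ⟦_⟧    = λ q → q
    ; +-homo = λ _ _ → ≡.refl
    ; *-homo = λ _ _ → ≡.refl
    ; -‿homo = λ _ → ≡.refl
    ; 0-homo = ≡.refl
    ; 1-homo = ≡.refl
    }

  module ℚ-alg = ℚ-Algebra ℚ.+-*-commutativeRing ℚ-morphism

-- Interlacing real roots of the recurrence

module RealRoots where

  open import Data.Rational.Solver using (module +-*-Solver)
  open import Relation.Binary.Definitions using (tri<; tri≈; tri>)
  open Polynomials
  open Rationals

  0<2^ : ∀ n → 0ℚ ℚ.< 2^ n
  0<2^ zero    = 0<1
  0<2^ (suc n) = 0<p*q 0<2 (0<2^ n)

  module Growth (w : ℕ → ℚ) (0<w : ∀ n → 0ℚ ℚ.< w n) where

    open ℚ-alg.Recurrence 0ℚ (λ n → ℚ.- w n)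
    open import Data.Rational using (_+_; _*_; _-_; -_; _≤_; _<_; _⊔_)
    open +-*-Solver

    Large : ℕ → ℚ → Set
    Large n x = 0ℚ < value n x × value n x ≤ value (suc n) x

    -- Positivity alone does not survive the subtraction of w p_n. Together with p_n ≤ p_{n+1} it
    -- does, because p_{n+2} - p_{n+1} = (2x - w - 1) p_{n+1} + w (p_{n+1} - p_n).
    eventually-large : ∀ n → ∃ λ x₀ → ∀ x → x₀ ≤ x → Large n x
    eventually-large zero = 1ℚ , λ x 1≤x → 0<1 , 0≤d⇒p≤q
      (0≤p+q (0≤p+q (p≤q⇒0≤q-p 1≤x) (p≤q⇒0≤q-p 1≤x)) (ℚ.<⇒≤ 0<1))
      (solve 1 (λ x → ((x :- con 1ℚ) :+ (x :- con 1ℚ)) :+ con 1ℚ := (con 2ℚ :* x :+ con 0ℚ) :- con 1ℚ) ≡.refl x)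
    eventually-large (suc n) = let x₀ , large = eventually-large n in
      x₀ ⊔ (w n + 1ℚ) , λ x x₁≤x →
        let 0<a , a≤b = large x (ℚ.≤-trans (ℚ.p≤p⊔q x₀ (w n + 1ℚ)) x₁≤x)
            w+1≤x = ℚ.≤-trans (ℚ.p≤q⊔p x₀ (w n + 1ℚ)) x₁≤x
            a = value n x
            b = value (suc n) x
            0<b = ℚ.<-≤-trans 0<a a≤b
            0≤x-w-1 = p≤q⇒0≤q-p w+1≤x
            0≤2x-w-1 = 0≤p+q (0≤p+q (0≤p+q 0≤x-w-1 0≤x-w-1) (ℚ.<⇒≤ (0<w n))) (ℚ.<⇒≤ 0<1)
        in 0<b , 0≤d⇒p≤q
          (0≤p+q (0≤p*q 0≤2x-w-1 (ℚ.<⇒≤ 0<b)) (0≤p*q (ℚ.<⇒≤ (0<w n)) (p≤q⇒0≤q-p a≤b)))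
          (solve 4 (λ x w a b →
             ((((x :- (w :+ con 1ℚ)) :+ (x :- (w :+ con 1ℚ))) :+ w) :+ con 1ℚ) :* b :+ w :* (b :- a)
             := ((con 2ℚ :* x :+ con 0ℚ) :* b :+ (:- w) :* a) :- b) ≡.refl x (w n) a b)

    sign : ℕ → ℚ
    sign zero    = 1ℚ
    sign (suc n) = - sign n

    sign² : ∀ n → sign n * sign n ≡ 1ℚ
    sign² zero    = ≡.refl
    sign² (suc n) = ≡.trans (solve 1 (λ s → (:- s) :* (:- s) := s :* s) ≡.refl (sign n)) (sign² n)

    parity : ∀ n x → value n (- x) ≡ sign n * value n x
    parity zero          x = ≡.refl
    parity (suc zero)    x =
      solve 1 (λ x → con 2ℚ :* (:- x) :+ con 0ℚ := (:- con 1ℚ) :* (con 2ℚ :* x :+ con 0ℚ)) ≡.refl x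
    parity (suc (suc n)) x = ≡.trans
      (≡.cong₂ (λ b a → (2ℚ * (- x) + 0ℚ) * b + (- w n) * a) (parity (suc n) x) (parity n x))
      (solve 5 (λ x w s a b → (con 2ℚ :* (:- x) :+ con 0ℚ) :* ((:- s) :* b) :+ (:- w) :* (s :* a)
                  := (:- (:- s)) :* ((con 2ℚ :* x :+ con 0ℚ) :* b :+ (:- w) :* a))
         ≡.refl x (w n) (sign n) (value n x) (value (suc n) x))

    -- In this product and the next the sign (-1)ⁿ occurs squared, so signs at -X follow from signs
    -- at X without a case distinction on n.
    parity² : ∀ n x → value n (- x) * value n (- x) ≡ value n x * value n x
    parity² n x = ≡.trans (≡.cong₂ _*_ (parity n x) (parity n x)) (≡.trans
      (solve 2 (λ s a → (s :* a) :* (s :* a) := (s :* s) :* (a :* a)) ≡.refl (sign n) (value n x))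
      (≡.trans (≡.cong (_* (value n x * value n x)) (sign² n)) (ℚ.*-identityˡ _)))

    parity-two-steps : ∀ n x →
      value (suc (suc n)) (- x) * value n (- x) ≡ value (suc (suc n)) x * value n x
    parity-two-steps n x = ≡.trans (≡.cong₂ _*_ (parity (suc (suc n)) x) (parity n x)) (≡.trans
      (solve 3 (λ s a c → ((:- (:- s)) :* c) :* (s :* a) := (s :* s) :* (c :* a)) ≡.refl
         (sign n) (value n x) (value (suc (suc n)) x))
      (≡.trans (≡.cong (_* (value (suc (suc n)) x * value n x)) (sign² n)) (ℚ.*-identityˡ _)))

  module Roots
    (R : CommutativeRing 0ℓ 0ℓ)
    (κ-morphism : ℚ.+-*-rawRing -Raw-AlmostCommutative⟶ fromCommutativeRing R)
    where

    open ℚ-Algebra R κ-morphism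
    open Solver using (solve; _:+_; _:*_; _:-_; :-_; _:=_)
    open Relation.Binary.Reasoning.Setoid setoid

    value-κ : ∀ b v n q → Recurrence.value b v n (κ q) ≈ κ (ℚ-alg.Recurrence.value b v n q)
    value-κ b v zero          q = sym κ-1
    value-κ b v (suc zero)    q = trans (+-congʳ (sym (κ-* 2ℚ q))) (sym (κ-+ (2ℚ ℚ.* q) b))
    value-κ b v (suc (suc n)) q = trans
      (+-cong (*-cong (value-κ b v 1 q) (value-κ b v (suc n) q)) (*-congˡ (value-κ b v n q)))
      (trans (+-cong (sym (κ-* _ _)) (sym (κ-* _ _))) (sym (κ-+ _ _)))

    -- What the interlacing induction needs of ℝ. The intermediate value property is demanded only
    -- for the recurrence polynomials, since the later proof of it relies on their rational values
    -- at rational points.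
    record IntermediateValueField : Set₁ where
      infix 4 _≺_
      field
        Pos         : Carrier → Set
        Pos-resp    : ∀ {x y} → x ≈ y → Pos x → Pos y
        Pos-κ       : ∀ {q} → 0ℚ ℚ.< q → Pos (κ q)
        Pos-+       : ∀ {x y} → Pos x → Pos y → Pos (x + y)
        Pos-*       : ∀ {x y} → Pos x → Pos y → Pos (x * y)
        Pos-cancelˡ : ∀ {x y} → Pos x → Pos (x * y) → Pos y
        Pos-regular : ∀ {x} → Pos x → Regular x

      _≺_ : Carrier → Carrier → Set
      x ≺ y = Pos (y - x)

      field
        -- Quantifying over all larger r lets one maximum satisfy several bounds at once.
        bound : ∀ x → ∃ λ q → ∀ r → q ℚ.≤ r → x ≺ κ r × κ (ℚ.- r) ≺ x
        intermediate-value : ∀ b v n x y → x ≺ y →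
          Pos (- (Recurrence.value b v n x * Recurrence.value b v n y)) →
          ∃ λ u → x ≺ u × u ≺ y × Recurrence.value b v n u ≈ 0#

    module Interlacing (F : IntermediateValueField) (w : ℕ → ℚ) (0<w : ∀ n → 0ℚ ℚ.< w n) where

      open IntermediateValueField F
      open Recurrence 0ℚ (λ n → ℚ.- w n)
      open Growth w 0<w using (eventually-large; parity²; parity-two-steps)

      valueℚ : ℕ → ℚ → ℚ
      valueℚ = ℚ-alg.Recurrence.value 0ℚ (λ n → ℚ.- w n)

      ≺-trans : ∀ {x y z} → x ≺ y → y ≺ z → x ≺ z
      ≺-trans {x} {y} {z} x≺y y≺z = Pos-resp
        (solve 3 (λ x y z → (y :- x) :+ (z :- y) := z :- x) refl x y z) (Pos-+ x≺y y≺z)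

      Pos-1 : Pos 1#
      Pos-1 = Pos-resp κ-1 (Pos-κ 0<1)

      increasing : ∀ {m} (f : ℕ → Carrier) → (∀ i → suc i ℕ.< m → f i ≺ f (suc i)) →
                   ∀ {i j} → i ℕ.<′ j → j ℕ.< m → f i ≺ f j
      increasing f step {i} ℕ.≤′-refl           j<m = step i j<m
      increasing f step {i} (ℕ.≤′-step {j} i<j) j<m =
        ≺-trans (increasing f step i<j (ℕ.<-trans (ℕ.n<1+n j) j<m)) (step j j<m)

      ∏-distrib-* : ∀ {n} (f g : Vector Carrier n) → ∏ f * ∏ g ≈ ∏ (λ i → f i * g i)
      ∏-distrib-* {zero}  f g = *-identityˡ 1#
      ∏-distrib-* {suc n} f g = begin
        (f zero * ∏ (f ∘ suc)) * (g zero * ∏ (g ∘ suc))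
          ≈⟨ solve 4 (λ a p b q → (a :* p) :* (b :* q) := (a :* b) :* (p :* q)) refl
               (f zero) (∏ (f ∘ suc)) (g zero) (∏ (g ∘ suc)) ⟩
        (f zero * g zero) * (∏ (f ∘ suc) * ∏ (g ∘ suc))
          ≈⟨ *-congˡ (∏-distrib-* (f ∘ suc) (g ∘ suc)) ⟩
        (f zero * g zero) * ∏ (λ i → f (suc i) * g (suc i)) ∎

      ∏-pos : ∀ {n} (f : Vector Carrier n) → (∀ i → Pos (f i)) → Pos (∏ f)
      ∏-pos {zero}  f pos = Pos-1
      ∏-pos {suc n} f pos = Pos-* (pos zero) (∏-pos (f ∘ suc) (pos ∘ suc))

      ∏-neg : ∀ {n} (f : Vector Carrier n) k → Pos (- f k) → (∀ i → i ≢ k → Pos (f i)) → Pos (- ∏ f)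
      ∏-neg {suc n} f zero    neg pos = Pos-resp
        (solve 2 (λ a p → (:- a) :* p := :- (a :* p)) refl (f zero) (∏ (f ∘ suc)))
        (Pos-* neg (∏-pos (f ∘ suc) (λ i → pos (suc i) λ ())))
      ∏-neg {suc n} f (suc k) neg pos = Pos-resp
        (solve 2 (λ a p → a :* (:- p) := :- (a :* p)) refl (f zero) (∏ (f ∘ suc)))
        (Pos-* (pos zero λ ()) (∏-neg (f ∘ suc) k neg (λ i i≢k → pos (suc i) (i≢k ∘ Fin.suc-injective))))

      both-below : ∀ {x y s} → x ≺ s → y ≺ s → Pos ((x - s) * (y - s))
      both-below {x} {y} {s} x≺s y≺s = Pos-resp
        (solve 3 (λ x y s → (s :- x) :* (s :- y) := (x :- s) :* (y :- s)) refl x y s) (Pos-* x≺s y≺s)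

      separated : ∀ {x y s} → x ≺ s → s ≺ y → Pos (- ((x - s) * (y - s)))
      separated {x} {y} {s} x≺s s≺y = Pos-resp
        (solve 3 (λ x y s → (s :- x) :* (y :- s) := :- ((x :- s) :* (y :- s))) refl x y s) (Pos-* x≺s s≺y)

      -- Roots are indexed by ℕ and constrained only below the degree, which avoids conversions
      -- between `Fin n` and `Fin (suc n)` as the degree grows.
      record Interlaced (n : ℕ) (t s : ℕ → Carrier) : Set where
        field
          t-root : ∀ i → i ℕ.< suc n → value (suc n) (t i) ≈ 0#
          s-root : ∀ i → i ℕ.< n → value n (s i) ≈ 0#
          t≺s    : ∀ i → i ℕ.< n → t i ≺ s i
          s≺t    : ∀ i → i ℕ.< n → s i ≺ t (suc i)

        t-increasing : ∀ {i j} → i ℕ.< j → j ℕ.< suc n → t i ≺ t j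
        t-increasing i<j = increasing t
          (λ i 1+i<1+n → ≺-trans (t≺s i (ℕ.s≤s⁻¹ 1+i<1+n)) (s≺t i (ℕ.s≤s⁻¹ 1+i<1+n))) (ℕ.<⇒<′ i<j)

        s-increasing : ∀ {i j} → i ℕ.< j → j ℕ.< n → s i ≺ s j
        s-increasing i<j = increasing s
          (λ i 1+i<n → ≺-trans (s≺t i (ℕ.<-trans (ℕ.n<1+n i) 1+i<n)) (t≺s (suc i) 1+i<n)) (ℕ.<⇒<′ i<j)

        t≺s′ : ∀ {i j} → i ℕ.≤ j → j ℕ.< n → t i ≺ s j
        t≺s′ {i} {j} i≤j j<n with ℕ.m≤n⇒m<n∨m≡n i≤j
        ... | inj₁ i<j    = ≺-trans (t-increasing i<j (ℕ.<-trans j<n (ℕ.n<1+n n))) (t≺s j j<n)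
        ... | inj₂ ≡.refl = t≺s i j<n

        s≺t′ : ∀ {i j} → j ℕ.< i → i ℕ.< suc n → s j ≺ t i
        s≺t′ {i} {j} j<i i<1+n with ℕ.m≤n⇒m<n∨m≡n j<i
        ... | inj₁ 1+j<i  = ≺-trans (s≺t j (ℕ.<-≤-trans j<i (ℕ.s≤s⁻¹ i<1+n))) (t-increasing 1+j<i i<1+n)
        ... | inj₂ ≡.refl = s≺t j (ℕ.s≤s⁻¹ i<1+n)

        value-product : ∀ x → value n x ≈ κ (2^ n) * ∏ {n} (λ i → x - s (toℕ i))
        value-product = value-factorisation n (s ∘ toℕ)
          (λ i j i<j → Pos-regular (s-increasing i<j (Fin.toℕ<n j)))
          (λ i → s-root (toℕ i) (Fin.toℕ<n i))

      module Step (n : ℕ) (t s : ℕ → Carrier) (interlaced : Interlaced n t s) where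

        open Interlaced interlaced

        -- Signs are compared only for pairs of points. The factor belonging to sⱼ is negative if sⱼ
        -- separates x from y and positive if both lie on the same side, so no power of -1 has to be
        -- tracked.
        value-*-value : ∀ x y → κ (2^ n ℚ.* 2^ n) * ∏ {n} (λ j → (x - s (toℕ j)) * (y - s (toℕ j)))
                              ≈ value n x * value n y
        value-*-value x y = sym (begin
          value n x * value n y
            ≈⟨ *-cong (value-product x) (value-product y) ⟩
          (κ (2^ n) * p) * (κ (2^ n) * q)
            ≈⟨ solve 3 (λ c p q → (c :* p) :* (c :* q) := (c :* c) :* (p :* q)) refl (κ (2^ n)) p q ⟩
          (κ (2^ n) * κ (2^ n)) * (p * q)
            ≈⟨ *-cong (sym (κ-* (2^ n) (2^ n))) (∏-distrib-* {n} (λ j → x - s (toℕ j)) (λ j → y - s (toℕ j))) ⟩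
          κ (2^ n ℚ.* 2^ n) * ∏ {n} (λ j → (x - s (toℕ j)) * (y - s (toℕ j))) ∎)
          where
          p = ∏ {n} (λ j → x - s (toℕ j))
          q = ∏ {n} (λ j → y - s (toℕ j))

        0<4^ : Pos (κ (2^ n ℚ.* 2^ n))
        0<4^ = Pos-κ (0<p*q (0<2^ n) (0<2^ n))

        next-at-root : ∀ i → i ℕ.< suc n → value (suc (suc n)) (t i) ≈ - (κ (w n) * value n (t i))
        next-at-root i i<1+n = begin
          (κ 2ℚ * t i + κ 0ℚ) * value (suc n) (t i) + κ (ℚ.- w n) * value n (t i)
            ≈⟨ +-cong (*-zero-congʳ (t-root i i<1+n)) (*-congʳ (κ-neg (w n))) ⟩
          0# + (- κ (w n)) * value n (t i)
            ≈⟨ +-identityˡ _ ⟩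
          (- κ (w n)) * value n (t i)
            ≈⟨ solve 2 (λ a b → (:- a) :* b := :- (a :* b)) refl (κ (w n)) (value n (t i)) ⟩
          - (κ (w n) * value n (t i)) ∎

        t≺t⁺ : ∀ i → i ℕ.< n → t i ≺ t (suc i)
        t≺t⁺ i i<n = t-increasing (ℕ.n<1+n i) (s≤s i<n)

        -- Of all the roots of p_n only sᵢ lies between tᵢ and tᵢ₊₁, so exactly one factor of the
        -- product is negative. The two factors -w from `next-at-root` multiply to w² > 0.
        middle-sign : ∀ i → i ℕ.< n →
          Pos (- (value (suc (suc n)) (t i) * value (suc (suc n)) (t (suc i))))
        middle-sign i i<n = Pos-resp
          (begin
            (κ (w n) * κ (w n)) * (κ (2^ n ℚ.* 2^ n) * (- ∏ f))
              ≈⟨ solve 3 (λ w c p → (w :* w) :* (c :* (:- p)) := :- ((w :* w) :* (c :* p)))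
                   refl (κ (w n)) (κ (2^ n ℚ.* 2^ n)) (∏ f) ⟩
            - ((κ (w n) * κ (w n)) * (κ (2^ n ℚ.* 2^ n) * ∏ f))
              ≈⟨ -‿cong (*-congˡ (value-*-value (t i) (t (suc i)))) ⟩
            - ((κ (w n) * κ (w n)) * (value n (t i) * value n (t (suc i))))
              ≈⟨ solve 3 (λ w a b → :- ((w :* w) :* (a :* b)) := :- ((:- (w :* a)) :* (:- (w :* b))))
                   refl (κ (w n)) (value n (t i)) (value n (t (suc i))) ⟩
            - ((- (κ (w n) * value n (t i))) * (- (κ (w n) * value n (t (suc i)))))
              ≈⟨ -‿cong (*-cong (sym (next-at-root i (ℕ.<-trans i<n (ℕ.n<1+n n))))
                                (sym (next-at-root (suc i) (s≤s i<n)))) ⟩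
            - (value (suc (suc n)) (t i) * value (suc (suc n)) (t (suc i))) ∎)
          (Pos-* (Pos-* (Pos-κ (0<w n)) (Pos-κ (0<w n))) (Pos-* 0<4^
            (∏-neg f (fromℕ< i<n)
              (≡.subst (λ k → Pos (- ((t i - s k) * (t (suc i) - s k)))) (≡.sym (Fin.toℕ-fromℕ< i<n))
                 (separated (t≺s i i<n) (s≺t i i<n)))
              off-diagonal)))
          where
          f : Vector Carrier n
          f j = (t i - s (toℕ j)) * (t (suc i) - s (toℕ j))
          off-diagonal : ∀ j → j ≢ fromℕ< i<n → Pos (f j)
          off-diagonal j j≢i with ℕ.<-cmp (toℕ j) i
          ... | tri< j<i _ _ = Pos-* (s≺t′ j<i (ℕ.<-trans i<n (ℕ.n<1+n n)))
                                     (s≺t′ (ℕ.<-trans j<i (ℕ.n<1+n i)) (s≤s i<n))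
          ... | tri≈ _ j≡i _ = contradiction
                  (Fin.toℕ-injective (≡.trans j≡i (≡.sym (Fin.toℕ-fromℕ< i<n)))) j≢i
          ... | tri> _ _ i<j = both-below (t≺s′ (ℕ.<⇒≤ i<j) (Fin.toℕ<n j)) (t≺s′ i<j (Fin.toℕ<n j))

        -- A rational X with -X and X beyond all t i, where moreover the values
        -- of the recurrence have their asymptotic signs.
        barrier : ∃ λ X → t n ≺ κ X × κ (ℚ.- X) ≺ t 0 × 0ℚ ℚ.< valueℚ n X × 0ℚ ℚ.< valueℚ (suc (suc n)) X
        barrier =
          let q₁ , above = bound (t n)
              q₂ , below = bound (t 0)
              q₃ , large₀ = eventually-large n
              q₄ , large₂ = eventually-large (suc (suc n))
              X = (q₁ ℚ.⊔ q₂) ℚ.⊔ (q₃ ℚ.⊔ q₄)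
          in X
           , proj₁ (above X (ℚ.≤-trans (ℚ.p≤p⊔q q₁ q₂) (ℚ.p≤p⊔q (q₁ ℚ.⊔ q₂) (q₃ ℚ.⊔ q₄))))
           , proj₂ (below X (ℚ.≤-trans (ℚ.p≤q⊔p q₁ q₂) (ℚ.p≤p⊔q (q₁ ℚ.⊔ q₂) (q₃ ℚ.⊔ q₄))))
           , proj₁ (large₀ X (ℚ.≤-trans (ℚ.p≤p⊔q q₃ q₄) (ℚ.p≤q⊔p (q₁ ℚ.⊔ q₂) (q₃ ℚ.⊔ q₄))))
           , proj₁ (large₂ X (ℚ.≤-trans (ℚ.p≤q⊔p q₃ q₄) (ℚ.p≤q⊔p (q₁ ℚ.⊔ q₂) (q₃ ℚ.⊔ q₄))))

        X : ℚ
        X = proj₁ barrier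

        -- All sⱼ lie below tₙ, so p_n is positive at tₙ and p_{n+2} is negative there, while
        -- p_{n+2} is positive at X.
        right-sign : Pos (- (value (suc (suc n)) (t n) * value (suc (suc n)) (κ X)))
        right-sign = Pos-resp
          (begin
            (κ (w n) * value n (t n)) * κ (valueℚ (suc (suc n)) X)
              ≈⟨ solve 2 (λ a b → a :* b := :- ((:- a) :* b)) refl _ _ ⟩
            - ((- (κ (w n) * value n (t n))) * κ (valueℚ (suc (suc n)) X))
              ≈⟨ -‿cong (*-cong (sym (next-at-root n (ℕ.n<1+n n))) (sym (value-κ _ _ (suc (suc n)) X))) ⟩
            - (value (suc (suc n)) (t n) * value (suc (suc n)) (κ X)) ∎)
          (Pos-* (Pos-* (Pos-κ (0<w n)) (Pos-resp (sym (value-product (t n)))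
                   (Pos-* (Pos-κ (0<2^ n))
                     (∏-pos {n} (λ j → t n - s (toℕ j)) (λ j → s≺t′ (Fin.toℕ<n j) (ℕ.n<1+n n))))))
                 (Pos-κ (proj₂ (proj₂ (proj₂ (proj₂ barrier))))))

        -- Let a and c be the values of p_n and p_{n+2} at -X, and y that of p_n at t₀. Parity gives
        -- ca > 0, and ay > 0 because all sⱼ lie above both points. Hence a² · cy > 0, and
        -- cancelling a² leaves cy > 0; at t₀ the value of p_{n+2} is -wy.
        left-sign : Pos (- (value (suc (suc n)) (κ (ℚ.- X)) * value (suc (suc n)) (t 0)))
        left-sign = Pos-resp
          (begin
            κ (w n) * (c * y)
              ≈⟨ solve 3 (λ w c y → w :* (c :* y) := :- (c :* (:- (w :* y)))) refl (κ (w n)) c y ⟩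
            - (c * (- (κ (w n) * y)))
              ≈⟨ -‿cong (*-cong (sym (value-κ _ _ (suc (suc n)) (ℚ.- X))) (sym (next-at-root 0 (s≤s z≤n)))) ⟩
            - (value (suc (suc n)) (κ (ℚ.- X)) * value (suc (suc n)) (t 0)) ∎)
          (Pos-* (Pos-κ (0<w n)) (Pos-cancelˡ 0<a² (Pos-resp
            (solve 3 (λ a c y → (c :* a) :* (a :* y) := (a :* a) :* (c :* y)) refl a c y)
            (Pos-* 0<ca 0<ay))))
          where
          a = κ (valueℚ n (ℚ.- X))
          c = κ (valueℚ (suc (suc n)) (ℚ.- X))
          y = value n (t 0)
          -X≺t₀ : κ (ℚ.- X) ≺ t 0
          -X≺t₀ = proj₁ (proj₂ (proj₂ barrier))
          0<V : 0ℚ ℚ.< valueℚ n X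
          0<V = proj₁ (proj₂ (proj₂ (proj₂ barrier)))
          0<a² : Pos (a * a)
          0<a² = Pos-resp (κ-* _ _) (Pos-κ (≡.subst (0ℚ ℚ.<_) (≡.sym (parity² n X)) (0<p*q 0<V 0<V)))
          0<ca : Pos (c * a)
          0<ca = Pos-resp (κ-* _ _) (Pos-κ (≡.subst (0ℚ ℚ.<_) (≡.sym (parity-two-steps n X))
            (0<p*q (proj₂ (proj₂ (proj₂ (proj₂ barrier)))) 0<V)))
          0<ay : Pos (a * y)
          0<ay = Pos-resp
            (trans (value-*-value (κ (ℚ.- X)) (t 0)) (*-congʳ (value-κ _ _ n (ℚ.- X))))
            (Pos-* 0<4^ (∏-pos {n} (λ j → (κ (ℚ.- X) - s (toℕ j)) * (t 0 - s (toℕ j))) (λ j → both-below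
              (≺-trans -X≺t₀ (t≺s′ z≤n (Fin.toℕ<n j))) (t≺s′ z≤n (Fin.toℕ<n j)))))

        first : ∃ λ u → value (suc (suc n)) u ≈ 0# × u ≺ t 0
        first =
          let u , _ , u≺t₀ , root = intermediate-value _ _ (suc (suc n)) (κ (ℚ.- X)) (t 0)
                                      (proj₁ (proj₂ (proj₂ barrier))) left-sign
          in u , root , u≺t₀

        -- Defined for every natural i: from n onwards it returns the root beyond tₙ. The two bounds
        -- are therefore conditional on i.
        later : ∀ i → ∃ λ u → value (suc (suc n)) u ≈ 0#
                            × (i ℕ.< suc n → t i ≺ u) × (i ℕ.< n → u ≺ t (suc i))
        later i with i ℕ.<? n
        ... | yes i<n =
          let u , t≺u , u≺t , root = intermediate-value _ _ (suc (suc n)) (t i) (t (suc i))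
                                       (t≺t⁺ i i<n) (middle-sign i i<n)
          in u , root , (λ _ → t≺u) , (λ _ → u≺t)
        ... | no i≮n =
          let u , t≺u , _ , root = intermediate-value _ _ (suc (suc n)) (t n) (κ X)
                                     (proj₁ (proj₂ barrier)) right-sign
          in u , root
           , (λ i<1+n → ≡.subst (λ k → t k ≺ u) (ℕ.≤-antisym (ℕ.≮⇒≥ i≮n) (ℕ.s≤s⁻¹ i<1+n)) t≺u)
           , (λ i<n → contradiction i<n i≮n)

        next : ℕ → Carrier
        next zero    = proj₁ first
        next (suc i) = proj₁ (later i)

        next-interlaced : Interlaced (suc n) next t
        next-interlaced = record
          { t-root = λ { zero    _ → proj₁ (proj₂ first)
                       ; (suc i) _ → proj₁ (proj₂ (later i)) }
          ; s-root = t-root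
          ; t≺s    = λ { zero    _     → proj₂ (proj₂ first)
                       ; (suc i) 1+i<1+n → proj₂ (proj₂ (proj₂ (later i))) (ℕ.s≤s⁻¹ 1+i<1+n) }
          ; s≺t    = λ i i<1+n → proj₁ (proj₂ (proj₂ (later i))) i<1+n
          }

      interlaced-roots : ∀ n → ∃₂ λ t s → Interlaced n t s
      -- p₁ = 2t vanishes at 0. p₀ has no roots, so the second sequence is a default value.
      interlaced-roots zero = (λ _ → κ 0ℚ) , (λ _ → κ 0ℚ) , record
        { t-root = λ _ _ → begin
            κ 2ℚ * κ 0ℚ + κ 0ℚ  ≈⟨ +-cong (*-zero-congʳ κ-0) κ-0 ⟩
            0# + 0#             ≈⟨ +-identityˡ 0# ⟩
            0#                  ∎
        ; s-root = λ _ ()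
        ; t≺s    = λ _ ()
        ; s≺t    = λ _ ()
        }
      interlaced-roots (suc n) =
        let t , s , interlaced = interlaced-roots n
        in Step.next n t s interlaced , t , Step.next-interlaced n t s interlaced

-- Linear functionals and convex combinations over an abstract ring

module Functionals where

  open Polynomials
  open Rationals

  ∑ℤ : ∀ {n} → Vector ℤ n → ℤ
  ∑ℤ = foldr ℤ._+_ (+ 0)

  ∑ℚ : ∀ {n} → Vector ℚ n → ℚ
  ∑ℚ = foldr ℚ._+_ 0ℚ

  module Hull
    (R : CommutativeRing 0ℓ 0ℓ)
    (κ-morphism : ℚ.+-*-rawRing -Raw-AlmostCommutative⟶ fromCommutativeRing R)
    where

    open ℚ-Algebra R κ-morphism
    open Algebra.Properties.Semiring.Sum semiring
      using (sum-cong-≋; ∑-distrib-+; ∑-comm; *-distribˡ-sum; *-distribʳ-sum) renaming (sum to ∑)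
    open Solver using (solve; _:+_; _:*_; _:-_; :-_; _:=_)
    open Relation.Binary.Reasoning.Setoid setoid

    -0≈0 : - 0# ≈ 0#
    -0≈0 = trans (sym (+-identityˡ _)) (-‿inverseʳ 0#)

    ∑-zero : ∀ {n} (f : Vector Carrier n) → (∀ i → f i ≈ 0#) → ∑ f ≈ 0#
    ∑-zero {zero}  f f≈0 = refl
    ∑-zero {suc n} f f≈0 = trans (+-cong (f≈0 zero) (∑-zero (f ∘ suc) (f≈0 ∘ suc))) (+-identityˡ 0#)

    ∑-single : ∀ {n} (f : Vector Carrier n) k → (∀ i → i ≢ k → f i ≈ 0#) → ∑ f ≈ f k
    ∑-single {suc n} f zero    f≈0 =
      trans (+-congˡ (∑-zero (f ∘ suc) (λ i → f≈0 (suc i) λ ()))) (+-identityʳ (f zero))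
    ∑-single {suc n} f (suc k) f≈0 = trans
      (+-cong (f≈0 zero λ ()) (∑-single (f ∘ suc) k (λ i i≢k → f≈0 (suc i) (i≢k ∘ Fin.suc-injective))))
      (+-identityˡ (f (suc k)))

    ∑-κ : ∀ {n} (f : Vector ℚ n) → ∑ (κ ∘ f) ≈ κ (∑ℚ f)
    ∑-κ {zero}  f = sym κ-0
    ∑-κ {suc n} f = trans (+-congˡ (∑-κ (f ∘ suc))) (sym (κ-+ (f zero) (∑ℚ (f ∘ suc))))

    ∑-ι* : ∀ {n} (a x : Vector ℤ n) →
      ∑ (λ u → κ (ι (a u)) * κ (ι (x u))) ≈ κ (ι (∑ℤ (λ u → a u ℤ.* x u)))
    ∑-ι* {zero}  a x = sym κ-0
    ∑-ι* {suc n} a x = trans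
      (+-cong (trans (sym (κ-* _ _)) (κ-cong (≡.sym (ι-* (a zero) (x zero))))) (∑-ι* (a ∘ suc) (x ∘ suc)))
      (trans (sym (κ-+ _ _)) (κ-cong (≡.sym (ι-+ (a zero ℤ.* x zero) _))))

    -- The support inequality a·x ≤ rs in the form of an identity, as the ring has no order: the gap
    -- rs - a·x equals s Σ cⱼ (r - qⱼ), where qⱼ is the value of a on the vertex pⱼ. Over ℝ the
    -- terms are nonnegative once r bounds the qⱼ.
    functional-identity : ∀ {m k} (a x : Vector ℤ m) (r s : ℤ)
      (y : Vector Carrier m) (c : Vector Carrier k) (p : Vector (Vector Carrier m) k) (q : Vector ℤ k) →
      (∀ u → κ (ι (x u)) ≈ κ (ι s) * y u) → (∀ u → y u ≈ ∑ (λ j → c j * p j u)) → ∑ c ≈ 1# →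
      (∀ j → ∑ (λ u → κ (ι (a u)) * p j u) ≈ κ (ι (q j))) →
      ∀ g → (∀ j → g j ≈ c j * κ (ι r ℚ.- ι (q j))) →
      ∑ g * κ (ι s) ≈ κ (ι (r ℤ.* s ℤ.- ∑ℤ (λ u → a u ℤ.* x u)))
    functional-identity {m} {k} a x r s y c p q x≈sy y≈cp ∑c≈1 pj≈qj g g≈ = begin
      ∑ g * S
        ≈⟨ *-congʳ (sum-cong-≋ (λ j → trans (trans (g≈ j)
             (*-congˡ (trans (κ-+ (ι r) (ℚ.- ι (q j))) (+-congˡ (κ-neg (ι (q j)))))))
             (solve 3 (λ c r q → c :* (r :- q) := c :* r :+ (:- (c :* q))) refl (c j) (κ (ι r)) (κ (ι (q j)))))) ⟩
      ∑ (λ j → c j * κ (ι r) + (- (c j * κ (ι (q j))))) * S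
        ≈⟨ *-congʳ (trans (∑-distrib-+ (λ j → c j * κ (ι r)) (λ j → - (c j * κ (ι (q j)))))
             (+-cong (sym (*-distribʳ-sum (κ (ι r)) c)) (∑-neg (λ j → c j * κ (ι (q j)))))) ⟩
      (∑ c * κ (ι r) - ∑ (λ j → c j * κ (ι (q j)))) * S
        ≈⟨ *-congʳ (+-congʳ (trans (*-congʳ ∑c≈1) (*-identityˡ _))) ⟩
      (κ (ι r) - ∑ (λ j → c j * κ (ι (q j)))) * S
        ≈⟨ solve 3 (λ r q s → (r :- q) :* s := r :* s :- s :* q) refl (κ (ι r)) _ S ⟩
      κ (ι r) * S - S * ∑ (λ j → c j * κ (ι (q j)))
        ≈⟨ +-cong (trans (sym (κ-* _ _)) (κ-cong (≡.sym (ι-* r s)))) (-‿cong exchange) ⟩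
      κ (ι (r ℤ.* s)) - κ (ι (∑ℤ (λ u → a u ℤ.* x u)))
        ≈⟨ trans (+-congˡ (sym (κ-neg _))) (sym (κ-+ _ _)) ⟩
      κ (ι (r ℤ.* s) ℚ.- ι (∑ℤ (λ u → a u ℤ.* x u)))
        ≈⟨ κ-cong (≡.sym (≡.trans (ι-+ (r ℤ.* s) (ℤ.- ax)) (≡.cong (ι (r ℤ.* s) ℚ.+_) (ι-neg ax)))) ⟩
      κ (ι (r ℤ.* s ℤ.- ∑ℤ (λ u → a u ℤ.* x u))) ∎
      where
      S  = κ (ι s)
      ax = ∑ℤ (λ u → a u ℤ.* x u)
      ∑-neg : ∀ {n} (f : Vector Carrier n) → ∑ (λ j → - f j) ≈ - ∑ f
      ∑-neg {zero}  f = sym -0≈0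
      ∑-neg {suc n} f = trans (+-congˡ (∑-neg (f ∘ suc)))
        (solve 2 (λ a b → (:- a) :+ (:- b) := :- (a :+ b)) refl (f zero) (∑ (f ∘ suc)))
      exchange : S * ∑ (λ j → c j * κ (ι (q j))) ≈ κ (ι ax)
      exchange = begin
        S * ∑ (λ j → c j * κ (ι (q j)))
          ≈⟨ *-congˡ (sum-cong-≋ (λ j → trans (*-congˡ (sym (pj≈qj j)))
               (trans (*-distribˡ-sum (c j) (λ u → κ (ι (a u)) * p j u))
                 (sum-cong-≋ (λ u → solve 3 (λ c a p → c :* (a :* p) := a :* (c :* p)) refl
                    (c j) (κ (ι (a u))) (p j u)))))) ⟩
        S * ∑ (λ j → ∑ (λ u → κ (ι (a u)) * (c j * p j u)))
          ≈⟨ *-congˡ (∑-comm (λ j u → κ (ι (a u)) * (c j * p j u))) ⟩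
        S * ∑ (λ u → ∑ (λ j → κ (ι (a u)) * (c j * p j u)))
          ≈⟨ *-distribˡ-sum S (λ u → ∑ (λ j → κ (ι (a u)) * (c j * p j u))) ⟩
        ∑ (λ u → S * ∑ (λ j → κ (ι (a u)) * (c j * p j u)))
          ≈⟨ sum-cong-≋ (λ u → trans
               (*-congˡ (trans (sym (*-distribˡ-sum (κ (ι (a u))) (λ j → c j * p j u))) (*-congˡ (sym (y≈cp u)))))
               (trans (solve 3 (λ s a y → s :* (a :* y) := a :* (s :* y)) refl S (κ (ι (a u))) (y u))
                 (*-congˡ (sym (x≈sy u))))) ⟩
        ∑ (λ u → κ (ι (a u)) * κ (ι (x u)))
          ≈⟨ ∑-ι* a x ⟩
        κ (ι ax) ∎

    module Basis {m} (d : Fin m → Fin m → Carrier)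
      (d-diagonal : ∀ v → d v v ≈ 1#) (d-off : ∀ v u → u ≢ v → d v u ≈ 0#) where

      ∑-basis : ∀ (f : Vector Carrier m) v → ∑ (λ u → f u * d v u) ≈ f v
      ∑-basis f v = trans (∑-single (λ u → f u * d v u) v (λ u u≢v → *-zero-congʳ (d-off v u u≢v)))
        (trans (*-congˡ (d-diagonal v)) (*-identityʳ (f v)))

      edge-functional : ∀ (a : Vector ℤ m) (p : Vector Carrier m) v w → (∀ u → p u ≈ d v u - d w u) →
        ∑ (λ u → κ (ι (a u)) * p u) ≈ κ (ι (a v ℤ.- a w))
      edge-functional a p v w p≈ = begin
        ∑ (λ u → κ (ι (a u)) * p u)
          ≈⟨ sum-cong-≋ (λ u → trans (*-congˡ (p≈ u))
               (solve 3 (λ a x y → a :* (x :- y) := a :* x :+ (:- a) :* y) refl (κ (ι (a u))) (d v u) (d w u))) ⟩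
        ∑ (λ u → κ (ι (a u)) * d v u + (- κ (ι (a u))) * d w u)
          ≈⟨ ∑-distrib-+ (λ u → κ (ι (a u)) * d v u) (λ u → (- κ (ι (a u))) * d w u) ⟩
        ∑ (λ u → κ (ι (a u)) * d v u) + ∑ (λ u → (- κ (ι (a u))) * d w u)
          ≈⟨ +-cong (∑-basis (λ u → κ (ι (a u))) v) (∑-basis (λ u → - κ (ι (a u))) w) ⟩
        κ (ι (a v)) - κ (ι (a w))
          ≈⟨ +-congˡ (sym (κ-neg (ι (a w)))) ⟩
        κ (ι (a v)) + κ (ℚ.- ι (a w))
          ≈⟨ κ-+ (ι (a v)) (ℚ.- ι (a w)) ⟨
        κ (ι (a v) ℚ.- ι (a w))
          ≈⟨ κ-cong (≡.trans (≡.cong (ι (a v) ℚ.+_) (≡.sym (ι-neg (a w)))) (≡.sym (ι-+ (a v) (ℤ.- a w)))) ⟩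
        κ (ι (a v ℤ.- a w)) ∎

    module Star {n} (d : Fin (suc n) → Fin (suc n) → Carrier)
      (d-diagonal : ∀ v → d v v ≈ 1#) (d-off : ∀ v u → u ≢ v → d v u ≈ 0#)
      (t : Vector ℚ n) (X : Vector Carrier (suc n))
      (X-zero : X zero ≈ - κ (∑ℚ t)) (X-suc : ∀ i → X (suc i) ≈ κ (t i))
      where

      star-sum : ∀ u → ∑ (λ i → κ (t i) * (d (suc i) u - d zero u)) ≈ X u
      star-sum zero = begin
        ∑ (λ i → κ (t i) * (d (suc i) zero - d zero zero))
          ≈⟨ sum-cong-≋ (λ i → trans (*-congˡ (+-cong (d-off (suc i) zero λ ()) (-‿cong (d-diagonal zero))))
               (trans (*-congˡ (+-identityˡ _)) (*-comm (κ (t i)) (- 1#)))) ⟩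
        ∑ (λ i → (- 1#) * κ (t i))
          ≈⟨ *-distribˡ-sum (- 1#) (κ ∘ t) ⟨
        (- 1#) * ∑ (κ ∘ t)   ≈⟨ *-congˡ (∑-κ t) ⟩
        (- 1#) * κ (∑ℚ t)    ≈⟨ -1*x (κ (∑ℚ t)) ⟩
        - κ (∑ℚ t)           ≈⟨ X-zero ⟨
        X zero               ∎
      star-sum (suc k) = begin
        ∑ (λ i → κ (t i) * (d (suc i) (suc k) - d zero (suc k)))
          ≈⟨ ∑-single _ k (λ i i≢k → *-zero-congʳ
               (trans (+-cong (d-off (suc i) (suc k) (i≢k ∘ ≡.sym ∘ Fin.suc-injective)) refl)
                 (x≈y⇒x-y≈0 (sym (d-off zero (suc k) λ ()))))) ⟩
        κ (t k) * (d (suc k) (suc k) - d zero (suc k))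
          ≈⟨ *-congˡ (+-cong (d-diagonal (suc k)) (-‿cong (d-off zero (suc k) λ ()))) ⟩
        κ (t k) * (1# - 0#)
            ≈⟨ *-congˡ (trans (+-congˡ -0≈0) (+-identityʳ 1#)) ⟩
        κ (t k) * 1#
          ≈⟨ *-identityʳ (κ (t k)) ⟩
        κ (t k)   ≈⟨ X-suc k ⟨
        X (suc k) ∎

      -- The two leading terms have equal weights and opposite vectors and cancel. They allow the
      -- total weight to be raised to 1 without moving the point.
      star-combination : ∀ (c : Vector Carrier (suc (suc n))) (p : Vector (Vector Carrier (suc n)) (suc (suc n))) →
        c zero ≈ c (suc zero) → (∀ u → p (suc zero) u ≈ - p zero u) →
        (∀ i u → c (suc (suc i)) * p (suc (suc i)) u ≈ κ (t i) * (d (suc i) u - d zero u)) →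
        ∀ u → X u ≈ ∑ (λ j → c j * p j u)
      star-combination c p c₀≈c₁ p₁≈-p₀ cp u = sym (begin
        c zero * p zero u + (c (suc zero) * p (suc zero) u + ∑ (λ i → c (suc (suc i)) * p (suc (suc i)) u))
          ≈⟨ +-congˡ (+-cong (*-cong (sym c₀≈c₁) (p₁≈-p₀ u)) (sum-cong-≋ (λ i → cp i u))) ⟩
        c zero * p zero u + (c zero * (- p zero u) + ∑ (λ i → κ (t i) * (d (suc i) u - d zero u)))
          ≈⟨ solve 3 (λ c p z → c :* p :+ (c :* (:- p) :+ z) := z) refl (c zero) (p zero u) _ ⟩
        ∑ (λ i → κ (t i) * (d (suc i) u - d zero u))
          ≈⟨ star-sum u ⟩
        X u ∎)

-- Polynomials determined by their values at the naturals

module Interpolation where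

  open import Data.Rational.Solver using (module +-*-Solver)
  open Polynomials
  open Rationals
  open RealRoots

  ι-< : ∀ {i j} → i ℕ.< j → ι (+ i) ℚ.< ι (+ j)
  ι-< {i} {j} i<j = ℚ.<-≤-trans
    (0<d⇒p<q 0<1 (≡.trans (+-*-Solver.solve 1 (λ m → con 1ℚ := (con 1ℚ :+ m) :- m) ≡.refl (ι (+ i)))
                          (≡.cong (ℚ._- ι (+ i)) (≡.sym (ι-suc i)))))
    (ι-mono-≤ (ℤ.+≤+ i<j))
    where open +-*-Solver

  module ScaledRecurrence
    (R : CommutativeRing 0ℓ 0ℓ)
    (κ-morphism : ℚ.+-*-rawRing -Raw-AlmostCommutative⟶ fromCommutativeRing R)
    (b : ℚ) (v : ℕ → ℚ) (n : ℕ) (r : ℚ) (0<r : 0ℚ ℚ.< r)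
    where

    open ℚ-Algebra R κ-morphism
    open Recurrence b v
    open Roots R κ-morphism using (value-κ)
    open Relation.Binary.Reasoning.Setoid setoid

    valueℚ : ℚ → ℚ
    valueℚ = ℚ-alg.Recurrence.value b v n

    scaled-poly : Poly
    scaled-poly = κ r ·ₚ poly n

    eval-scaled-poly : ∀ x → eval scaled-poly x ≈ κ r * value n x
    eval-scaled-poly x = trans (eval-·ₚ (κ r) (poly n) x) (*-congˡ (eval-poly n x))

    eval-scaled-poly-κ : ∀ q → eval scaled-poly (κ q) ≈ κ (r ℚ.* valueℚ q)
    eval-scaled-poly-κ q = trans (eval-scaled-poly (κ q))
      (trans (*-congˡ (value-κ b v n q)) (sym (κ-* r (valueℚ q))))

    ι-regular : ∀ {i j} → i ℕ.< j → Regular (κ (ι (+ j)) - κ (ι (+ i)))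
    ι-regular {i} {j} i<j = regular λ y eq → Regular.cancel
      (κ-regular (p<q⇒0<q-p (ι-< i<j))) y
      (trans (*-congʳ (trans (κ-+ _ _) (+-congˡ (κ-neg _)))) eq)

    module Agreeing (H : Poly) (point : ℕ → Carrier) (point≈ : ∀ s → point s ≈ κ (ι (+ s)))
      (agree : ∀ s → eval H (point s) ≈ κ (r ℚ.* valueℚ (ι (+ s)))) where

      H≈scaled-poly : H ≈ₚ scaled-poly
      -- The lengths of the coefficient lists bound both degrees a priori; the actual degree of `H`
      -- becomes known only through this equality.
      H≈scaled-poly = interpolation-unique (length H ℕ.⊔ length scaled-poly) H scaled-poly
        (λ i → κ (ι (+ toℕ i)))
        (length-degree H _ (ℕ.m≤m⊔n (length H) (length scaled-poly)))
        (length-degree scaled-poly _ (ℕ.m≤n⊔m (length H) (length scaled-poly)))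
        (λ i j i<j → ι-regular i<j)
        (λ i → trans (eval-cong H (sym (point≈ (toℕ i))))
          (trans (agree (toℕ i)) (sym (eval-scaled-poly-κ (ι (+ toℕ i))))))

      degree : DegreeBelow H (suc n)
      degree k n<k = trans (H≈scaled-poly k)
        (trans (coeff-·ₚ (κ r) (poly n) k) (*-zero-congʳ (poly-degree n k n<k)))

      leading : coeff H n ≈ κ (r ℚ.* 2^ n)
      leading = trans (H≈scaled-poly n)
        (trans (coeff-·ₚ (κ r) (poly n) n) (trans (*-congˡ (poly-leading n)) (sym (κ-* r (2^ n)))))

      eval-H : ∀ x → eval H x ≈ κ r * value n x
      eval-H x = trans (eval-congₚ H scaled-poly H≈scaled-poly x) (eval-scaled-poly x)

      root⇒value-root : ∀ x → eval H x ≈ 0# → value n x ≈ 0#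
      root⇒value-root x root = Regular.cancel (κ-regular 0<r) (value n x) (trans (sym (eval-H x)) root)

      coeff-factorisation : ∀ (z : Vector Carrier n) →
        (∀ i j → i Fin.< j → Regular (z j - z i)) → (∀ i → value n (z i) ≈ 0#) →
        ∀ k → coeff H k ≈ coeff H n * coeff (∏ₚ (λ i → x- z i)) k
      coeff-factorisation z z-reg root k = trans
        (factorisation n H z degree z-reg (λ i → trans (eval-H (z i)) (*-zero-congʳ (root i))) k)
        (coeff-·ₚ (coeff H n) (∏ₚ (λ i → x- z i)) k)

-- Delannoy numbers and lattice points of the cross-polytope

module Counting where

  open import Data.List.Membership.Propositional using (_∈_)
  open import Data.List.Membership.Propositional.Properties
    using (∈-map⁺; ∈-map⁻; ∈-++⁺ˡ; ∈-++⁺ʳ; ∈-++⁻)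
  open import Data.List.Membership.Propositional.Properties.WithK using (unique∧set⇒bag)
  open import Data.List.Properties using (length-map; length-++)
  open import Data.List.Relation.Binary.BagAndSetEquality using (∼bag⇒↭)
  open import Data.List.Relation.Binary.Permutation.Propositional.Properties using (↭-length)
  open import Data.List.Relation.Unary.All using ([])
  open import Data.List.Relation.Unary.AllPairs using ([]; _∷_)
  open import Data.List.Relation.Unary.Any using (here)
  import Data.List.Relation.Unary.Unique.Propositional.Properties as Unique
  open import Data.Nat using (_+_; _*_; _≤_; _<_; _!)
  open import Data.Nat.Solver using (module +-*-Solver)
  open import Data.Product using (map₁)
  open import Data.Product.Properties using (,-injectiveʳ)
  import Data.Rational.Solver
  open import Data.Vec.Properties using (∷-injectiveʳ)
  open import Defs using (HasCardinality)
  open ≡ using (refl; sym; trans; cong; cong₂; subst; module ≡-Reasoning)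
  open Polynomials
  open Rationals

  -- partial n s is the sum of delannoy n j over j < s.
  mutual
    delannoy : ℕ → ℕ → ℕ
    delannoy zero    s = 1
    delannoy (suc n) s = delannoy n s + (partial n s + partial n s)

    partial : ℕ → ℕ → ℕ
    partial n zero    = 0
    partial n (suc s) = delannoy n s + partial n s

  delannoy-suc-suc : ∀ n s →
    delannoy (suc n) (suc s) ≡ delannoy (suc n) s + delannoy n (suc s) + delannoy n s
  delannoy-suc-suc n s =
    solve 3 (λ z z′ p → z′ :+ ((z :+ p) :+ (z :+ p)) := ((z :+ (p :+ p)) :+ z′) :+ z) refl
      (delannoy n s) (delannoy n (suc s)) (partial n s)
    where open +-*-Solver

  delannoy-zero : ∀ n → delannoy n 0 ≡ 1
  delannoy-zero zero    = refl
  delannoy-zero (suc n) = trans (ℕ.+-identityʳ _) (delannoy-zero n)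

  delannoy-one : ∀ n → delannoy n 1 ≡ 1 + (n + n)
  delannoy-one zero    = refl
  delannoy-one (suc n) = trans
    (cong₂ (λ a b → a + ((b + 0) + (b + 0))) (delannoy-one n) (delannoy-zero n))
    (solve 1 (λ n → (con 1 :+ (n :+ n)) :+ con 2 := con 1 :+ ((con 1 :+ n) :+ (con 1 :+ n))) refl n)
    where open +-*-Solver

  partial-zero : ∀ s → partial 0 s ≡ s
  partial-zero zero    = refl
  partial-zero (suc s) = cong suc (partial-zero s)

  -- Writing D for `delannoy`, the two sides are mirror images under D(n, s) = D(s, n). The identity
  -- trades a step in s for a step in n. The induction step applies it at (n, s + 1), (n, s) and (n
  -- + 1, s), joined by the three-term rule.
  delannoy-exchange : ∀ n s →
    suc s * (delannoy n (suc s) + delannoy n s) ≡ suc n * (delannoy (suc n) s + delannoy n s)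
  delannoy-exchange zero s = trans
    (solve 1 (λ s → (con 1 :+ s) :* con 2 := con 1 :* ((con 1 :+ (s :+ s)) :+ con 1)) refl s)
    (cong (λ p → 1 * ((1 + (p + p)) + 1)) (sym (partial-zero s)))
    where open +-*-Solver
  delannoy-exchange (suc n) zero = trans
    (cong₂ (λ a b → 1 * (a + b)) (delannoy-one (suc n)) (delannoy-zero (suc n)))
    (trans (solve 1 (λ n → con 1 :* ((con 1 :+ ((con 1 :+ n) :+ (con 1 :+ n))) :+ con 1)
                         := (con 2 :+ n) :* con 2) refl n)
      (sym (cong₂ (λ a b → suc (suc n) * (a + b)) (delannoy-zero (suc (suc n))) (delannoy-zero (suc n)))))
    where open +-*-Solver
  delannoy-exchange (suc n) (suc s) = begin
    suc (suc s) * (a″ + a′)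
      ≡⟨ cong (λ t → suc (suc s) * (t + a′)) (delannoy-suc-suc n (suc s)) ⟩
    suc (suc s) * (a′ + z″ + z′ + a′)
      ≡⟨ solve 4 (λ s a′ z′ z″ → (con 2 :+ s) :* (((a′ :+ z″) :+ z′) :+ a′)
                    := con 2 :* (con 2 :+ s) :* a′ :+ (con 2 :+ s) :* (z″ :+ z′)) refl s a′ z′ z″ ⟩
    2 * suc (suc s) * a′ + suc (suc s) * (z″ + z′)
      ≡⟨ cong (λ t → 2 * suc (suc s) * a′ + t) (delannoy-exchange n (suc s)) ⟩
    2 * suc (suc s) * a′ + suc n * (a′ + z′)
      ≡⟨ cong (λ t → 2 * suc (suc s) * t + suc n * (t + z′)) (delannoy-suc-suc n s) ⟩
    2 * suc (suc s) * (a + z′ + z) + suc n * (a + z′ + z + z′)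
      ≡⟨ solve 5 (λ n s a z z′ →
           con 2 :* (con 2 :+ s) :* (a :+ z′ :+ z) :+ (con 1 :+ n) :* (a :+ z′ :+ z :+ z′)
           := ((con 5 :+ s :+ s :+ n) :* a :+ (con 5 :+ s :+ n :+ n) :* z′ :+ (con 4 :+ s :+ n) :* z)
              :+ (con 1 :+ s) :* (z′ :+ z)) refl n s a z z′ ⟩
    m + suc s * (z′ + z)
      ≡⟨ cong (λ t → m + t) (delannoy-exchange n s) ⟩
    m + suc n * (a + z)
      ≡⟨ solve 5 (λ n s a z z′ →
           ((con 5 :+ s :+ s :+ n) :* a :+ (con 5 :+ s :+ n :+ n) :* z′ :+ (con 4 :+ s :+ n) :* z)
              :+ (con 1 :+ n) :* (a :+ z)
           := (con 1 :+ s) :* (a :+ z′ :+ z :+ a) :+ con 2 :* (con 2 :+ n) :* (a :+ z′ :+ z)) refl n s a z z′ ⟩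
    suc s * (a + z′ + z + a) + 2 * suc (suc n) * (a + z′ + z)
      ≡⟨ cong (λ t → suc s * (t + a) + 2 * suc (suc n) * t) (sym (delannoy-suc-suc n s)) ⟩
    suc s * (a′ + a) + 2 * suc (suc n) * a′
      ≡⟨ cong (_+ 2 * suc (suc n) * a′) (delannoy-exchange (suc n) s) ⟩
    suc (suc n) * (b + a) + 2 * suc (suc n) * a′
      ≡⟨ solve 4 (λ n a a′ b → (con 2 :+ n) :* (b :+ a) :+ con 2 :* (con 2 :+ n) :* a′
                    := (con 2 :+ n) :* (b :+ a′ :+ a :+ a′)) refl n a a′ b ⟩
    suc (suc n) * (b + a′ + a + a′)
      ≡⟨ cong (λ t → suc (suc n) * (t + a′)) (sym (delannoy-suc-suc (suc n) s)) ⟩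
    suc (suc n) * (b′ + a′) ∎
    where
    open ≡-Reasoning
    open +-*-Solver
    z  = delannoy n s
    z′ = delannoy n (suc s)
    z″ = delannoy n (suc (suc s))
    a  = delannoy (suc n) s
    a′ = delannoy (suc n) (suc s)
    a″ = delannoy (suc n) (suc (suc s))
    b  = delannoy (suc (suc n)) s
    b′ = delannoy (suc (suc n)) (suc s)
    -- What remains after splitting off (1 + s)(z′ + z), the term to which the hypothesis at (n, s)
    -- applies.
    m  = (5 + s + s + n) * a + (5 + s + n + n) * z′ + (4 + s + n) * z

  -- Exchange at (n + 1, s) introduces D(n + 1, s + 1), the three-term rule reduces it to D(n, s +
  -- 1), and exchange at (n, s) removes that. Both sides are first enlarged by (n + 2) D(n + 1, s),
  -- which avoids subtraction in ℕ.
  delannoy-recurrence : ∀ n s → suc (suc n) * delannoy (suc (suc n)) s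
    ≡ (s + s + 1) * delannoy (suc n) s + suc n * delannoy n s
  delannoy-recurrence n s = ℕ.+-cancelʳ-≡ (suc (suc n) * b) _ _ (begin
    suc (suc n) * c + suc (suc n) * b
      ≡⟨ ℕ.*-distribˡ-+ (suc (suc n)) c b ⟨
    suc (suc n) * (c + b)
      ≡⟨ delannoy-exchange (suc n) s ⟨
    suc s * (delannoy (suc n) (suc s) + b)
      ≡⟨ cong (λ t → suc s * (t + b)) (delannoy-suc-suc n s) ⟩
    suc s * (b + a′ + a + b)
      ≡⟨ solve 4 (λ s a a′ b → (con 1 :+ s) :* (b :+ a′ :+ a :+ b)
                    := con 2 :* (con 1 :+ s) :* b :+ (con 1 :+ s) :* (a′ :+ a)) refl s a a′ b ⟩
    2 * suc s * b + suc s * (a′ + a)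
      ≡⟨ cong (λ t → 2 * suc s * b + t) (delannoy-exchange n s) ⟩
    2 * suc s * b + suc n * (b + a)
      ≡⟨ solve 4 (λ n s a b → con 2 :* (con 1 :+ s) :* b :+ (con 1 :+ n) :* (b :+ a)
                    := (s :+ s :+ con 1) :* b :+ (con 1 :+ n) :* a :+ (con 2 :+ n) :* b) refl n s a b ⟩
    (s + s + 1) * b + suc n * a + suc (suc n) * b ∎)
    where
    open ≡-Reasoning
    open +-*-Solver
    a  = delannoy n s
    a′ = delannoy n (suc s)
    b  = delannoy (suc n) s
    c  = delannoy (suc (suc n)) s

  -- Clearing denominators makes the recurrence integral.
  scaled : ℕ → ℕ → ℕ
  scaled n s = n ! * delannoy n s

  scaled-recurrence : ∀ n s →
    scaled (suc (suc n)) s ≡ (s + s + 1) * scaled (suc n) s + suc n * suc n * scaled n s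
  scaled-recurrence n s = begin
    suc (suc n) * (suc n * n !) * c
      ≡⟨ solve 3 (λ n f c → (con 2 :+ n) :* ((con 1 :+ n) :* f) :* c
                    := ((con 1 :+ n) :* f) :* ((con 2 :+ n) :* c)) refl n (n !) c ⟩
    (suc n * n !) * (suc (suc n) * c)
      ≡⟨ cong ((suc n * n !) *_) (delannoy-recurrence n s) ⟩
    (suc n * n !) * ((s + s + 1) * b + suc n * a)
      ≡⟨ solve 5 (λ n s f a b → ((con 1 :+ n) :* f) :* ((s :+ s :+ con 1) :* b :+ (con 1 :+ n) :* a)
                    := (s :+ s :+ con 1) :* (((con 1 :+ n) :* f) :* b) :+ (con 1 :+ n) :* (con 1 :+ n) :* (f :* a))
           refl n s (n !) a b ⟩
    (s + s + 1) * (suc n * n ! * b) + suc n * suc n * (n ! * a) ∎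
    where
    open ≡-Reasoning
    open +-*-Solver
    a = delannoy n s
    b = delannoy (suc n) s
    c = delannoy (suc (suc n)) s

  ιℕ : ℕ → ℚ
  ιℕ n = ι (+ n)

  ιℕ-+ : ∀ m n → ιℕ (m + n) ≡ ιℕ m ℚ.+ ιℕ n
  ιℕ-+ m n = ι-+ (+ m) (+ n)

  ιℕ-* : ∀ m n → ιℕ (m * n) ≡ ιℕ m ℚ.* ιℕ n
  ιℕ-* m n = trans (cong ι (ℤ.pos-* m n)) (ι-* (+ m) (+ n))

  weight : ℕ → ℚ
  weight n = ιℕ (suc n * suc n)

  0<weight : ∀ n → 0ℚ ℚ.< weight n
  0<weight n = 0<ι (n + n * suc n)

  2s+1 : ∀ s → ιℕ (s + s + 1) ≡ 2ℚ ℚ.* ιℕ s ℚ.+ 1ℚ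
  2s+1 s = trans (ιℕ-+ (s + s) 1) (cong (ℚ._+ 1ℚ) (trans (ιℕ-+ s s)
    (Data.Rational.Solver.+-*-Solver.solve 1 (λ x → x :+ x := con 2ℚ :* x) refl (ιℕ s))))
    where open Data.Rational.Solver.+-*-Solver

  value-scaled : ∀ n s → ℚ-alg.Recurrence.value 1ℚ weight n (ιℕ s) ≡ ιℕ (scaled n s)
  value-scaled zero          s = refl
  value-scaled (suc zero)    s = trans (sym (2s+1 s)) (cong ιℕ (trans
    (solve 1 (λ s → s :+ s :+ con 1 := con 1 :* (con 1 :+ (s :+ s))) refl s)
    (cong (λ p → 1 * (1 + (p + p))) (sym (partial-zero s)))))
    where open +-*-Solver
  value-scaled (suc (suc n)) s = trans
    (cong₂ ℚ._+_ (cong₂ ℚ._*_ (sym (2s+1 s)) (value-scaled (suc n) s))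
                 (cong (weight n ℚ.*_) (value-scaled n s)))
    (sym (trans (cong ιℕ (scaled-recurrence n s))
      (trans (ιℕ-+ ((s + s + 1) * scaled (suc n) s) (suc n * suc n * scaled n s))
        (cong₂ ℚ._+_ (ιℕ-* (s + s + 1) (scaled (suc n) s)) (ιℕ-* (suc n * suc n) (scaled n s))))))

  module _ {A : Set} where

    -- Duplicate-free lists with the same elements are permutations of each other. An Ehrhart
    -- polynomial comes with its own count, which this identifies with the Delannoy number.
    cardinality-unique : ∀ {S : Pred A 0ℓ} {M N} → HasCardinality S M → HasCardinality S N → M ≡ N
    cardinality-unique (xs , xs! , xs⇔S , refl) (ys , ys! , ys⇔S , refl) =
      ↭-length (∼bag⇒↭ (unique∧set⇒bag xs! ys! (λ {x} → mk⇔
        (λ x∈xs → Equivalence.from (ys⇔S x) (Equivalence.to (xs⇔S x) x∈xs))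
        (λ x∈ys → Equivalence.from (xs⇔S x) (Equivalence.to (ys⇔S x) x∈ys)))))

    cardinality-resp : ∀ {S T : Pred A 0ℓ} {N} → (∀ x → S x ⇔ T x) → HasCardinality S N → HasCardinality T N
    cardinality-resp S⇔T (xs , xs! , xs⇔S , len) = xs , xs! ,
      (λ x → mk⇔ (λ x∈xs → Equivalence.to (S⇔T x) (Equivalence.to (xs⇔S x) x∈xs))
                 (λ Tx → Equivalence.from (xs⇔S x) (Equivalence.from (S⇔T x) Tx))) , len

    cardinality-∪ : ∀ {S T : Pred A 0ℓ} {M N} → (∀ x → S x → ¬ T x) →
      HasCardinality S M → HasCardinality T N → HasCardinality (λ x → S x ⊎ T x) (M + N)
    cardinality-∪ {S} {T} disjoint (xs , xs! , xs⇔S , refl) (ys , ys! , ys⇔T , refl) =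
      xs ++ ys , Unique.++⁺ xs! ys!
        (λ {x} (x∈xs , x∈ys) → disjoint x (Equivalence.to (xs⇔S x) x∈xs) (Equivalence.to (ys⇔T x) x∈ys)) ,
      (λ x → mk⇔ (λ x∈ → to x (∈-++⁻ xs x∈))
        λ { (inj₁ Sx) → ∈-++⁺ˡ (Equivalence.from (xs⇔S x) Sx)
          ; (inj₂ Tx) → ∈-++⁺ʳ xs (Equivalence.from (ys⇔T x) Tx) }) ,
      length-++ xs
      where
      to : ∀ x → x ∈ xs ⊎ x ∈ ys → S x ⊎ T x
      to x (inj₁ x∈xs) = inj₁ (Equivalence.to (xs⇔S x) x∈xs)
      to x (inj₂ x∈ys) = inj₂ (Equivalence.to (ys⇔T x) x∈ys)

  Image : {A B : Set} → (A → B) → Pred A 0ℓ → Pred B 0ℓ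
  Image f S y = ∃ λ x → S x × y ≡ f x

  cardinality-image : ∀ {A B : Set} (f : A → B) {S : Pred A 0ℓ} {N} → (∀ {x y} → f x ≡ f y → x ≡ y) →
    HasCardinality S N → HasCardinality (Image f S) N
  cardinality-image f {S} injective (xs , xs! , xs⇔S , refl) =
    map f xs , Unique.map⁺ injective xs! ,
    (λ y → mk⇔ (λ y∈ → let x , x∈xs , y≡fx = ∈-map⁻ f y∈ in x , Equivalence.to (xs⇔S x) x∈xs , y≡fx)
               λ { (x , Sx , refl) → ∈-map⁺ f (Equivalence.from (xs⇔S x) Sx) }) ,
    length-map f xs

  norm₁ : ∀ {n} → Vec ℤ n → ℕ
  norm₁ []      = 0
  norm₁ (x ∷ v) = ℤ.∣ x ∣ + norm₁ v

  Ball : ∀ n → ℕ → Pred (Vec ℤ n) 0ℓ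
  Ball n s v = norm₁ v ≤ s

  -- (k , v) encodes the vectors ±(k + 1) ∷ v of norm at most s.
  Half : ∀ n → ℕ → Pred (ℕ × Vec ℤ n) 0ℓ
  Half n s (k , v) = k + norm₁ v < s

  consPos consNeg : ∀ {n} → ℕ × Vec ℤ n → Vec ℤ (suc n)
  consPos (k , v) = + suc k ∷ v
  consNeg    (k , v) = -[1+ k ] ∷ v

  consPos-injective : ∀ {n} {p q : ℕ × Vec ℤ n} → consPos p ≡ consPos q → p ≡ q
  consPos-injective refl = refl

  consNeg-injective : ∀ {n} {p q : ℕ × Vec ℤ n} → consNeg p ≡ consNeg q → p ≡ q
  consNeg-injective refl = refl

  mutual
    -- Split by the first coordinate: 0 leaves a ball, and each sign leaves a copy of `Half`. In
    -- `Half` at s + 1, the pairs with k = 0 form a ball of radius s and the others a `Half` at s.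
    -- This is the mutual recursion of `delannoy` and `partial`.
    ball-cardinality : ∀ n s → HasCardinality (Ball n s) (delannoy n s)
    ball-cardinality zero s = [] ∷ [] , [] ∷ [] ,
      (λ { [] → mk⇔ (λ _ → z≤n) (λ _ → here refl) }) , refl
    ball-cardinality (suc n) s = cardinality-resp (λ x → mk⇔ to from) (cardinality-∪ disjoint
      (cardinality-image (+ 0 ∷_) ∷-injectiveʳ (ball-cardinality n s))
      (cardinality-∪ disjoint′
        (cardinality-image consPos consPos-injective (half-cardinality n s))
        (cardinality-image consNeg consNeg-injective (half-cardinality n s))))
      where
      disjoint : ∀ x → Image (+ 0 ∷_) (Ball n s) x →
                 ¬ (Image consPos (Half n s) x ⊎ Image consNeg (Half n s) x)
      disjoint _ (_ , _ , refl) (inj₁ (_ , _ , ()))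
      disjoint _ (_ , _ , refl) (inj₂ (_ , _ , ()))
      disjoint′ : ∀ x → Image consPos (Half n s) x → ¬ Image consNeg (Half n s) x
      disjoint′ _ (_ , _ , refl) (_ , _ , ())
      Cases : Pred (Vec ℤ (suc n)) 0ℓ
      Cases x = Image (+ 0 ∷_) (Ball n s) x ⊎ (Image consPos (Half n s) x ⊎ Image consNeg (Half n s) x)
      to : ∀ {x} → Cases x → Ball (suc n) s x
      to (inj₁ (_ , v≤s , refl))        = v≤s
      to (inj₂ (inj₁ (_ , v<s , refl))) = v<s
      to (inj₂ (inj₂ (_ , v<s , refl))) = v<s
      from : ∀ {x} → Ball (suc n) s x → Cases x
      from {+ zero ∷ v}    v≤s = inj₁ (v , v≤s , refl)
      from {+ suc k ∷ v}   v<s = inj₂ (inj₁ ((k , v) , v<s , refl))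
      from { -[1+ k ] ∷ v} v<s = inj₂ (inj₂ ((k , v) , v<s , refl))

    half-cardinality : ∀ n s → HasCardinality (Half n s) (partial n s)
    half-cardinality n zero    = [] , [] , (λ _ → mk⇔ (λ ()) (λ ())) , refl
    half-cardinality n (suc s) = cardinality-resp (λ x → mk⇔ to from) (cardinality-∪ disjoint
      (cardinality-image (0 ,_) ,-injectiveʳ (ball-cardinality n s))
      (cardinality-image (map₁ suc) (λ { refl → refl }) (half-cardinality n s)))
      where
      disjoint : ∀ x → Image (0 ,_) (Ball n s) x → ¬ Image (map₁ suc) (Half n s) x
      disjoint _ (_ , _ , refl) (_ , _ , ())
      Cases : Pred (ℕ × Vec ℤ n) 0ℓ
      Cases x = Image (0 ,_) (Ball n s) x ⊎ Image (map₁ suc) (Half n s) x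
      to : ∀ {x} → Cases x → Half n (suc s) x
      to (inj₁ (_ , v≤s , refl)) = s≤s v≤s
      to (inj₂ (_ , v<s , refl)) = s≤s v<s
      from : ∀ {x} → Half n (suc s) x → Cases x
      from {zero  , v} (s≤s v≤s) = inj₁ (v , v≤s , refl)
      from {suc k , v} (s≤s v<s) = inj₂ ((k , v) , v<s , refl)

-- The ordered ring of Cauchy reals

module RealNumbers where

  open import Data.Empty using (⊥-elim)
  open import Data.Rational using (∣_∣; _+_; _*_; _-_; -_; _<_; _≤_)
  open import Data.Rational.Solver using (module +-*-Solver)
  open import Defs hiding (_≤_; _<_)
  import Defs
  open ≡ using (refl; sym; trans; cong; cong₂; subst; subst₂)
  open +-*-Solver using (solve; _:+_; _:*_; _:-_; :-_; _:=_; con)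
  open Polynomials
  open Rationals

  bounded : ∀ x → Bounded (seq x)
  bounded x with cauchy x 1ℚ 0<1
  ... | N , close = 1ℚ + ∣ seq x N ∣ , ℚ.+-mono-<-≤ 0<1 (ℚ.0≤∣p∣ (seq x N)) , N , λ n N≤n → begin
    ∣ seq x n ∣
      ≡⟨ cong ∣_∣ (solve 2 (λ a b → a := (a :- b) :+ b) refl (seq x n) (seq x N)) ⟩
    ∣ (seq x n - seq x N) + seq x N ∣
      ≤⟨ ℚ.∣p+q∣≤∣p∣+∣q∣ (seq x n - seq x N) (seq x N) ⟩
    ∣ seq x n - seq x N ∣ + ∣ seq x N ∣
      ≤⟨ ℚ.+-monoˡ-≤ ∣ seq x N ∣ (ℚ.<⇒≤ (close n N N≤n ℕ.≤-refl)) ⟩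
    1ℚ + ∣ seq x N ∣ ∎
    where open ℚ.≤-Reasoning

  infix 4 _≃_

  -- Unlike x ≈ y, which unfolds, x ≃ y determines x and y.  Two expressions for
  -- the same real are compared by the type checker including their Cauchy
  -- proofs; rewrapping an equation as ⟨ ≃⇒≈ eq ⟩ (and an element of Pos with pos)
  -- compares only the sequences.  For the same reason some lemmas below take an
  -- equation z ≡ … instead of mentioning the expression for z.
  record _≃_ (x y : ℝ) : Set where
    constructor ⟨_⟩
    field ≃⇒≈ : x ≈ y

  open _≃_ public

  pointwise : ∀ {x y} → (∀ n → seq x n ≡ seq y n) → x ≃ y
  pointwise {x} {y} eq = ⟨ small-resp
    (λ n → sym (trans (cong (_- seq y n) (eq n)) (ℚ.+-inverseʳ (seq y n)))) small-0 ⟩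

  ≃-refl : ∀ {x} → x ≃ x
  ≃-refl = pointwise λ _ → refl

  ≃-sym : ∀ {x y} → x ≃ y → y ≃ x
  ≃-sym {x} {y} ⟨ x≈y ⟩ = ⟨ small-resp
    (λ n → solve 2 (λ a b → :- (a :- b) := b :- a) refl (seq x n) (seq y n)) (small-neg x≈y) ⟩

  ≃-trans : ∀ {x y z} → x ≃ y → y ≃ z → x ≃ z
  ≃-trans {x} {y} {z} ⟨ x≈y ⟩ ⟨ y≈z ⟩ = ⟨ small-resp
    (λ n → solve 3 (λ a b c → (a :- b) :+ (b :- c) := a :- c) refl (seq x n) (seq y n) (seq z n))
    (small-+ x≈y y≈z) ⟩

  +ᴿ-cong : ∀ {x y u v} → x ≃ y → u ≃ v → x +ᴿ u ≃ y +ᴿ v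
  +ᴿ-cong {x} {y} {u} {v} ⟨ x≈y ⟩ ⟨ u≈v ⟩ = ⟨ small-resp
    (λ n → solve 4 (λ a b c d → (a :- b) :+ (c :- d) := (a :+ c) :- (b :+ d)) refl
             (seq x n) (seq y n) (seq u n) (seq v n))
    (small-+ x≈y u≈v) ⟩

  *ᴿ-cong : ∀ {x y u v} → x ≃ y → u ≃ v → x *ᴿ u ≃ y *ᴿ v
  *ᴿ-cong {x} {y} {u} {v} ⟨ x≈y ⟩ ⟨ u≈v ⟩ = ⟨ small-resp
    (λ n → solve 4 (λ a b c d → a :* (c :- d) :+ d :* (a :- b) := a :* c :- b :* d) refl
             (seq x n) (seq y n) (seq u n) (seq v n))
    (small-+ (small-* (bounded x) u≈v) (small-* (bounded v) x≈y)) ⟩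

  -ᴿ-cong : ∀ {x y} → x ≃ y → -ᴿ x ≃ -ᴿ y
  -ᴿ-cong {x} {y} ⟨ x≈y ⟩ = ⟨ small-resp
    (λ n → solve 2 (λ a b → :- (a :- b) := (:- a) :- (:- b)) refl (seq x n) (seq y n))
    (small-neg x≈y) ⟩

  +ᴿ-isGroup : IsGroup _≃_ _+ᴿ_ 0ᴿ (-ᴿ_)
  +ᴿ-isGroup = record
    { isMonoid = record
      { isSemigroup = record
        { isMagma = record
          { isEquivalence = record { refl = ≃-refl ; sym = ≃-sym ; trans = ≃-trans }
          ; ∙-cong = λ {x} {y} {u} {v} → +ᴿ-cong {x} {y} {u} {v} }
        ; assoc = λ x y z → pointwise {(x +ᴿ y) +ᴿ z} {x +ᴿ (y +ᴿ z)}
            λ n → ℚ.+-assoc (seq x n) (seq y n) (seq z n) }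
      ; identity = (λ x → pointwise {0ᴿ +ᴿ x} {x} λ n → ℚ.+-identityˡ (seq x n))
                 , (λ x → pointwise {x +ᴿ 0ᴿ} {x} λ n → ℚ.+-identityʳ (seq x n)) }
    ; inverse = (λ x → pointwise {(-ᴿ x) +ᴿ x} {0ᴿ} λ n → ℚ.+-inverseˡ (seq x n))
              , (λ x → pointwise {x +ᴿ (-ᴿ x)} {0ᴿ} λ n → ℚ.+-inverseʳ (seq x n))
    ; ⁻¹-cong = λ {x} {y} x≃y → ⟨ ≃⇒≈ (-ᴿ-cong {x} {y} x≃y) ⟩ }

  +ᴿ-isAbelianGroup : IsAbelianGroup _≃_ _+ᴿ_ 0ᴿ (-ᴿ_)
  +ᴿ-isAbelianGroup = record
    { isGroup = +ᴿ-isGroup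
    ; comm = λ x y → pointwise {x +ᴿ y} {y +ᴿ x} λ n → ℚ.+-comm (seq x n) (seq y n) }

  ℝ-isRing : IsRing _≃_ _+ᴿ_ _*ᴿ_ (-ᴿ_) 0ᴿ 1ᴿ
  ℝ-isRing = record
        { +-isAbelianGroup = +ᴿ-isAbelianGroup
        ; *-cong = λ {x} {y} {u} {v} → *ᴿ-cong {x} {y} {u} {v}
        ; *-assoc = λ x y z → pointwise {(x *ᴿ y) *ᴿ z} {x *ᴿ (y *ᴿ z)}
            λ n → ℚ.*-assoc (seq x n) (seq y n) (seq z n)
        ; *-identity = (λ x → pointwise {1ᴿ *ᴿ x} {x} λ n → ℚ.*-identityˡ (seq x n))
                     , (λ x → pointwise {x *ᴿ 1ᴿ} {x} λ n → ℚ.*-identityʳ (seq x n))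
        ; distrib = (λ x y z → pointwise {x *ᴿ (y +ᴿ z)} {x *ᴿ y +ᴿ x *ᴿ z}
                       λ n → ℚ.*-distribˡ-+ (seq x n) (seq y n) (seq z n))
                  , (λ x y z → pointwise {(y +ᴿ z) *ᴿ x} {y *ᴿ x +ᴿ z *ᴿ x}
                       λ n → ℚ.*-distribʳ-+ (seq x n) (seq y n) (seq z n)) }

  ℝ-commutativeRing : CommutativeRing 0ℓ 0ℓ
  ℝ-commutativeRing = record
    { Carrier = ℝ ; _≈_ = _≃_ ; _+_ = _+ᴿ_ ; _*_ = _*ᴿ_ ; -_ = -ᴿ_ ; 0# = 0ᴿ ; 1# = 1ᴿ
    ; isCommutativeRing = record
      { isRing = ℝ-isRing
      ; *-comm = λ x y → pointwise {x *ᴿ y} {y *ᴿ x} λ n → ℚ.*-comm (seq x n) (seq y n) } }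

  fromℚ-morphism : ℚ.+-*-rawRing -Raw-AlmostCommutative⟶ fromCommutativeRing ℝ-commutativeRing
  fromℚ-morphism = record
    { ⟦_⟧    = fromℚ
    ; +-homo = λ _ _ → pointwise λ _ → refl
    ; *-homo = λ _ _ → pointwise λ _ → refl
    ; -‿homo = λ _ → pointwise λ _ → refl
    ; 0-homo = ≃-refl
    ; 1-homo = ≃-refl
    }

  module ℝ-alg = ℚ-Algebra ℝ-commutativeRing fromℚ-morphism

  seq-value : ∀ b v n x k →
    seq (ℝ-alg.Recurrence.value b v n x) k ≡ ℚ-alg.Recurrence.value b v n (seq x k)
  seq-value b v zero          x k = refl
  seq-value b v (suc zero)    x k = refl
  seq-value b v (suc (suc n)) x k =
    cong₂ (λ p q → (2ℚ * seq x k + b) * p + v n * q) (seq-value b v (suc n) x k) (seq-value b v n x k)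

  record Pos (x : ℝ) : Set where
    constructor pos
    field
      margin     : ℚ
      0<margin   : 0ℚ < margin
      eventually : Eventually λ n → margin < seq x n

  Pos-resp : ∀ {x y} → x ≃ y → Pos x → Pos y
  Pos-resp {x} {y} ⟨ x≈y ⟩ (pos ε 0<ε ε<x) = pos (ε * ½) (0<p*½ 0<ε)
    (eventually-zip (λ n ε<x close → 0<d⇒p<q
        (0<p+q (p<q⇒0<q-p ε<x) (p<q⇒0<q-p (∣p∣<q⇒p<q close)))
        (trans (solve 3 (λ ε x y → (x :- ε) :+ (ε :* con ½ :- (x :- y)) := y :- (ε :- ε :* con ½))
                 refl ε (seq x n) (seq y n))
               (cong (λ q → seq y n - q) (solve 1 (λ ε → ε :- ε :* con ½ := ε :* con ½) refl ε))))
      ε<x (x≈y (ε * ½) (0<p*½ 0<ε)))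

  Pos-fromℚ : ∀ {q} → 0ℚ < q → Pos (fromℚ q)
  Pos-fromℚ {q} 0<q = pos (q * ½) (0<p*½ 0<q) (always λ _ →
    0<d⇒p<q (0<p*½ 0<q) (solve 1 (λ q → q :* con ½ := q :- q :* con ½) refl q))

  Pos-+ : ∀ {x y} → Pos x → Pos y → Pos (x +ᴿ y)
  Pos-+ (pos ε 0<ε ε<x) (pos δ 0<δ δ<y) =
    pos (ε + δ) (0<p+q 0<ε 0<δ) (eventually-zip (λ _ → ℚ.+-mono-<) ε<x δ<y)

  Pos-* : ∀ {x y} → Pos x → Pos y → Pos (x *ᴿ y)
  Pos-* {x} {y} (pos ε 0<ε ε<x) (pos δ 0<δ δ<y) = pos (ε * δ) (0<p*q 0<ε 0<δ)
    (eventually-zip (λ n ε<x δ<y → ℚ.<-trans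
        (ℚ.*-monoʳ-<-pos ε {{ℚ.positive 0<ε}} δ<y)
        (ℚ.*-monoˡ-<-pos (seq y n) {{ℚ.positive (ℚ.<-trans 0<δ δ<y)}} ε<x))
      ε<x δ<y)

  ¬Pos-0 : ¬ Pos 0ᴿ
  ¬Pos-0 (pos ε 0<ε ε<0) = ℚ.<-asym 0<ε (proj₂ (eventually-witness ε<0))

  -- If ε is a margin of x, then eventually ε |yₙ| ≤ |xₙ yₙ|, so tolerance εδ for the product gives
  -- tolerance δ for y.
  Pos-regular : ∀ {x} → Pos x → ℝ-alg.Regular x
  Pos-regular {x} (pos ε 0<ε ε<x) = ℝ-alg.regular λ { y ⟨ xy≈0 ⟩ → ⟨ (λ δ 0<δ →
    eventually-zip (λ n ε<x xy<εδ → subst (λ q → ∣ q ∣ < δ) (sym (ℚ.+-identityʳ (seq y n)))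
        (ℚ.*-cancelˡ-<-nonNeg ε {{ℚ.nonNegative (ℚ.<⇒≤ 0<ε)}} (begin-strict
          ε * ∣ seq y n ∣             ≤⟨ ℚ.*-monoʳ-≤-nonNeg ∣ seq y n ∣ {{ℚ.nonNegative (ℚ.0≤∣p∣ (seq y n))}}
                                           (ℚ.≤-trans (ℚ.<⇒≤ ε<x) (p≤∣p∣ (seq x n))) ⟩
          ∣ seq x n ∣ * ∣ seq y n ∣   ≡⟨ ℚ.∣p*q∣≡∣p∣*∣q∣ (seq x n) (seq y n) ⟨
          ∣ seq x n * seq y n ∣       ≡⟨ cong ∣_∣ (ℚ.+-identityʳ (seq x n * seq y n)) ⟨
          ∣ seq x n * seq y n - 0ℚ ∣  <⟨ xy<εδ ⟩
          ε * δ                       ∎)))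
      ε<x (xy≈0 (ε * δ) (0<p*q 0<ε 0<δ))) ⟩ }
    where open ℚ.≤-Reasoning

  -- Here r = 1/B. If b were at most η/B, then ab would be at most η. An upper bound of one factor
  -- thus turns a margin of the product into a margin of the other factor.
  η*r<b : ∀ {a b B r η} → 0ℚ < a → ∣ a ∣ ≤ B → B * r ≡ 1ℚ → 0ℚ < η * r → η < a * b → η * r < b
  η*r<b {a} {b} {B} {r} {η} 0<a a≤B Br≡1 0<ηr η<ab = ℚ.≰⇒> λ b≤ηr → ℚ.<-irrefl refl (begin-strict
    η            <⟨ η<ab ⟩
    a * b        ≤⟨ ℚ.*-monoˡ-≤-nonNeg a {{ℚ.nonNegative (ℚ.<⇒≤ 0<a)}} b≤ηr ⟩
    a * (η * r)  ≤⟨ ℚ.*-monoʳ-≤-nonNeg (η * r) {{ℚ.nonNegative (ℚ.<⇒≤ 0<ηr)}} (ℚ.≤-trans (p≤∣p∣ a) a≤B) ⟩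
    B * (η * r)  ≡⟨ solve 3 (λ B η r → B :* (η :* r) := η :* (B :* r)) refl B η r ⟩
    η * (B * r)  ≡⟨ cong (η *_) Br≡1 ⟩
    η * 1ℚ       ≡⟨ ℚ.*-identityʳ η ⟩
    η            ∎)
    where open ℚ.≤-Reasoning

  Pos-cancelˡ : ∀ {x y} → Pos x → Pos (x *ᴿ y) → Pos y
  Pos-cancelˡ {x} {y} (pos ε 0<ε ε<x) (pos η 0<η η<xy) =
    let B , 0<B , x≤B = bounded x
        r , 0<r , Br≡1 = recip B 0<B
        0<ηr = 0<p*q 0<η 0<r
    in pos (η * r) 0<ηr
         (eventually-zip {λ n → ∣ seq x n ∣ ≤ B} {λ n → 0ℚ < seq x n × η < seq x n * seq y n}
           (λ n x≤B (0<x , η<xy) → η*r<b 0<x x≤B Br≡1 0<ηr η<xy) x≤B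
           (eventually-zip {λ n → ε < seq x n} (λ n ε<x η<xy → ℚ.<-trans 0<ε ε<x , η<xy) ε<x η<xy))

  -- For each ε a single rational term c, accurate to ε/2, is compared with ε/2, which is decidable.
  -- If c or -c exceeded ε/2, the excess would be a margin for x or -x.
  ¬Pos⇒≃0 : ∀ {x} → ¬ Pos x → ¬ Pos (-ᴿ x) → x ≃ 0ᴿ
  ¬Pos⇒≃0 {x} ¬x>0 ¬x<0 = ⟨ small ⟩
    where
    small : x ≈ 0ᴿ
    small ε 0<ε with cauchy x (ε * ½) (0<p*½ 0<ε)
    ... | N , close with seq x N ℚ.≤? ε * ½ | - seq x N ℚ.≤? ε * ½
    ... | no c≰δ | _ = ⊥-elim (¬x>0 (pos (seq x N - ε * ½) (p<q⇒0<q-p (ℚ.≰⇒> c≰δ))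
      (N , λ n N≤n → 0<d⇒p<q (p<q⇒0<q-p (∣p∣<q⇒-q<p (close n N N≤n ℕ.≤-refl)))
         (solve 3 (λ x c δ → (x :- c) :- (:- δ) := x :- (c :- δ)) refl (seq x n) (seq x N) (ε * ½)))))
    ... | yes _ | no -c≰δ = ⊥-elim (¬x<0 (pos (- seq x N - ε * ½) (p<q⇒0<q-p (ℚ.≰⇒> -c≰δ))
      (N , λ n N≤n → 0<d⇒p<q (p<q⇒0<q-p (∣p∣<q⇒p<q (close n N N≤n ℕ.≤-refl)))
         (solve 3 (λ x c δ → δ :- (x :- c) := (:- x) :- ((:- c) :- δ)) refl (seq x n) (seq x N) (ε * ½)))))
    ... | yes c≤δ | yes -c≤δ = N , λ n N≤n → ∣p∣<q
      (0<d⇒p<q (ℚ.+-mono-<-≤ (p<q⇒0<q-p (∣p∣<q⇒-q<p (close n N N≤n ℕ.≤-refl))) (p≤q⇒0≤q-p -c≤δ))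
        (trans (solve 3 (λ x c δ → ((x :- c) :- (:- δ)) :+ (δ :- (:- c)) := (x :- con 0ℚ) :- (:- (δ :+ δ)))
                 refl (seq x n) (seq x N) (ε * ½))
               (cong (λ q → (seq x n - 0ℚ) - (- q)) (p*½+p*½≡p ε))))
      (0<d⇒p<q (ℚ.+-mono-<-≤ (p<q⇒0<q-p (∣p∣<q⇒p<q (close n N N≤n ℕ.≤-refl))) (p≤q⇒0≤q-p c≤δ))
        (trans (solve 3 (λ x c δ → (δ :- (x :- c)) :+ (δ :- c) := (δ :+ δ) :- (x :- con 0ℚ))
                 refl (seq x n) (seq x N) (ε * ½))
               (cong (λ q → q - (seq x n - 0ℚ)) (p*½+p*½≡p ε))))

  Pos⇒≤ : ∀ {x y} → Pos (y -ᴿ x) → x Defs.≤ y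
  Pos⇒≤ {x} {y} (pos δ 0<δ δ<y-x) ε 0<ε = eventually-map
    (λ n δ<y-x → 0<d⇒p<q (0<p+q (ℚ.<-trans 0<δ δ<y-x) 0<ε)
      (solve 3 (λ x y ε → (y :- x) :+ ε := (y :+ ε) :- x) refl (seq x n) (seq y n) ε))
    δ<y-x

  record NonNeg (x : ℝ) : Set where
    constructor nonNeg
    field above : ∀ ε → 0ℚ < ε → Eventually λ n → - ε < seq x n

  ≤⇒NonNeg : ∀ {x} → 0ᴿ Defs.≤ x → NonNeg x
  ≤⇒NonNeg {x} 0≤x = nonNeg λ ε 0<ε → eventually-map
    (λ n 0<x+ε → 0<d⇒p<q 0<x+ε (solve 2 (λ x ε → x :+ ε := x :- (:- ε)) refl (seq x n) ε))
    (0≤x ε 0<ε)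

  NonNeg-resp : ∀ {x y} → x ≃ y → NonNeg x → NonNeg y
  NonNeg-resp {x} {y} ⟨ x≈y ⟩ (nonNeg above) = nonNeg λ ε 0<ε →
    eventually-zip (λ n -δ<x close → 0<d⇒p<q
        (0<p+q (p<q⇒0<q-p -δ<x) (p<q⇒0<q-p (∣p∣<q⇒p<q close)))
        (trans (solve 3 (λ δ x y → (x :- (:- δ)) :+ (δ :- (x :- y)) := y :- (:- (δ :+ δ)))
                 refl (ε * ½) (seq x n) (seq y n))
               (cong (λ q → seq y n - (- q)) (p*½+p*½≡p ε))))
      (above (ε * ½) (0<p*½ 0<ε)) (x≈y (ε * ½) (0<p*½ 0<ε))

  NonNeg-fromℚ : ∀ {q} → 0ℚ ≤ q → NonNeg (fromℚ q)
  NonNeg-fromℚ {q} 0≤q = nonNeg λ ε 0<ε → always λ _ →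
    ℚ.<-≤-trans (ℚ.neg-antimono-< 0<ε) 0≤q

  NonNeg-+ : ∀ {x y} → NonNeg x → NonNeg y → NonNeg (x +ᴿ y)
  NonNeg-+ {x} {y} (nonNeg x≥0) (nonNeg y≥0) = nonNeg λ ε 0<ε →
    eventually-zip (λ n x> y> → subst (_< seq x n + seq y n)
        (trans (solve 1 (λ δ → (:- δ) :+ (:- δ) := :- (δ :+ δ)) refl (ε * ½)) (cong -_ (p*½+p*½≡p ε)))
        (ℚ.+-mono-< x> y>))
      (x≥0 (ε * ½) (0<p*½ 0<ε)) (y≥0 (ε * ½) (0<p*½ 0<ε))

  NonNeg-*fromℚ : ∀ {x q} → NonNeg x → 0ℚ ≤ q → NonNeg (x *ᴿ fromℚ q)
  NonNeg-*fromℚ {x} {q} (nonNeg x≥0) 0≤q = nonNeg λ ε 0<ε →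
    -- q may be 0, so q + 1 is inverted instead; qε/(q + 1) still stays below ε.
    let r , 0<r , qr≡1 = recip (q + 1ℚ) (ℚ.+-mono-≤-< 0≤q 0<1)
        δ = r * ε
    in eventually-map (λ n -δ<x → 0<d⇒p<q
         (ℚ.+-mono-≤-< (0≤p*q 0≤q (ℚ.<⇒≤ (p<q⇒0<q-p -δ<x))) (0<p*q 0<r 0<ε))
         (trans (solve 4 (λ q x r ε → q :* (x :- (:- (r :* ε))) :+ r :* ε
                            := x :* q :- (:- (((q :+ con 1ℚ) :* r) :* ε)))
                   refl q (seq x n) r ε)
                (cong (λ t → seq x n * q - (- t)) (trans (cong (_* ε) qr≡1) (ℚ.*-identityˡ ε)))))
       (x≥0 δ (0<p*q 0<r 0<ε))

  NonNeg-fromℚ⁻¹ : ∀ {q} → NonNeg (fromℚ q) → 0ℚ ≤ q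
  NonNeg-fromℚ⁻¹ {q} (nonNeg q≥0) = ℚ.≮⇒≥ λ q<0 →
    ℚ.<-irrefl refl (subst (_< q) (solve 1 (λ q → :- (:- q) := q) refl q)
      (proj₂ (eventually-witness (q≥0 (- q) (ℚ.neg-antimono-< q<0)))))

  foldr-preserves : ∀ {A : Set} (P : A → Set) (_∙_ : A → A → A) {ε} →
    (∀ {x y} → P x → P y → P (x ∙ y)) → P ε → ∀ {n} (f : Fin n → A) → (∀ i → P (f i)) →
    P (foldr _∙_ ε f)
  foldr-preserves P _∙_ P-∙ P-ε {zero}  f Pf = P-ε
  foldr-preserves P _∙_ P-∙ P-ε {suc n} f Pf =
    P-∙ (Pf zero) (foldr-preserves P _∙_ P-∙ P-ε (λ i → f (suc i)) (λ i → Pf (suc i)))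

  NonNeg-∑ : ∀ {n} (f : Fin n → ℝ) → (∀ i → NonNeg (f i)) → NonNeg (∑ᴿ f)
  NonNeg-∑ = foldr-preserves NonNeg _+ᴿ_ (λ {x} {y} → NonNeg-+ {x} {y}) (NonNeg-fromℚ ℚ.≤-refl)

-- The intermediate value theorem by rational bisection

module IntermediateValues where

  open import Data.Nat using (_⊔_)
  open import Data.Rational using (∣_∣; _+_; _*_; _-_; -_; _<_; _≤_)
  open import Data.Rational.Solver using (module +-*-Solver)
  open import Defs hiding (_≤_; _<_)
  open ≡ using (refl; sym; trans; cong; cong₂; subst; subst₂)
  open +-*-Solver using (solve; _:+_; _:*_; _:-_; :-_; _:=_; con)
  open Rationals
  open RealNumbers

  null : (s : ℕ → ℚ) → Small s → ℝ
  seq    (null s small) = s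
  cauchy (null s small) ε 0<ε with small (ε * ½) (0<p*½ 0<ε)
  ... | N , s<δ = N , λ m n N≤m N≤n → ℚ.≤-<-trans (ℚ.∣p-q∣≤∣p∣+∣q∣ (s m) (s n))
    (subst (∣ s m ∣ + ∣ s n ∣ <_) (p*½+p*½≡p ε) (ℚ.+-mono-< (s<δ m N≤m) (s<δ n N≤n)))

  Pos-mono : ∀ {x y} → (∀ n → seq x n ≤ seq y n) → Pos x → Pos y
  Pos-mono x≤y (pos ε 0<ε ε<x) = pos ε 0<ε (eventually-map (λ n ε<x → ℚ.<-≤-trans ε<x (x≤y n)) ε<x)

  bounded-by-ℚ : ∀ x → ∃ λ q → ∀ r → q ≤ r → Pos (fromℚ r -ᴿ x) × Pos (x -ᴿ fromℚ (- r))
  bounded-by-ℚ x = let B , _ , x≤B = bounded x in B + 1ℚ , λ r q≤r →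
      pos ½ 0<½ (eventually-map (λ n x≤B → ℚ.<-≤-trans ½<1
        (0≤d⇒p≤q (0≤p+q (p≤q⇒0≤q-p q≤r) (p≤q⇒0≤q-p (ℚ.≤-trans (p≤∣p∣ (seq x n)) x≤B)))
          (solve 3 (λ r B x → (r :- (B :+ con 1ℚ)) :+ (B :- x) := (r :- x) :- con 1ℚ) refl r B (seq x n)))) x≤B)
    , pos ½ 0<½ (eventually-map (λ n x≤B → ℚ.<-≤-trans ½<1
        (0≤d⇒p≤q (0≤p+q (p≤q⇒0≤q-p q≤r) (p≤q⇒0≤q-p (ℚ.≤-trans (p≤∣p∣ (- seq x n))
                   (subst (_≤ B) (sym (ℚ.∣-p∣≡∣p∣ (seq x n))) x≤B))))
          (solve 3 (λ r B x → (r :- (B :+ con 1ℚ)) :+ (B :- (:- x)) := (x :- (:- r)) :- con 1ℚ) refl r B (seq x n)))) x≤B)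
    where
    ½<1 : ½ < 1ℚ
    ½<1 = 0<d⇒p<q 0<½ refl

  module _ (x : ℝ) where

    private
      modulus : ℕ → ℕ
      -- The maximum with k makes the subsequence inherit every Cauchy bound of x.
      modulus k = k ⊔ proj₁ (cauchy x (½^ k * ½) (0<p*½ (0<½^ k)))

      subsequence : ℝ
      seq    subsequence k = seq x (modulus k)
      cauchy subsequence ε 0<ε with cauchy x ε 0<ε
      ... | N , close = N , λ m n N≤m N≤n → close (modulus m) (modulus n)
        (ℕ.≤-trans N≤m (ℕ.m≤m⊔n m _)) (ℕ.≤-trans N≤n (ℕ.m≤m⊔n n _))

      subsequence≃ : subsequence ≃ x
      subsequence≃ = ⟨ (λ ε 0<ε → let N , close = cauchy x ε 0<ε in
        N , λ n N≤n → close (modulus n) n (ℕ.≤-trans N≤n (ℕ.m≤m⊔n n _)) N≤n) ⟩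

    -- A representative of x all of whose terms are strict rational upper bounds of x: the k-th term
    -- of the subsequence is accurate to 2⁻ᵏ/2, so adding 2⁻ᵏ overshoots by at least 2⁻ᵏ/2.
    fromAbove : ℝ
    fromAbove = subsequence +ᴿ null ½^ ½^-small

    fromAbove≃ : fromAbove ≃ x
    fromAbove≃ = ⟨ small-resp
      (λ n → solve 3 (λ a b h → (a :- b) :+ h := (a :+ h) :- b) refl (seq subsequence n) (seq x n) (½^ n))
      (small-+ (≃⇒≈ subsequence≃) ½^-small) ⟩

    fromAbove-above : ∀ k → Pos (fromℚ (seq fromAbove k) -ᴿ x)
    fromAbove-above k = pos (½^ k * ½) (0<p*½ (0<½^ k))
      (N , λ n N≤n → 0<d⇒p<q (p<q⇒0<q-p (∣p∣<q⇒-q<p (close (modulus k) n (ℕ.m≤n⊔m k N) N≤n)))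
        (trans (solve 3 (λ a b δ → (a :- b) :- (:- δ) := ((a :+ (δ :+ δ)) :- b) :- δ) refl
                 (seq x (modulus k)) (seq x n) (½^ k * ½))
               (cong (λ h → ((seq x (modulus k) + h) - seq x n) - ½^ k * ½) (p*½+p*½≡p (½^ k)))))
      where
      N = proj₁ (cauchy x (½^ k * ½) (0<p*½ (0<½^ k)))
      close = proj₂ (cauchy x (½^ k * ½) (0<p*½ (0<½^ k)))

  0≤a⇒∣a∣≤∣a-b∣ : ∀ a b → 0ℚ ≤ a → a * b ≤ 0ℚ → ∣ a ∣ ≤ ∣ a - b ∣
  0≤a⇒∣a∣≤∣a-b∣ a b 0≤a ab≤0 with b ℚ.≤? 0ℚ
  ... | yes b≤0 = subst (_≤ ∣ a - b ∣) (sym (ℚ.0≤p⇒∣p∣≡p 0≤a)) (ℚ.≤-trans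
    (0≤d⇒p≤q (p≤q⇒0≤q-p b≤0) (solve 2 (λ a b → con 0ℚ :- b := (a :- b) :- a) refl a b)) (p≤∣p∣ (a - b)))
  ... | no  b≰0 = subst (_≤ ∣ a - b ∣) (sym (ℚ.0≤p⇒∣p∣≡p 0≤a)) (ℚ.≤-trans
    (ℚ.≮⇒≥ λ 0<a → ℚ.<-irrefl refl (ℚ.<-≤-trans (0<p*q 0<a (ℚ.≰⇒> b≰0)) ab≤0)) (ℚ.0≤∣p∣ (a - b)))

  -- Turns a sign change into smallness: as the ends of the interval merge, the difference of the
  -- two values tends to 0 and bounds the value at the left end.
  a*b≤0⇒∣a∣≤∣a-b∣ : ∀ a b → a * b ≤ 0ℚ → ∣ a ∣ ≤ ∣ a - b ∣
  a*b≤0⇒∣a∣≤∣a-b∣ a b ab≤0 with ℚ.≤-total 0ℚ a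
  ... | inj₁ 0≤a = 0≤a⇒∣a∣≤∣a-b∣ a b 0≤a ab≤0
  ... | inj₂ a≤0 = subst₂ _≤_ (ℚ.∣-p∣≡∣p∣ a)
    (trans (cong ∣_∣ (solve 2 (λ a b → :- a :- (:- b) := :- (a :- b)) refl a b)) (ℚ.∣-p∣≡∣p∣ (a - b)))
    (0≤a⇒∣a∣≤∣a-b∣ (- a) (- b) (ℚ.neg-antimono-≤ a≤0)
      (subst (_≤ 0ℚ) (solve 2 (λ a b → a :* b := (:- a) :* (:- b)) refl a b) ab≤0))

  -- The weak invariant, product of end values at most 0, covers the case of a midpoint that happens
  -- to be a root.
  module Bisection (f : ℚ → ℚ) (α β : ℚ) (α<β : α < β) (sign-change : f α * f β ≤ 0ℚ) where

    width : ℕ → ℚ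
    width k = (β - α) * ½^ k

    0≤width : ∀ k → 0ℚ ≤ width k
    0≤width k = ℚ.<⇒≤ (0<p*q (p<q⇒0<q-p α<β) (0<½^ k))

    width-halves : ∀ k → width (suc k) + width (suc k) ≡ width k
    width-halves k = solve 2 (λ c h → c :* (con ½ :* h) :+ c :* (con ½ :* h) := c :* h) refl (β - α) (½^ k)

    -- The decision is an explicit argument so that the lemmas about one step can match on it.
    choose : ∀ l w → Dec (f l * f (l + w) ≤ 0ℚ) → ℚ
    choose l w (yes _) = l
    choose l w (no  _) = l + w

    left : ℕ → ℚ
    decide : ∀ k → Dec (f (left k) * f (left k + width (suc k)) ≤ 0ℚ)
    left zero    = α
    left (suc k) = choose (left k) (width (suc k)) (decide k)
    decide k = f (left k) * f (left k + width (suc k)) ℚ.≤? 0ℚ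

    -- With midpoint m and right end r, if f l · f m and f m · f r were both positive, so would be
    -- their product (f m)² · (f l · f r).
    choose-sign : ∀ l w d → f l * f (l + (w + w)) ≤ 0ℚ → f (choose l w d) * f (choose l w d + w) ≤ 0ℚ
    choose-sign l w (yes flfm≤0) _      = flfm≤0
    choose-sign l w (no  flfm≰0) flfr≤0 = ℚ.≮⇒≥ λ 0<fmfr → ℚ.<-irrefl refl (begin-strict
      0ℚ                                         <⟨ 0<p*q (ℚ.≰⇒> flfm≰0) 0<fmfr ⟩
      (f l * f m) * (f m * f (m + w))            ≡⟨ cong (λ r → (f l * f m) * (f m * f r)) (ℚ.+-assoc l w w) ⟩
      (f l * f m) * (f m * f (l + (w + w)))
        ≡⟨ solve 3 (λ a b c → (a :* b) :* (b :* c) := (b :* b) :* (a :* c)) refl (f l) (f m) (f (l + (w + w))) ⟩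
      (f m * f m) * (f l * f (l + (w + w)))      ≤⟨ ℚ.*-monoˡ-≤-nonNeg (f m * f m) {{ℚ.nonNegative (0≤p² (f m))}} flfr≤0 ⟩
      (f m * f m) * 0ℚ                           ≡⟨ ℚ.*-zeroʳ (f m * f m) ⟩
      0ℚ                                         ∎)
      where
      open ℚ.≤-Reasoning
      m = l + w

    left-sign : ∀ k → f (left k) * f (left k + width k) ≤ 0ℚ
    left-sign zero    = subst (λ r → f α * f r ≤ 0ℚ)
      (solve 2 (λ α β → β := α :+ (β :- α) :* con 1ℚ) refl α β) sign-change
    left-sign (suc k) = choose-sign (left k) (width (suc k)) (decide k)
      (subst (λ w → f (left k) * f (left k + w) ≤ 0ℚ) (sym (width-halves k)) (left-sign k))

    choose-≥ : ∀ l w d → 0ℚ ≤ w → l ≤ choose l w d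
    choose-≥ l w (yes _) 0≤w = ℚ.≤-refl
    choose-≥ l w (no  _) 0≤w = 0≤d⇒p≤q 0≤w (solve 2 (λ l w → w := (l :+ w) :- l) refl l w)

    choose-≤ : ∀ l w d → 0ℚ ≤ w → choose l w d + w ≤ l + (w + w)
    choose-≤ l w (yes _) 0≤w = 0≤d⇒p≤q 0≤w (solve 2 (λ l w → w := (l :+ (w :+ w)) :- (l :+ w)) refl l w)
    choose-≤ l w (no  _) 0≤w = ℚ.≤-reflexive (ℚ.+-assoc l w w)

    left-mono : ∀ {k n} → k ℕ.≤′ n → left k ≤ left n
    left-mono ℕ.≤′-refl           = ℚ.≤-refl
    left-mono (ℕ.≤′-step {n} k≤n) = ℚ.≤-trans (left-mono k≤n)
      (choose-≥ (left n) (width (suc n)) (decide n) (0≤width (suc n)))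

    right-mono : ∀ {k n} → k ℕ.≤′ n → left n + width n ≤ left k + width k
    right-mono ℕ.≤′-refl           = ℚ.≤-refl
    right-mono (ℕ.≤′-step {n} k≤n) = ℚ.≤-trans (choose-≤ (left n) (width (suc n)) (decide n) (0≤width (suc n)))
      (ℚ.≤-trans (ℚ.≤-reflexive (cong (λ w → left n + w) (width-halves n))) (right-mono k≤n))

    left-upper : ∀ {k n} → k ℕ.≤′ n → left n ≤ left k + width k
    left-upper {k} {n} k≤n = ℚ.≤-trans
      (0≤d⇒p≤q (0≤width n) (solve 2 (λ l w → w := (l :+ w) :- l) refl (left n) (width n))) (right-mono k≤n)

    α≤left : ∀ k → α ≤ left k
    α≤left k = left-mono {0} {k} (ℕ.≤⇒≤′ z≤n)

    left≤β : ∀ k → left k ≤ β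
    left≤β k = ℚ.≤-trans (left-upper {0} {k} (ℕ.≤⇒≤′ z≤n))
      (ℚ.≤-reflexive (solve 2 (λ α β → α :+ (β :- α) :* con 1ℚ := β) refl α β))

    width-small : Small width
    width-small = small-* (∣ β - α ∣ + 1ℚ , ℚ.+-mono-≤-< (ℚ.0≤∣p∣ (β - α)) 0<1
      , always (λ _ → 0≤d⇒p≤q (ℚ.<⇒≤ 0<1) (solve 1 (λ c → con 1ℚ := (c :+ con 1ℚ) :- c) refl ∣ β - α ∣))) ½^-small

    left-close : ∀ {N m n ε} → N ℕ.≤ m → N ℕ.≤ n → width N < ε → left n - left m < ε
    left-close {N} {m} {n} {ε} N≤m N≤n w<ε = 0<d⇒p<q
      (ℚ.+-mono-<-≤ (p<q⇒0<q-p w<ε) (0≤p+q (p≤q⇒0≤q-p (left-mono {N} {m} (ℕ.≤⇒≤′ N≤m)))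
                                            (p≤q⇒0≤q-p (left-upper {N} {n} (ℕ.≤⇒≤′ N≤n)))))
      (solve 5 (λ a b l w ε → (ε :- w) :+ ((a :- l) :+ ((l :+ w) :- b)) := ε :- (b :- a)) refl
         (left m) (left n) (left N) (width N) ε)

    limit : ℝ
    seq    limit = left
    cauchy limit ε 0<ε = let N , small = width-small ε 0<ε in N , λ m n N≤m N≤n →
      let w<ε = ∣p∣<q⇒p<q {width N} {ε} (small N ℕ.≤-refl) in
      ∣p∣<q {left m - left n} {ε}
        (subst (- ε <_) (solve 2 (λ a b → :- (b :- a) := a :- b) refl (left m) (left n))
           (ℚ.neg-antimono-< (left-close {N} {m} {n} N≤m N≤n w<ε)))
        (left-close {N} {n} {m} N≤n N≤m w<ε)

  -- Continuity enters only through `f-cong`: the left and the right ends of the bisection are two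
  -- representatives of one real, so congruence says that the values of f at them differ by a null
  -- sequence.
  module IntermediateValue
    (f : ℝ → ℝ) (fℚ : ℚ → ℚ) (f-seq : ∀ x k → seq (f x) k ≡ fℚ (seq x k))
    (f-cong : ∀ {x y} → x ≃ y → f x ≃ f y) where

    root-ℚ : ∀ α β → α < β → fℚ α * fℚ β ≤ 0ℚ →
      ∃ λ u → (∀ k → α ≤ seq u k) × (∀ k → seq u k ≤ β) × f u ≃ 0ᴿ
    root-ℚ α β α<β sign = limit , α≤left , left≤β , ⟨ small ⟩
      where
      open Bisection fℚ α β α<β sign
      right : ℝ
      right = limit +ᴿ null width width-small
      limit≃right : limit ≃ right
      limit≃right = ⟨ small-resp
        (λ n → solve 2 (λ l w → :- w := l :- (l :+ w)) refl (left n) (width n)) (small-neg width-small) ⟩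
      small : Small λ n → seq (f limit) n - 0ℚ
      small ε 0<ε = eventually-map
        (λ n close → ℚ.≤-<-trans (subst (_≤ ∣ seq (f limit) n - seq (f right) n ∣)
            (cong ∣_∣ (sym (ℚ.+-identityʳ (seq (f limit) n))))
            (a*b≤0⇒∣a∣≤∣a-b∣ (seq (f limit) n) (seq (f right) n)
              (subst₂ (λ a b → a * b ≤ 0ℚ) (sym (f-seq limit n)) (sym (f-seq right n)) (left-sign n))))
          close)
        (≃⇒≈ (f-cong {limit} {right} limit≃right) ε 0<ε)

    -- The order and the sign change pass from the reals to the rational terms of a′ and b′ at some
    -- index k. Bisection stays between these two rationals, and since they lie strictly inside (a,
    -- b), so does the root.
    root-between : ∀ a b a′ b′ → a ≃ a′ → b ≃ b′ →
      (∀ k → Pos (fromℚ (seq a′ k) -ᴿ a)) → (∀ k → Pos (b -ᴿ fromℚ (seq b′ k))) →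
      Pos (b -ᴿ a) → Pos (-ᴿ (f a *ᴿ f b)) →
      ∃ λ u → Pos (u -ᴿ a) × Pos (b -ᴿ u) × f u ≃ 0ᴿ
    root-between a b a′ b′ a≃a′ b≃b′ a′>a b′<b a<b fafb<0 = u , a<u , u<b , fu≃0
      where
      a′<b′ : Pos (b′ -ᴿ a′)
      a′<b′ = Pos-resp {b -ᴿ a} {b′ -ᴿ a′}
        (+ᴿ-cong {b} {b′} { -ᴿ a} { -ᴿ a′} b≃b′ (-ᴿ-cong {a} {a′} a≃a′)) a<b
      fa′fb′<0 : Pos (-ᴿ (f a′ *ᴿ f b′))
      fa′fb′<0 = Pos-resp { -ᴿ (f a *ᴿ f b)} { -ᴿ (f a′ *ᴿ f b′)}
        (-ᴿ-cong {f a *ᴿ f b} {f a′ *ᴿ f b′}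
          (*ᴿ-cong {f a} {f a′} {f b} {f b′} (f-cong {a} {a′} a≃a′) (f-cong {b} {b′} b≃b′))) fafb<0
      index : ∃ λ k → seq a′ k < seq b′ k × fℚ (seq a′ k) * fℚ (seq b′ k) ≤ 0ℚ
      index = eventually-witness (eventually-zip
        {λ k → Pos.margin a′<b′ < seq b′ k - seq a′ k}
        {λ k → Pos.margin fa′fb′<0 < - (seq (f a′) k * seq (f b′) k)}
        (λ k lt sg → 0<d⇒p<q (ℚ.<-trans (Pos.0<margin a′<b′) lt) refl
           , subst₂ (λ p q → p * q ≤ 0ℚ) (f-seq a′ k) (f-seq b′ k)
               (ℚ.<⇒≤ (0<d⇒p<q (ℚ.<-trans (Pos.0<margin fa′fb′<0) sg)
                 (sym (ℚ.+-identityˡ (- (seq (f a′) k * seq (f b′) k)))))))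
        (Pos.eventually a′<b′) (Pos.eventually fa′fb′<0))
      k = proj₁ index
      found = root-ℚ (seq a′ k) (seq b′ k) (proj₁ (proj₂ index)) (proj₂ (proj₂ index))
      u = proj₁ found
      fu≃0 = proj₂ (proj₂ (proj₂ found))
      a<u : Pos (u -ᴿ a)
      a<u = Pos-mono {fromℚ (seq a′ k) -ᴿ a} {u -ᴿ a}
        (λ n → ℚ.+-monoˡ-≤ (- seq a n) (proj₁ (proj₂ found) n)) (a′>a k)
      u<b : Pos (b -ᴿ u)
      u<b = Pos-mono {b -ᴿ fromℚ (seq b′ k)} {b -ᴿ u}
        (λ n → ℚ.+-monoʳ-≤ (seq b n) (ℚ.neg-antimono-≤ (proj₁ (proj₂ (proj₂ found)) n))) (b′<b k)

    root : ∀ a b → Pos (b -ᴿ a) → Pos (-ᴿ (f a *ᴿ f b)) →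
      ∃ λ u → Pos (u -ᴿ a) × Pos (b -ᴿ u) × f u ≃ 0ᴿ
    -- Rational approximations of b from below are the negatives of those of -b from above.
    root a b = root-between a b (fromAbove a) (-ᴿ fromAbove (-ᴿ b))
      (≃-sym {fromAbove a} {a} (fromAbove≃ a))
      ⟨ small-resp (λ n → solve 2 (λ b c → c :- (:- b) := b :- (:- c)) refl (seq b n) (seq (fromAbove (-ᴿ b)) n))
          (≃⇒≈ (fromAbove≃ (-ᴿ b))) ⟩
      (fromAbove-above a)
      (λ k → Pos-mono {fromℚ (seq (fromAbove (-ᴿ b)) k) -ᴿ (-ᴿ b)} {b -ᴿ fromℚ (seq (-ᴿ fromAbove (-ᴿ b)) k)}
        (λ n → ℚ.≤-reflexive (solve 2 (λ b c → c :- (:- b) := b :- (:- c)) refl (seq b n) (seq (fromAbove (-ᴿ b)) k)))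
        (fromAbove-above (-ᴿ b) k))

-- The ring of complex numbers

module ComplexNumbers where

  open import Data.Rational.Solver using (module +-*-Solver)
  open import Defs
  open ≡ using (refl)
  open +-*-Solver using (solve; _:+_; _:*_; _:-_; :-_; _:=_; con)
  open Polynomials
  open RealNumbers

  infix 4 _≃ᶜ_

  record _≃ᶜ_ (z w : ℂ) : Set where
    constructor _+≃i_
    field
      re≃ : re z ≃ re w
      im≃ : im z ≃ im w

  infix 5 _+≃i_

  open _≃ᶜ_ public

  ≈ᶜ⇒≃ᶜ : ∀ {z w} → z ≈ᶜ w → z ≃ᶜ w
  ≈ᶜ⇒≃ᶜ (r , i) = ⟨ r ⟩ +≃i ⟨ i ⟩

  ≃ᶜ⇒≈ᶜ : ∀ {z w} → z ≃ᶜ w → z ≈ᶜ w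
  ≃ᶜ⇒≈ᶜ (⟨ r ⟩ +≃i ⟨ i ⟩) = r , i

  pointwiseᶜ : ∀ z w → (∀ n → seq (re z) n ≡ seq (re w) n) → (∀ n → seq (im z) n ≡ seq (im w) n) → z ≃ᶜ w
  pointwiseᶜ z w r i = pointwise {re z} {re w} r +≃i pointwise {im z} {im w} i

  ≃ᶜ-refl : ∀ {z} → z ≃ᶜ z
  ≃ᶜ-refl {z} = ≃-refl {re z} +≃i ≃-refl {im z}

  ≃ᶜ-sym : ∀ {z w} → z ≃ᶜ w → w ≃ᶜ z
  ≃ᶜ-sym {z} {w} (r +≃i i) = ≃-sym {re z} {re w} r +≃i ≃-sym {im z} {im w} i

  ≃ᶜ-trans : ∀ {z w u} → z ≃ᶜ w → w ≃ᶜ u → z ≃ᶜ u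
  ≃ᶜ-trans {z} {w} {u} (r +≃i i) (r′ +≃i i′) =
    ≃-trans {re z} {re w} {re u} r r′ +≃i ≃-trans {im z} {im w} {im u} i i′

  +ᶜ-cong : ∀ {z z′ w w′} → z ≃ᶜ z′ → w ≃ᶜ w′ → z +ᶜ w ≃ᶜ z′ +ᶜ w′
  +ᶜ-cong {z} {z′} {w} {w′} (r +≃i i) (r′ +≃i i′) =
    +ᴿ-cong {re z} {re z′} {re w} {re w′} r r′ +≃i +ᴿ-cong {im z} {im z′} {im w} {im w′} i i′

  -ᶜ-cong : ∀ {z w} → z ≃ᶜ w → -ᶜ z ≃ᶜ -ᶜ w
  -ᶜ-cong {z} {w} (r +≃i i) = -ᴿ-cong {re z} {re w} r +≃i -ᴿ-cong {im z} {im w} i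

  *ᶜ-cong : ∀ {z z′ w w′} → z ≃ᶜ z′ → w ≃ᶜ w′ → z *ᶜ w ≃ᶜ z′ *ᶜ w′
  *ᶜ-cong {z} {z′} {w} {w′} (r +≃i i) (r′ +≃i i′) =
    +ᴿ-cong {re z *ᴿ re w} {re z′ *ᴿ re w′} { -ᴿ (im z *ᴿ im w)} { -ᴿ (im z′ *ᴿ im w′)}
        (*ᴿ-cong {re z} {re z′} {re w} {re w′} r r′)
        (-ᴿ-cong {im z *ᴿ im w} {im z′ *ᴿ im w′} (*ᴿ-cong {im z} {im z′} {im w} {im w′} i i′))
    +≃i +ᴿ-cong {re z *ᴿ im w} {re z′ *ᴿ im w′} {im z *ᴿ re w} {im z′ *ᴿ re w′}
        (*ᴿ-cong {re z} {re z′} {im w} {im w′} r i′)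
        (*ᴿ-cong {im z} {im z′} {re w} {re w′} i r′)

  +ᶜ-isGroup : IsGroup _≃ᶜ_ _+ᶜ_ 0ᶜ (-ᶜ_)
  +ᶜ-isGroup = record
    { isMonoid = record
      { isSemigroup = record
        { isMagma = record
          { isEquivalence = record { refl = ≃ᶜ-refl ; sym = ≃ᶜ-sym ; trans = ≃ᶜ-trans }
          ; ∙-cong = λ {x} {y} {u} {v} → +ᶜ-cong {x} {y} {u} {v} }
        ; assoc = λ x y z → pointwiseᶜ ((x +ᶜ y) +ᶜ z) (x +ᶜ (y +ᶜ z))
            (λ n → ℚ.+-assoc (seq (re x) n) (seq (re y) n) (seq (re z) n))
            (λ n → ℚ.+-assoc (seq (im x) n) (seq (im y) n) (seq (im z) n)) }
      ; identity = (λ x → pointwiseᶜ (0ᶜ +ᶜ x) x (λ n → ℚ.+-identityˡ (seq (re x) n)) (λ n → ℚ.+-identityˡ (seq (im x) n)))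
                 , (λ x → pointwiseᶜ (x +ᶜ 0ᶜ) x (λ n → ℚ.+-identityʳ (seq (re x) n)) (λ n → ℚ.+-identityʳ (seq (im x) n))) }
    ; inverse = (λ x → pointwiseᶜ ((-ᶜ x) +ᶜ x) 0ᶜ (λ n → ℚ.+-inverseˡ (seq (re x) n)) (λ n → ℚ.+-inverseˡ (seq (im x) n)))
              , (λ x → pointwiseᶜ (x +ᶜ (-ᶜ x)) 0ᶜ (λ n → ℚ.+-inverseʳ (seq (re x) n)) (λ n → ℚ.+-inverseʳ (seq (im x) n)))
    ; ⁻¹-cong = λ {x} {y} x≃y → ≈ᶜ⇒≃ᶜ (≃ᶜ⇒≈ᶜ (-ᶜ-cong {x} {y} x≃y)) }

  +ᶜ-isAbelianGroup : IsAbelianGroup _≃ᶜ_ _+ᶜ_ 0ᶜ (-ᶜ_)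
  +ᶜ-isAbelianGroup = record
    { isGroup = +ᶜ-isGroup
    ; comm = λ x y → pointwiseᶜ (x +ᶜ y) (y +ᶜ x)
        (λ n → ℚ.+-comm (seq (re x) n) (seq (re y) n)) (λ n → ℚ.+-comm (seq (im x) n) (seq (im y) n)) }

  *ᶜ-assoc : ∀ x y z → (x *ᶜ y) *ᶜ z ≃ᶜ x *ᶜ (y *ᶜ z)
  *ᶜ-assoc x y z = pointwiseᶜ ((x *ᶜ y) *ᶜ z) (x *ᶜ (y *ᶜ z))
    (λ n → solve 6 (λ a b c d e f → (a :* c :- b :* d) :* e :- (a :* d :+ b :* c) :* f
                      := a :* (c :* e :- d :* f) :- b :* (c :* f :+ d :* e)) refl
             (seq (re x) n) (seq (im x) n) (seq (re y) n) (seq (im y) n) (seq (re z) n) (seq (im z) n))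
    (λ n → solve 6 (λ a b c d e f → (a :* c :- b :* d) :* f :+ (a :* d :+ b :* c) :* e
                      := a :* (c :* f :+ d :* e) :+ b :* (c :* e :- d :* f)) refl
             (seq (re x) n) (seq (im x) n) (seq (re y) n) (seq (im y) n) (seq (re z) n) (seq (im z) n))

  *ᶜ-comm : ∀ x y → x *ᶜ y ≃ᶜ y *ᶜ x
  *ᶜ-comm x y = pointwiseᶜ (x *ᶜ y) (y *ᶜ x)
    (λ n → solve 4 (λ a b c d → a :* c :- b :* d := c :* a :- d :* b) refl
             (seq (re x) n) (seq (im x) n) (seq (re y) n) (seq (im y) n))
    (λ n → solve 4 (λ a b c d → a :* d :+ b :* c := c :* b :+ d :* a) refl
             (seq (re x) n) (seq (im x) n) (seq (re y) n) (seq (im y) n))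

  *ᶜ-identityˡ : ∀ x → 1ᶜ *ᶜ x ≃ᶜ x
  *ᶜ-identityˡ x = pointwiseᶜ (1ᶜ *ᶜ x) x
    (λ n → solve 2 (λ a b → con 1ℚ :* a :- con 0ℚ :* b := a) refl (seq (re x) n) (seq (im x) n))
    (λ n → solve 2 (λ a b → con 1ℚ :* b :+ con 0ℚ :* a := b) refl (seq (re x) n) (seq (im x) n))

  *ᶜ-distribˡ : ∀ x y z → x *ᶜ (y +ᶜ z) ≃ᶜ x *ᶜ y +ᶜ x *ᶜ z
  *ᶜ-distribˡ x y z = pointwiseᶜ (x *ᶜ (y +ᶜ z)) (x *ᶜ y +ᶜ x *ᶜ z)
    (λ n → solve 6 (λ a b c d e f → a :* (c :+ e) :- b :* (d :+ f)
                      := (a :* c :- b :* d) :+ (a :* e :- b :* f)) refl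
             (seq (re x) n) (seq (im x) n) (seq (re y) n) (seq (im y) n) (seq (re z) n) (seq (im z) n))
    (λ n → solve 6 (λ a b c d e f → a :* (d :+ f) :+ b :* (c :+ e)
                      := (a :* d :+ b :* c) :+ (a :* f :+ b :* e)) refl
             (seq (re x) n) (seq (im x) n) (seq (re y) n) (seq (im y) n) (seq (re z) n) (seq (im z) n))

  ℂ-isRing : IsRing _≃ᶜ_ _+ᶜ_ _*ᶜ_ (-ᶜ_) 0ᶜ 1ᶜ
  ℂ-isRing = record
    { +-isAbelianGroup = +ᶜ-isAbelianGroup
    ; *-cong = λ {x} {y} {u} {v} → *ᶜ-cong {x} {y} {u} {v}
    ; *-assoc = *ᶜ-assoc
    ; *-identity = *ᶜ-identityˡ , λ x → ≃ᶜ-trans {x *ᶜ 1ᶜ} {1ᶜ *ᶜ x} {x} (*ᶜ-comm x 1ᶜ) (*ᶜ-identityˡ x)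
    ; distrib = *ᶜ-distribˡ
              , λ x y z → ≃ᶜ-trans {(y +ᶜ z) *ᶜ x} {x *ᶜ (y +ᶜ z)} {y *ᶜ x +ᶜ z *ᶜ x} (*ᶜ-comm (y +ᶜ z) x)
                  (≃ᶜ-trans {x *ᶜ (y +ᶜ z)} {x *ᶜ y +ᶜ x *ᶜ z} {y *ᶜ x +ᶜ z *ᶜ x} (*ᶜ-distribˡ x y z)
                    (+ᶜ-cong {x *ᶜ y} {y *ᶜ x} {x *ᶜ z} {z *ᶜ x} (*ᶜ-comm x y) (*ᶜ-comm x z))) }

  ℂ-commutativeRing : CommutativeRing 0ℓ 0ℓ
  ℂ-commutativeRing = record
    { Carrier = ℂ ; _≈_ = _≃ᶜ_ ; _+_ = _+ᶜ_ ; _*_ = _*ᶜ_ ; -_ = -ᶜ_ ; 0# = 0ᶜ ; 1# = 1ᶜ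
    ; isCommutativeRing = record { isRing = ℂ-isRing ; *-comm = *ᶜ-comm } }

  fromℚᶜ : ℚ → ℂ
  fromℚᶜ q = fromℝ (fromℚ q)

  fromℚᶜ-morphism : ℚ.+-*-rawRing -Raw-AlmostCommutative⟶ fromCommutativeRing ℂ-commutativeRing
  fromℚᶜ-morphism = record
    { ⟦_⟧    = fromℚᶜ
    ; +-homo = λ p q → pointwiseᶜ (fromℚᶜ (p ℚ.+ q)) (fromℚᶜ p +ᶜ fromℚᶜ q) (λ _ → refl) (λ _ → refl)
    ; *-homo = λ p q → pointwiseᶜ (fromℚᶜ (p ℚ.* q)) (fromℚᶜ p *ᶜ fromℚᶜ q)
        (λ _ → solve 2 (λ p q → p :* q := p :* q :- con 0ℚ :* con 0ℚ) refl p q)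
        (λ _ → solve 2 (λ p q → con 0ℚ := p :* con 0ℚ :+ con 0ℚ :* q) refl p q)
    ; -‿homo = λ p → pointwiseᶜ (fromℚᶜ (ℚ.- p)) (-ᶜ fromℚᶜ p) (λ _ → refl) (λ _ → refl)
    ; 0-homo = ≃ᶜ-refl
    ; 1-homo = ≃ᶜ-refl
    }

  module ℂ-alg = ℚ-Algebra ℂ-commutativeRing fromℚᶜ-morphism

  +ᶜ≡ : ∀ z w → z +ᶜ w ≡ z ℂ-alg.+ w
  +ᶜ≡ z w = refl

  *ᶜ≡ : ∀ z w → z *ᶜ w ≡ z ℂ-alg.* w
  *ᶜ≡ z w = refl

-- From real roots to zeros on the line Re z = -1/2

module CriticalLine where

  open import Data.Rational.Solver using (module +-*-Solver)
  open import Defs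
  open Defs.Line using (point)
  open ≡ using (refl; cong; cong₂)
  open +-*-Solver using (solve; _:+_; _:*_; _:-_; :-_; _:=_; con)
  open ComplexNumbers
  open IntermediateValues
  open Polynomials
  open Rationals
  open RealNumbers
  open RealRoots

  -- The polynomial operations of the theorem and those of `ℚ-Algebra` are separate definitions with
  -- the same clauses. This and the following lemmas translate between them.
  coeff≡ : ∀ p k → coeff p k ≡ ℂ-alg.coeff p k
  coeff≡ []      k       = refl
  coeff≡ (a ∷ p) zero    = refl
  coeff≡ (a ∷ p) (suc k) = coeff≡ p k

  eval≃ : ∀ p z → eval p z ≃ᶜ ℂ-alg.eval p z
  eval≃ []      z = ≃ᶜ-refl
  eval≃ (a ∷ p) z =
    let r +≃i i = +ᶜ-cong {a} {a} {z *ᶜ eval p z} {z *ᶜ ℂ-alg.eval p z} (≃ᶜ-refl {a})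
                    (*ᶜ-cong {z} {z} {eval p z} {ℂ-alg.eval p z} (≃ᶜ-refl {z}) (eval≃ p z))
    in ⟨ ≃⇒≈ r ⟩ +≃i ⟨ ≃⇒≈ i ⟩

  +ₚ≡ : ∀ p q → p +ₚ q ≡ p ℂ-alg.+ₚ q
  +ₚ≡ []      q       = refl
  +ₚ≡ (a ∷ p) []      = refl
  +ₚ≡ (a ∷ p) (b ∷ q) = cong₂ _∷_ (+ᶜ≡ a b) (+ₚ≡ p q)

  ·ₚ≡ : ∀ c p → c ·ₚ p ≡ c ℂ-alg.·ₚ p
  ·ₚ≡ c []      = refl
  ·ₚ≡ c (a ∷ p) = cong₂ _∷_ (*ᶜ≡ c a) (·ₚ≡ c p)

  *ₚ≡ : ∀ p q → p *ₚ q ≡ p ℂ-alg.*ₚ q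
  *ₚ≡ []      q = refl
  *ₚ≡ (a ∷ p) q = ≡.trans (cong₂ (λ r s → r +ₚ (0ᶜ ∷ s)) (·ₚ≡ a q) (*ₚ≡ p q))
    (+ₚ≡ (a ℂ-alg.·ₚ q) (0ᶜ ∷ (p ℂ-alg.*ₚ q)))

  foldr-≡ : ∀ {A : Set} (_∙_ _⋆_ : A → A → A) {ε ε′ : A} → (∀ x y → x ∙ y ≡ x ⋆ y) → ε ≡ ε′ →
    ∀ {n} (f g : Vector A n) → (∀ i → f i ≡ g i) → foldr _∙_ ε f ≡ foldr _⋆_ ε′ g
  foldr-≡ _∙_ _⋆_ ∙≡⋆ ε≡ε′ {zero}  f g f≡g = ε≡ε′
  foldr-≡ _∙_ _⋆_ {ε′ = ε′} ∙≡⋆ ε≡ε′ {suc n} f g f≡g = ≡.trans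
    (cong₂ _∙_ (f≡g zero) (foldr-≡ _∙_ _⋆_ ∙≡⋆ ε≡ε′ (tail f) (tail g) (λ i → f≡g (suc i))))
    (∙≡⋆ (g zero) (foldr _⋆_ ε′ (tail g)))

  ∏ₚ≡ : ∀ {n} (z : Vector ℂ n) → ∏ₚ (λ i → x- z i) ≡ ℂ-alg.∏ₚ (λ i → ℂ-alg.x- z i)
  ∏ₚ≡ z = foldr-≡ _*ₚ_ ℂ-alg._*ₚ_ *ₚ≡ refl (λ i → x- z i) (λ i → ℂ-alg.x- z i) (λ i → refl)

  norm : ℂ → ℝ
  norm z = re z *ᴿ re z +ᴿ im z *ᴿ im z

  -- Multiplication by the conjugate replaces z by its norm, a positive real that cancels from both
  -- components.
  norm-regular : ∀ z → Pos (norm z) → ℂ-alg.Regular z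
  norm-regular z 0<∣z∣ = ℂ-alg.regular λ { y (⟨ re≈0 ⟩ +≃i ⟨ im≈0 ⟩) →
    let ⟨ p ⟩ , ⟨ q ⟩ = ℝ-alg.conjugate-cancel (re z) (im z) (re y) (im y) ⟨ re≈0 ⟩ ⟨ im≈0 ⟩
        cancel = ℝ-alg.Regular.cancel (Pos-regular {norm z} 0<∣z∣)
    in cancel (re y) ⟨ p ⟩ +≃i cancel (im y) ⟨ q ⟩ }

  re-point : ∀ t n → seq (re (point Re=-½ t)) n ≡ ℚ.- ½
  re-point t n = solve 1 (λ t → con (ℚ.- ½) :+ (t :* con 0ℚ :- con 0ℚ :* con 1ℚ) := con (ℚ.- ½)) refl (seq t n)

  im-point : ∀ t n → seq (im (point Re=-½ t)) n ≡ seq t n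
  im-point t n = solve 1 (λ t → con 0ℚ :+ (t :* con 1ℚ :+ con 0ℚ :* con 0ℚ) := t) refl (seq t n)

  imaginary-regular : ∀ z d → (∀ n → seq (re z) n ≡ 0ℚ) → (∀ n → seq (im z) n ≡ seq d n) →
    Pos d → ℂ-alg.Regular z
  imaginary-regular z d re≡0 im≡d 0<d = norm-regular z (Pos-resp {d *ᴿ d} {norm z}
    (pointwise {d *ᴿ d} {norm z} λ n → ≡.trans
      (solve 1 (λ d → d :* d := con 0ℚ :* con 0ℚ :+ d :* d) refl (seq d n))
      (≡.sym (cong₂ (λ a b → a ℚ.* a ℚ.+ b ℚ.* b) (re≡0 n) (im≡d n))))
    (Pos-* {d} {d} 0<d 0<d))

  off-line-norm-regular : ∀ z d → (∀ n → seq (re z) n ≡ seq d n) → Pos (d *ᴿ d) → ℂ-alg.Regular z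
  off-line-norm-regular z d re≡d 0<d² = norm-regular z (Pos-mono {d *ᴿ d} {norm z}
    (λ n → 0≤d⇒p≤q (0≤p² (seq (im z) n)) (≡.trans
      (solve 2 (λ d b → b :* b := (d :* d :+ b :* b) :- d :* d) refl (seq d n) (seq (im z) n))
      (cong (λ a → (a ℚ.* a ℚ.+ seq (im z) n ℚ.* seq (im z) n) ℚ.- seq d n ℚ.* seq d n) (≡.sym (re≡d n)))))
    0<d²)

  -- The square merges d > 0 and d < 0 into one positivity condition, which can be refuted in one
  -- go.
  ¬Pos²⇒≃0 : ∀ d → ¬ Pos (d *ᴿ d) → d ≃ 0ᴿ
  ¬Pos²⇒≃0 d ¬0<d² = ¬Pos⇒≃0 {d} (λ 0<d → ¬0<d² (Pos-* {d} {d} 0<d 0<d))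
    (λ 0<-d → ¬0<d² (Pos-resp {(-ᴿ d) *ᴿ (-ᴿ d)} {d *ᴿ d}
      (pointwise {(-ᴿ d) *ᴿ (-ᴿ d)} {d *ᴿ d} λ n → solve 1 (λ d → (:- d) :* (:- d) := d :* d) refl (seq d n))
      (Pos-* { -ᴿ d} { -ᴿ d} 0<-d 0<-d)))

  point-regular : ∀ t u → Pos (u -ᴿ t) → ℂ-alg.Regular (point Re=-½ u ℂ-alg.- point Re=-½ t)
  point-regular t u = imaginary-regular (point Re=-½ u ℂ-alg.- point Re=-½ t) (u -ᴿ t)
    (λ n → cong₂ ℚ._-_ (re-point u n) (re-point t n))
    (λ n → cong₂ ℚ._-_ (im-point u n) (im-point t n))

  point-regular′ : ∀ {t u z w} → z ≡ point Re=-½ t → w ≡ point Re=-½ u → Pos (u ℝ-alg.- t) →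
    ℂ-alg.Regular (w ℂ-alg.- z)
  point-regular′ {t} {u} refl refl (pos ε 0<ε ε<u-t) = point-regular t u (pos ε 0<ε ε<u-t)

  off-line-regular : ∀ z t → Pos ((re z -ᴿ -½) *ᴿ (re z -ᴿ -½)) → ℂ-alg.Regular (z ℂ-alg.- point Re=-½ t)
  off-line-regular z t = off-line-norm-regular (z ℂ-alg.- point Re=-½ t) (re z -ᴿ -½)
    (λ n → cong (λ a → seq (re z) n ℚ.- a) (re-point t n))

  ℝ-field : Roots.IntermediateValueField ℝ-commutativeRing fromℚ-morphism
  ℝ-field = record
    { Pos         = Pos
    ; Pos-resp    = λ {x} {y} → Pos-resp {x} {y}
    ; Pos-κ       = Pos-fromℚ
    ; Pos-+       = λ {x} {y} → Pos-+ {x} {y}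
    ; Pos-*       = λ {x} {y} → Pos-* {x} {y}
    ; Pos-cancelˡ = λ {x} {y} → Pos-cancelˡ {x} {y}
    ; Pos-regular = λ {x} → Pos-regular {x}
    ; bound       = λ x → let q , beyond = bounded-by-ℚ x in q , λ r q≤r →
        let pos ε 0<ε above , pos δ 0<δ below = beyond r q≤r in pos ε 0<ε above , pos δ 0<δ below
    ; intermediate-value = λ { b v n x y (pos ε 0<ε x<y) (pos δ 0<δ opposite) →
        let u , pos η 0<η x<u , pos θ 0<θ u<y , ⟨ root ⟩ =
              IntermediateValue.root (ℝ-alg.Recurrence.value b v n) (ℚ-alg.Recurrence.value b v n)
                (seq-value b v n) (λ {x} {y} → ℝ-alg.Recurrence.value-cong b v n {x} {y})
                x y (pos ε 0<ε x<y) (pos δ 0<δ opposite)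
        in u , pos η 0<η x<u , pos θ 0<θ u<y , ⟨ root ⟩ }
    }

  fromℝ-homomorphism : Transfer.Homomorphism ℝ-commutativeRing fromℚ-morphism ℂ-commutativeRing fromℚᶜ-morphism
  fromℝ-homomorphism = record
    { φ      = fromℝ
    ; φ-cong = λ x y x≃y → x≃y +≃i ≃-refl {0ᴿ}
    ; φ-+    = λ x y → pointwiseᶜ (fromℝ (x ℝ-alg.+ y)) (fromℝ x ℂ-alg.+ fromℝ y) (λ _ → refl) (λ _ → refl)
    ; φ-*    = λ x y → pointwiseᶜ (fromℝ (x ℝ-alg.* y)) (fromℝ x ℂ-alg.* fromℝ y)
        (λ n → solve 2 (λ x y → x :* y := x :* y :- con 0ℚ :* con 0ℚ) refl (seq x n) (seq y n))
        (λ n → solve 2 (λ x y → con 0ℚ := x :* con 0ℚ :+ con 0ℚ :* y) refl (seq x n) (seq y n))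
    ; φ-κ    = λ q → ≃ᶜ-refl {fromℚᶜ q}
    }

  module _ (w : ℕ → ℚ) where

    open ℂ-alg.Recurrence 1ℚ w
    module ℝ-rec = ℝ-alg.Recurrence 0ℚ (λ n → ℚ.- w n)

    𝕚² : 𝕚 *ᶜ 𝕚 ≃ᶜ -ᶜ 1ᶜ
    𝕚² = pointwiseᶜ (𝕚 *ᶜ 𝕚) (-ᶜ 1ᶜ) (λ _ → refl) (λ _ → refl)

    point-equation : ∀ t → fromℚᶜ 2ℚ *ᶜ point Re=-½ t +ᶜ fromℚᶜ 1ℚ ≃ᶜ 𝕚 *ᶜ (fromℚᶜ 2ℚ *ᶜ fromℝ t +ᶜ fromℚᶜ 0ℚ)
    point-equation t = pointwiseᶜ (fromℚᶜ 2ℚ *ᶜ point Re=-½ t +ᶜ fromℚᶜ 1ℚ)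
                                  (𝕚 *ᶜ (fromℚᶜ 2ℚ *ᶜ fromℝ t +ᶜ fromℚᶜ 0ℚ))
      -- `re` and `im` repeat the components of the point as complex multiplication computes them,
      -- products with 0 and 1 included, so that the solver's equation matches the sequences
      -- literally.
      (λ n → solve 1 (λ t →
        let re = con (ℚ.- ½) :+ (t :* con 0ℚ :- con 0ℚ :* con 1ℚ)
            im = con 0ℚ :+ (t :* con 1ℚ :+ con 0ℚ :* con 0ℚ)
        in (con 2ℚ :* re :- con 0ℚ :* im) :+ con 1ℚ
           := con 0ℚ :* ((con 2ℚ :* t :- con 0ℚ :* con 0ℚ) :+ con 0ℚ)
              :- con 1ℚ :* ((con 2ℚ :* con 0ℚ :+ con 0ℚ :* t) :+ con 0ℚ)) refl (seq t n))
      (λ n → solve 1 (λ t →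
        let re = con (ℚ.- ½) :+ (t :* con 0ℚ :- con 0ℚ :* con 1ℚ)
            im = con 0ℚ :+ (t :* con 1ℚ :+ con 0ℚ :* con 0ℚ)
        in (con 2ℚ :* im :+ con 0ℚ :* re) :+ con 0ℚ
           := con 0ℚ :* ((con 2ℚ :* con 0ℚ :+ con 0ℚ :* t) :+ con 0ℚ)
              :+ con 1ℚ :* ((con 2ℚ :* t :- con 0ℚ :* con 0ℚ) :+ con 0ℚ)) refl (seq t n))

    value-point : ∀ n t → ℝ-rec.value n t ≃ 0ᴿ → value n (point Re=-½ t) ≃ᶜ 0ᶜ
    value-point n t root =
      let ⟨ r ⟩ +≃i ⟨ i ⟩ = 𝕚²
          ⟨ r′ ⟩ +≃i ⟨ i′ ⟩ = point-equation t
      in Transfer.Homomorphism.rotation-root fromℝ-homomorphism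
           𝕚 (⟨ r ⟩ +≃i ⟨ i ⟩) (point Re=-½ t) t (⟨ r′ ⟩ +≃i ⟨ i′ ⟩) w n root

    zeros : (t : ℕ → ℝ) (m : ℕ) → Vector ℂ m
    zeros t m i = point Re=-½ (t (toℕ i))

    off-line-regular′ : ∀ z {w t} → w ≡ point Re=-½ t → Pos ((re z -ᴿ -½) *ᴿ (re z -ᴿ -½)) →
      ℂ-alg.Regular (z ℂ-alg.- w)
    off-line-regular′ z {t = t} refl = off-line-regular z t

    zeros-regular : ∀ m (t : ℕ → ℝ) → (∀ {i j} → i ℕ.< j → j ℕ.< m → Pos (t j ℝ-alg.- t i)) →
      ∀ i j → i Fin.< j → ℂ-alg.Regular (zeros t m j ℂ-alg.- zeros t m i)
    zeros-regular m t mono i j i<j =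
      point-regular′ {t (toℕ i)} {t (toℕ j)} {zeros t m i} {zeros t m j} refl refl (mono i<j (Fin.toℕ<n j))

    ¬1≃0 : ¬ (ℂ-alg.1# ≃ᶜ ℂ-alg.0#)
    ¬1≃0 (⟨ 1≈0 ⟩ +≃i _) = ¬Pos-0 (Pos-resp {1ᴿ} {0ᴿ} ⟨ 1≈0 ⟩ (Pos-fromℚ 0<1))

    off-line-nonzero : ∀ m t z → value m z ≃ᶜ ℂ-alg.0# →
      (∀ i j → i Fin.< j → ℂ-alg.Regular (zeros t m j ℂ-alg.- zeros t m i)) →
      (∀ i → value m (zeros t m i) ≃ᶜ ℂ-alg.0#) →
      ¬ Pos ((re z -ᴿ -½) *ᴿ (re z -ᴿ -½))
    off-line-nonzero m t z z-root regular root 0<d² = ¬1≃0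
      (root-not-separated m (zeros t m) regular root (ℂ-alg.κ-regular (0<2^ m))
        z (λ i → off-line-regular′ z {zeros t m i} {t (toℕ i)} refl 0<d²) z-root)

    -- The m known zeros exhaust the degree, so z cannot be separated from all of them, as it would
    -- be if it were off the line. Equality of reals follows from refuting apartness.
    zero-on-line : ∀ m t z → value m z ≃ᶜ ℂ-alg.0# →
      (∀ i j → i Fin.< j → ℂ-alg.Regular (zeros t m j ℂ-alg.- zeros t m i)) →
      (∀ i → value m (zeros t m i) ≃ᶜ ℂ-alg.0#) →
      re z ≈ -½
    zero-on-line m t z z-root regular root ε 0<ε = eventually-map
      (λ n → ≡.subst (λ q → ℚ.∣ q ∣ ℚ.< ε) (ℚ.+-identityʳ (seq (re z) n ℚ.- seq -½ n)))
      (≃⇒≈ (¬Pos²⇒≃0 (re z -ᴿ -½) (off-line-nonzero m t z z-root regular root)) ε 0<ε)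

-- Lattice points in dilates of the polytope of a star

module StarPolytope where

  open import Data.Integer.Solver using (module +-*-Solver)
  import Data.Rational.Solver
  open import Data.Unit using (tt)
  open import Data.Vec.Properties using (∷-injectiveʳ)
  open import Defs
  open ≡ using (refl; sym; trans; cong; cong₂; subst; module ≡-Reasoning)
  open Counting
  open Functionals
  open Polynomials
  open Rationals
  open RealNumbers

  module ℝ-hull = Hull ℝ-commutativeRing fromℚ-morphism

  e-diagonal : ∀ {n} (v : Fin n) → e v v ≃ 1ᴿ
  e-diagonal v with v Fin.≟ v
  ... | yes _  = ≃-refl {1ᴿ}
  ... | no v≢v = contradiction refl v≢v

  e-off : ∀ {n} (v u : Fin n) → u ≢ v → e v u ≃ 0ᴿ
  e-off v u u≢v with v Fin.≟ u
  ... | yes v≡u = contradiction (sym v≡u) u≢v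
  ... | no  _   = ≃-refl {0ᴿ}

  StarDilate : ∀ n → ℕ → Pred (Vec ℤ (suc n)) 0ℓ
  StarDilate n s = LatticePoint (Dilate s (SymmetricEdgePolytope (K 1 n)))

  -- By `functional-identity` the gap rs - a·x is s times a nonnegative combination of the gaps of a
  -- on the edge vectors. It is an integer, so its sign as a real can be read off in ℤ.
  functional-bound : ∀ n s x → StarDilate n s x → ∀ (a : Vector ℤ (suc n)) r →
    (∀ v w → Graph.Adj (K 1 n) v w → a v ℤ.- a w ℤ.≤ r) →
    ∑ℤ (λ u → a u ℤ.* lookup x u) ℤ.≤ r ℤ.* + s
  functional-bound n s x (y , (k , c , p , c≥0 , ∑c≈1 , edges , y≈cp) , x≈sy) a r a-bound =
    ℤ.0≤i-j⇒j≤i (ι-cancel-≤ {+ 0} (NonNeg-fromℚ⁻¹ bound-nonNeg))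
    where
    from to : Fin k → Fin (suc n)
    from j = proj₁ (edges j)
    to   j = proj₁ (proj₂ (edges j))
    q : Vector ℤ k
    q j = a (from j) ℤ.- a (to j)
    gap : ∀ j → 0ℚ ℚ.≤ ι r ℚ.- ι (q j)
    gap j = p≤q⇒0≤q-p (ι-mono-≤ (a-bound (from j) (to j) (proj₁ (proj₂ (proj₂ (edges j))))))
    identity : _
    identity = ℝ-hull.functional-identity a (lookup x) r (+ s) y c p q
      (λ u → ⟨ x≈sy u ⟩) (λ u → ⟨ y≈cp u ⟩) ⟨ ∑c≈1 ⟩
      (λ j → ℝ-hull.Basis.edge-functional e e-diagonal e-off a (p j) (from j) (to j)
               (λ u → ⟨ proj₂ (proj₂ (proj₂ (edges j))) u ⟩))
      (λ j → c j *ᴿ fromℚ (ι r ℚ.- ι (q j)))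
      (λ j → ⟨ ≃⇒≈ (≃-refl {c j *ᴿ fromℚ (ι r ℚ.- ι (q j))}) ⟩)
    f-nonNeg : ∀ j → NonNeg (c j *ᴿ fromℚ (ι r ℚ.- ι (q j)))
    f-nonNeg j = NonNeg-*fromℚ {c j} {ι r ℚ.- ι (q j)} (≤⇒NonNeg {c j} (c≥0 j)) (gap j)
    sum-nonNeg : NonNeg (∑ᴿ (λ j → c j *ᴿ fromℚ (ι r ℚ.- ι (q j))) *ᴿ fromℚ (ι (+ s)))
    sum-nonNeg = NonNeg-*fromℚ {∑ᴿ (λ j → c j *ᴿ fromℚ (ι r ℚ.- ι (q j)))} {ι (+ s)}
      (NonNeg-∑ (λ j → c j *ᴿ fromℚ (ι r ℚ.- ι (q j))) f-nonNeg) (0≤ι s)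
    bound-nonNeg : NonNeg (fromℚ (ι (r ℤ.* + s ℤ.- ∑ℤ (λ u → a u ℤ.* lookup x u))))
    bound-nonNeg = NonNeg-resp
      {∑ᴿ (λ j → c j *ᴿ fromℚ (ι r ℚ.- ι (q j))) *ᴿ fromℚ (ι (+ s))}
      {fromℚ (ι (r ℤ.* + s ℤ.- ∑ℤ (λ u → a u ℤ.* lookup x u)))}
      ⟨ ≃⇒≈ identity ⟩ sum-nonNeg

  ∑ℤ-cong : ∀ {n} {f g : Vector ℤ n} → (∀ i → f i ≡ g i) → ∑ℤ f ≡ ∑ℤ g
  ∑ℤ-cong {zero}  f≡g = refl
  ∑ℤ-cong {suc n} f≡g = cong₂ ℤ._+_ (f≡g zero) (∑ℤ-cong (λ i → f≡g (suc i)))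

  ∑ℤ-neg : ∀ {n} (f : Vector ℤ n) → ∑ℤ (λ i → ℤ.- f i) ≡ ℤ.- ∑ℤ f
  ∑ℤ-neg {zero}  f = refl
  ∑ℤ-neg {suc n} f = trans (cong (λ t → ℤ.- f zero ℤ.+ t) (∑ℤ-neg (λ i → f (suc i))))
    (sym (ℤ.neg-distrib-+ (f zero) (∑ℤ (λ i → f (suc i)))))

  -- The value 1 at 0 is a convention: what matters is that signum z · z = |z| and that both signs
  -- of the result are at most 1.
  signum : ℤ → ℤ
  signum (+ _)     = + 1
  signum -[1+ _ ]  = ℤ.- + 1

  signum-* : ∀ z → signum z ℤ.* z ≡ + ℤ.∣ z ∣
  signum-* (+ n)    = ℤ.*-identityˡ (+ n)
  signum-* -[1+ n ] = cong (λ m → + suc m) (ℕ.+-identityʳ n)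

  ∣signum∣≤1 : ∀ z → signum z ℤ.≤ + 1 × ℤ.- signum z ℤ.≤ + 1
  ∣signum∣≤1 (+ _)    = ℤ.≤-refl , ℤ.-≤+
  ∣signum∣≤1 -[1+ _ ] = ℤ.-≤+ , ℤ.≤-refl

  ∑-signum : ∀ {n} (v : Vec ℤ n) → ∑ℤ (λ i → signum (lookup v i) ℤ.* lookup v i) ≡ + norm₁ v
  ∑-signum []      = refl
  ∑-signum (z ∷ v) = cong₂ ℤ._+_ (signum-* z) (∑-signum v)

  -- The head is the coordinate at the centre of the star, forced by the vanishing coordinate sum.
  Section : ∀ n → ℕ → Pred (Vec ℤ (suc n)) 0ℓ
  Section n s = Image (λ v → ℤ.- ∑ℤ (lookup v) ∷ v) (Ball n s)

  -- Three functionals suffice. The constants 1 and -1 vanish on all edge vectors and force the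
  -- coordinate sum to be 0; the signs of v, with 0 at the centre, are at most 1 on edge vectors and
  -- take the value `norm₁ v` at the point.
  member⇒section : ∀ n s x → StarDilate n s x → Section n s x
  member⇒section n s (x₀ ∷ v) member = v , ℤ.drop‿+≤+ norm≤s , cong (_∷ v) x₀≡
    where
    open ≡-Reasoning
    total = x₀ ℤ.+ ∑ℤ (lookup v)
    total≤0 : total ℤ.≤ + 0
    total≤0 = subst (ℤ._≤ + 0) (∑ℤ-cong {f = λ u → + 1 ℤ.* lookup (x₀ ∷ v) u} (λ u → ℤ.*-identityˡ (lookup (x₀ ∷ v) u)))
      (functional-bound n s (x₀ ∷ v) member (λ _ → + 1) (+ 0) (λ _ _ _ → ℤ.≤-refl))
    -total≤0 : ℤ.- total ℤ.≤ + 0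
    -total≤0 = subst (ℤ._≤ + 0)
      (trans (∑ℤ-cong {f = λ u → ℤ.- + 1 ℤ.* lookup (x₀ ∷ v) u} (λ u → ℤ.-1*i≡-i (lookup (x₀ ∷ v) u)))
             (∑ℤ-neg (lookup (x₀ ∷ v))))
      (functional-bound n s (x₀ ∷ v) member (λ _ → ℤ.- + 1) (+ 0) (λ _ _ _ → ℤ.≤-refl))
    total≡0 : total ≡ + 0
    total≡0 = ℤ.≤-antisym total≤0 (subst (+ 0 ℤ.≤_) (ℤ.neg-involutive total) (ℤ.neg-mono-≤ -total≤0))
    x₀≡ : x₀ ≡ ℤ.- ∑ℤ (lookup v)
    x₀≡ = begin
      x₀                              ≡⟨ solve 2 (λ x t → x := (x :+ t) :+ (:- t)) refl x₀ (∑ℤ (lookup v)) ⟩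
      total ℤ.+ ℤ.- ∑ℤ (lookup v)     ≡⟨ cong (ℤ._+ ℤ.- ∑ℤ (lookup v)) total≡0 ⟩
      + 0 ℤ.+ ℤ.- ∑ℤ (lookup v)       ≡⟨ ℤ.+-identityˡ _ ⟩
      ℤ.- ∑ℤ (lookup v)               ∎
      where open +-*-Solver
    a : Vector ℤ (suc n)
    a zero    = + 0
    a (suc i) = signum (lookup v i)
    a-bound : ∀ u w → Graph.Adj (K 1 n) u w → a u ℤ.- a w ℤ.≤ + 1
    a-bound zero    zero    ()
    a-bound (suc i) (suc j) ()
    a-bound zero    (suc i) _ = subst (ℤ._≤ + 1) (sym (ℤ.+-identityˡ _)) (proj₂ (∣signum∣≤1 (lookup v i)))
    a-bound (suc i) zero    _ = subst (ℤ._≤ + 1) (sym (ℤ.+-identityʳ _)) (proj₁ (∣signum∣≤1 (lookup v i)))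
    norm≤s : + norm₁ v ℤ.≤ + s
    norm≤s = ℤ.≤-trans
      (ℤ.≤-reflexive (sym (trans (ℤ.+-identityˡ _) (∑-signum v))))
      (ℤ.≤-trans (functional-bound n s (x₀ ∷ v) member a (+ 1) a-bound) (ℤ.≤-reflexive (ℤ.*-identityˡ (+ s))))

  ≤-fromℚ : ∀ {q} → 0ℚ ℚ.≤ q → 0ᴿ Defs.≤ fromℚ q
  ≤-fromℚ 0≤q ε 0<ε = always λ _ → ℚ.+-mono-≤-< 0≤q 0<ε

  norm₁-zero : ∀ {n} (v : Vec ℤ n) → norm₁ v ℕ.≤ 0 → ∀ i → lookup v i ≡ + 0
  norm₁-zero (z ∷ v) z≤0 zero    = ℤ.∣i∣≡0⇒i≡0 (ℕ.n≤0⇒n≡0 (ℕ.m+n≤o⇒m≤o ℤ.∣ z ∣ z≤0))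
  norm₁-zero (z ∷ v) z≤0 (suc i) = norm₁-zero v (ℕ.m+n≤o⇒n≤o ℤ.∣ z ∣ z≤0) i

  ∑ℤ-zero : ∀ {n} (f : Vector ℤ n) → (∀ i → f i ≡ + 0) → ∑ℤ f ≡ + 0
  ∑ℤ-zero {zero}  f f≡0 = refl
  ∑ℤ-zero {suc n} f f≡0 = cong₂ ℤ._+_ (f≡0 zero) (∑ℤ-zero (λ i → f (suc i)) (λ i → f≡0 (suc i)))

  module ℚ-solver = Data.Rational.Solver.+-*-Solver

  -- Scaling by 0 cannot be undone, so this case is separate. The point is 0, and any point of the
  -- polytope serves as witness; the vertex e₀ - e₁ is taken.
  section⇒member-zero : ∀ n x → Section (suc n) 0 x → StarDilate (suc n) 0 x
  section⇒member-zero n _ (v , v≤0 , refl) =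
    y , (1 , (λ _ → 1ᴿ) , (λ _ → y) , (λ _ → ≤-fromℚ (ℚ.<⇒≤ 0<1))
        , ≃⇒≈ (pointwise {1ᴿ +ᴿ 0ᴿ} {1ᴿ} λ _ → refl)
        , (λ _ → zero , suc zero , tt , λ u → ≃⇒≈ (≃-refl {y u}))
        , λ u → ≃⇒≈ (pointwise {y u} {1ᴿ *ᴿ y u +ᴿ 0ᴿ} λ k →
            sym (trans (ℚ.+-identityʳ (1ℚ ℚ.* seq (y u) k)) (ℚ.*-identityˡ (seq (y u) k)))))
      , λ u → ≃⇒≈ (pointwise {fromℤ (lookup x u)} {fromℤ (+ 0) *ᴿ y u} λ k →
          trans (cong ι (x≡0 u)) (sym (ℚ.*-zeroˡ (seq (y u) k))))
    where
    x : Vec ℤ (suc (suc n))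
    x = ℤ.- ∑ℤ (lookup v) ∷ v
    y : Vector ℝ (suc (suc n))
    y u = e zero u -ᴿ e (suc zero) u
    x≡0 : ∀ u → lookup x u ≡ + 0
    x≡0 zero    = cong ℤ.-_ (∑ℤ-zero (lookup v) (norm₁-zero v v≤0))
    x≡0 (suc i) = norm₁-zero v v≤0 i

  ∑ℚ-ι* : ∀ {n} (f : Vector ℤ n) r → ∑ℚ (λ i → ι (f i) ℚ.* r) ≡ ι (∑ℤ f) ℚ.* r
  ∑ℚ-ι* {zero}  f r = sym (ℚ.*-zeroˡ r)
  ∑ℚ-ι* {suc n} f r = trans (cong (ι (f zero) ℚ.* r ℚ.+_) (∑ℚ-ι* (λ i → f (suc i)) r))
    (trans (sym (ℚ.*-distribʳ-+ r (ι (f zero)) (ι (∑ℤ (λ i → f (suc i))))))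
           (cong (ℚ._* r) (sym (ι-+ (f zero) (∑ℤ (λ i → f (suc i)))))))

  seq-∑ᴿ : ∀ {n} (f : Vector ℚ n) k → seq (∑ᴿ (λ i → fromℚ (f i))) k ≡ ∑ℚ f
  seq-∑ᴿ {zero}  f k = refl
  seq-∑ᴿ {suc n} f k = cong (f zero ℚ.+_) (seq-∑ᴿ (λ i → f (suc i)) k)

  ∑ℤ-norm : ∀ {n} (v : Vec ℤ n) → ∑ℤ (λ i → + ℤ.∣ lookup v i ∣) ≡ + norm₁ v
  ∑ℤ-norm []      = refl
  ∑ℤ-norm (z ∷ v) = cong (λ t → + ℤ.∣ z ∣ ℤ.+ t) (∑ℤ-norm v)

  -- A point of the section is the combination of the vertices ±(e_i − e_0) with
  -- weights |v_i| / (s + 1); the remaining weight is divided equally between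
  -- the opposite vertices e_0 − e_1 and e_1 − e_0.
  module SectionPoint (n s : ℕ) (v : Vec ℤ (suc n)) (v≤s : norm₁ v ℕ.≤ suc s) where

    S r slack : ℚ
    S = ι (+ suc s)
    r = proj₁ (recip S (0<ι s))
    slack = (S ℚ.- ι (+ norm₁ v)) ℚ.* r ℚ.* ½

    0<r : 0ℚ ℚ.< r
    0<r = proj₁ (proj₂ (recip S (0<ι s)))

    Sr≡1 : S ℚ.* r ≡ 1ℚ
    Sr≡1 = proj₂ (proj₂ (recip S (0<ι s)))

    0≤slack : 0ℚ ℚ.≤ slack
    0≤slack = 0≤p*q (0≤p*q (p≤q⇒0≤q-p (ι-mono-≤ (ℤ.+≤+ v≤s))) (ℚ.<⇒≤ 0<r)) (ℚ.<⇒≤ 0<½)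

    x : Vec ℤ (suc (suc n))
    x = ℤ.- ∑ℤ (lookup v) ∷ v

    t : Vector ℚ (suc n)
    t i = ι (lookup v i) ℚ.* r

    y : Vector ℝ (suc (suc n))
    y u = fromℚ (ι (lookup x u) ℚ.* r)

    cℚ : Vector ℚ (suc (suc (suc n)))
    cℚ zero          = slack
    cℚ (suc zero)    = slack
    cℚ (suc (suc i)) = ι (+ ℤ.∣ lookup v i ∣) ℚ.* r

    spoke : ℤ → Fin (suc n) → Vector ℝ (suc (suc n))
    spoke (+ _)    i u = e (suc i) u -ᴿ e zero u
    spoke -[1+ _ ] i u = e zero u -ᴿ e (suc i) u

    p : Vector (Vector ℝ (suc (suc n))) (suc (suc (suc n)))
    p zero          u = e zero u -ᴿ e (suc zero) u
    p (suc zero)    u = e (suc zero) u -ᴿ e zero u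
    p (suc (suc i)) u = spoke (lookup v i) i u

    spoke-edge : ∀ z i → EdgeVector (K 1 (suc n)) (spoke z i)
    spoke-edge (+ m)    i = suc i , zero , tt , λ u → ≃⇒≈ (≃-refl {spoke (+ m) i u})
    spoke-edge -[1+ m ] i = zero , suc i , tt , λ u → ≃⇒≈ (≃-refl {spoke -[1+ m ] i u})

    edge : ∀ j → EdgeVector (K 1 (suc n)) (p j)
    edge zero          = zero , suc zero , tt , λ u → ≃⇒≈ (≃-refl {p zero u})
    edge (suc zero)    = suc zero , zero , tt , λ u → ≃⇒≈ (≃-refl {p (suc zero) u})
    edge (suc (suc i)) = spoke-edge (lookup v i) i

    0≤cℚ : ∀ j → 0ℚ ℚ.≤ cℚ j
    0≤cℚ zero          = 0≤slack
    0≤cℚ (suc zero)    = 0≤slack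
    0≤cℚ (suc (suc i)) = 0≤p*q (0≤ι ℤ.∣ lookup v i ∣) (ℚ.<⇒≤ 0<r)

    ∑cℚ≡1 : ∑ℚ cℚ ≡ 1ℚ
    ∑cℚ≡1 = trans
      (cong (λ m → slack ℚ.+ (slack ℚ.+ m)) (trans (∑ℚ-ι* (λ i → + ℤ.∣ lookup v i ∣) r)
        (cong (λ m → ι m ℚ.* r) (∑ℤ-norm v))))
      (trans (solve 3 (λ S N r → (S :- N) :* r :* con ½ :+ ((S :- N) :* r :* con ½ :+ N :* r) := S :* r) refl
                S (ι (+ norm₁ v)) r) Sr≡1)
      where open ℚ-solver

    -- The sign of z is absorbed by the orientation of the edge, which leaves the nonnegative weight
    -- |z| r.
    spoke-scale : ∀ z i u → fromℚ (ι (+ ℤ.∣ z ∣) ℚ.* r) *ᴿ spoke z i u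
                          ≃ fromℚ (ι z ℚ.* r) *ᴿ (e (suc i) u -ᴿ e zero u)
    spoke-scale (+ m)    i u = ⟨ ≃⇒≈ (≃-refl {fromℚ (ι (+ m) ℚ.* r) *ᴿ (e (suc i) u -ᴿ e zero u)}) ⟩
    spoke-scale -[1+ m ] i u = ⟨ ≃⇒≈ (pointwise
      {fromℚ (ι (+ suc m) ℚ.* r) *ᴿ (e zero u -ᴿ e (suc i) u)}
      {fromℚ (ι -[1+ m ] ℚ.* r) *ᴿ (e (suc i) u -ᴿ e zero u)} λ k → trans
        (solve 4 (λ m r a b → m :* r :* (a :- b) := ((:- m) :* r) :* (b :- a)) refl
          (ι (+ suc m)) r (seq (e zero u) k) (seq (e (suc i) u) k))
        (cong (λ q → q ℚ.* r ℚ.* (seq (e (suc i) u) k ℚ.- seq (e zero u) k)) (sym (ι-neg (+ suc m))))) ⟩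
      where open ℚ-solver

    y-zero : y zero ≃ -ᴿ fromℚ (∑ℚ t)
    y-zero = pointwise {y zero} { -ᴿ fromℚ (∑ℚ t)} λ _ → trans (cong (ℚ._* r) (ι-neg (∑ℤ (lookup v))))
      (trans (sym (ℚ.neg-distribˡ-* (ι (∑ℤ (lookup v))) r)) (cong ℚ.-_ (sym (∑ℚ-ι* (lookup v) r))))

    y≃cp : ∀ u → _
    y≃cp = ℝ-hull.Star.star-combination e e-diagonal e-off t y ⟨ ≃⇒≈ y-zero ⟩ (λ i → ≃-refl {y (suc i)})
      (λ j → fromℚ (cℚ j)) p (≃-refl {fromℚ slack})
      (λ u → ⟨ ≃⇒≈ (pointwise {p (suc zero) u} { -ᴿ p zero u} λ k →
         solve 2 (λ a b → b :- a := :- (a :- b)) refl (seq (e zero u) k) (seq (e (suc zero) u) k)) ⟩)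
      (λ i u → ⟨ ≃⇒≈ (spoke-scale (lookup v i) i u) ⟩)
      where open ℚ-solver

    member : StarDilate (suc n) (suc s) x
    member = y , (suc (suc (suc n)) , (λ j → fromℚ (cℚ j)) , p
        , (λ j → ≤-fromℚ (0≤cℚ j))
        , ≃⇒≈ (pointwise {∑ᴿ (λ j → fromℚ (cℚ j))} {1ᴿ} λ k → trans (seq-∑ᴿ cℚ k) ∑cℚ≡1)
        , edge , λ u → ≃⇒≈ (y≃cp u))
      , λ u → ≃⇒≈ (pointwise {fromℤ (lookup x u)} {fromℤ (+ suc s) *ᴿ y u} λ _ → sym (trans
          (solve 3 (λ S x r → S :* (x :* r) := (S :* r) :* x) refl S (ι (lookup x u)) r)
          (trans (cong (ℚ._* ι (lookup x u)) Sr≡1) (ℚ.*-identityˡ (ι (lookup x u))))))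
      where open ℚ-solver

  section⇒member : ∀ n s x → Section (suc n) s x → StarDilate (suc n) s x
  section⇒member n zero    x section            = section⇒member-zero n x section
  section⇒member n (suc s) x (v , v≤s , refl) = SectionPoint.member n s v v≤s

  star-cardinality : ∀ n s → HasCardinality (StarDilate (suc n) s) (delannoy (suc n) s)
  star-cardinality n s = cardinality-resp
    (λ x → mk⇔ (section⇒member n s x) (member⇒section (suc n) s x))
    (cardinality-image (λ v → ℤ.- ∑ℤ (lookup v) ∷ v) ∷-injectiveʳ (ball-cardinality (suc n) s))

-- Existence, zeros and interlacing of the Ehrhart polynomials

open import Data.Nat using (_!)
open import Data.Rational.Solver using (module +-*-Solver)
open import Defs
open Defs.Line using (point)
open ≡ using (refl; cong)
open +-*-Solver using (solve; _:+_; _:*_; _:-_; _:=_; con)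
open ComplexNumbers
open Counting
open CriticalLine
open Interpolation
open Polynomials
open Rationals
open RealNumbers
open RealRoots
open StarPolytope

0<ι! : ∀ n → 0ℚ ℚ.< ιℕ (n !)
0<ι! n = ι-< {0} {n !} (ℕ.1≤n! n)

1/! : ℕ → ℚ
1/! n = proj₁ (recip (ιℕ (n !)) (0<ι! n))

0<1/! : ∀ n → 0ℚ ℚ.< 1/! n
0<1/! n = proj₁ (proj₂ (recip (ιℕ (n !)) (0<ι! n)))

1/!-value : ∀ n s → 1/! n ℚ.* ℚ-alg.Recurrence.value 1ℚ weight n (ιℕ s) ≡ ιℕ (delannoy n s)
1/!-value n s = ≡.trans (cong (1/! n ℚ.*_) (≡.trans (value-scaled n s) (ιℕ-* (n !) (delannoy n s))))
  (≡.trans (≡.sym (ℚ.*-assoc (1/! n) (ιℕ (n !)) (ιℕ (delannoy n s))))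
    (≡.trans (cong (ℚ._* ιℕ (delannoy n s))
               (≡.trans (ℚ.*-comm (1/! n) (ιℕ (n !))) (proj₂ (proj₂ (recip (ιℕ (n !)) (0<ι! n))))))
      (ℚ.*-identityˡ (ιℕ (delannoy n s)))))

module Scaled n = ScaledRecurrence ℂ-commutativeRing fromℚᶜ-morphism 1ℚ weight n (1/! n) (0<1/! n)

natural : ℕ → ℂ
natural s = fromℝ (fromℤ (+ s))

natural≃ : ∀ s → natural s ≃ᶜ fromℚᶜ (ιℕ s)
natural≃ s = pointwiseᶜ (natural s) (fromℚᶜ (ιℕ s)) (λ _ → refl) (λ _ → refl)

*ᶜ-congʳ-≡ : ∀ c {a d} → a ≡ d → c *ᶜ a ≃ᶜ c *ᶜ d
*ᶜ-congʳ-≡ c {a} refl = ≃ᶜ-refl {c *ᶜ a}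

*ᶜ-zeroʳ : ∀ c → 0ᶜ ≃ᶜ c *ᶜ 0ᶜ
*ᶜ-zeroʳ c = pointwiseᶜ 0ᶜ (c *ᶜ 0ᶜ)
  (λ n → solve 2 (λ a b → con 0ℚ := a :* con 0ℚ :- b :* con 0ℚ) refl (seq (re c) n) (seq (im c) n))
  (λ n → solve 2 (λ a b → con 0ℚ := a :* con 0ℚ :+ b :* con 0ℚ) refl (seq (re c) n) (seq (im c) n))

coeff-·ₚ : ∀ c p k d → coeff p k ≡ d → coeff (c ·ₚ p) k ≃ᶜ c *ᶜ d
coeff-·ₚ c []      k       d eq = ≃ᶜ-trans {0ᶜ} {c *ᶜ 0ᶜ} {c *ᶜ d} (*ᶜ-zeroʳ c) (*ᶜ-congʳ-≡ c {0ᶜ} {d} eq)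
coeff-·ₚ c (a ∷ p) zero    d eq = *ᶜ-congʳ-≡ c {a} {d} eq
coeff-·ₚ c (a ∷ p) (suc k) d eq = coeff-·ₚ c p k d eq

ehrhart : ℕ → ℂ[x]
ehrhart n = Scaled.scaled-poly n

ehrhart-isEhrhart : ∀ n → IsEhrhartPolynomial (K 1 (suc n)) (ehrhart (suc n))
ehrhart-isEhrhart n s = delannoy (suc n) s , star-cardinality n s , ≃ᶜ⇒≈ᶜ
  (≃ᶜ-trans {eval H (natural s)} {ℂ-alg.eval H (natural s)} {natural (delannoy (suc n) s)}
    (eval≃ H (natural s))
    (≃ᶜ-trans {ℂ-alg.eval H (natural s)} {ℂ-alg.eval H (fromℚᶜ (ιℕ s))} {natural (delannoy (suc n) s)}
      (ℂ-alg.eval-cong H {natural s} {fromℚᶜ (ιℕ s)} (natural≃ s))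
      (≃ᶜ-trans {ℂ-alg.eval H (fromℚᶜ (ιℕ s))} {fromℚᶜ q} {natural (delannoy (suc n) s)}
        (Scaled.eval-scaled-poly-κ (suc n) (ιℕ s))
        (pointwiseᶜ (fromℚᶜ q) (natural (delannoy (suc n) s)) (λ _ → 1/!-value (suc n) s) (λ _ → refl)))))
  where
  H = ehrhart (suc n)
  q = 1/! (suc n) ℚ.* ℚ-alg.Recurrence.value 1ℚ weight (suc n) (ιℕ s)

product-transport : ∀ {a a′ b b′ d d′ e} → a ≡ a′ → b ≡ b′ → d ≡ d′ → a′ ≃ᶜ b′ *ᶜ d′ → e ≃ᶜ b *ᶜ d → a ≃ᶜ e
product-transport {a} {_} {b} {_} {d} {_} {e} refl refl refl a≃bd e≃bd =
  ≃ᶜ-trans {a} {b *ᶜ d} {e} a≃bd (≃ᶜ-sym {e} {b *ᶜ d} e≃bd)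

coeff-∏ₚ≡ : ∀ {m} (z : Vector ℂ m) k → coeff (∏ₚ (λ i → x- z i)) k ≡ ℂ-alg.coeff (ℂ-alg.∏ₚ (λ i → ℂ-alg.x- z i)) k
coeff-∏ₚ≡ z k = ≡.trans (coeff≡ (∏ₚ (λ i → x- z i)) k) (cong (λ p → ℂ-alg.coeff p k) (∏ₚ≡ z))

factorise : ∀ {m} H (z : Vector ℂ m) (a : ℕ → ℂ) (c : ℂ) (d : ℕ → ℂ) →
  (∀ k → coeff H k ≡ a k) → coeff H m ≡ c → (∀ k → coeff (∏ₚ (λ i → x- z i)) k ≡ d k) →
  (∀ k → a k ≃ᶜ c *ᶜ d k) → H ≈ₚ coeff H m ·ₚ ∏ₚ (λ i → x- z i)
factorise {m} H z a c d H≡a Hm≡c π≡d eq k =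
  ≃ᶜ⇒≈ᶜ {coeff H k} {coeff (coeff H m ·ₚ ∏ₚ (λ i → x- z i)) k} (product-transport
  {coeff H k} {a k} {coeff H m} {c} {coeff (∏ₚ (λ i → x- z i)) k} {d k}
  {coeff (coeff H m ·ₚ ∏ₚ (λ i → x- z i)) k}
  (H≡a k) Hm≡c (π≡d k) (eq k)
  (coeff-·ₚ (coeff H m) (∏ₚ (λ i → x- z i)) k (coeff (∏ₚ (λ i → x- z i)) k) refl))

-- Any Ehrhart polynomial takes the Delannoy values at the naturals, hence has the coefficients of
-- h_{n+1}/(n + 1)! and inherits its degree and zeros.
module EhrhartPolynomial (n : ℕ) (H : ℂ[x]) (isEhrhart : IsEhrhartPolynomial (K 1 (suc n)) H) where

  q : ℕ → ℚ
  q s = 1/! (suc n) ℚ.* ℚ-alg.Recurrence.value 1ℚ weight (suc n) (ιℕ s)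

  agree : ∀ s → ℂ-alg.eval H (natural s) ≃ᶜ fromℚᶜ (q s)
  agree s =
    let N , card , evalH≈N = isEhrhart s
        N≡D = cardinality-unique card (star-cardinality n s)
    in ≃ᶜ-trans {ℂ-alg.eval H (natural s)} {eval H (natural s)} {fromℚᶜ (q s)}
      (≃ᶜ-sym {eval H (natural s)} {ℂ-alg.eval H (natural s)} (eval≃ H (natural s)))
      (≃ᶜ-trans {eval H (natural s)} {natural N} {fromℚᶜ (q s)} (≈ᶜ⇒≃ᶜ evalH≈N)
        (pointwiseᶜ (natural N) (fromℚᶜ (q s))
          (λ _ → ≡.trans (cong ιℕ N≡D) (≡.sym (1/!-value (suc n) s))) (λ _ → refl)))

  open Scaled.Agreeing (suc n) H natural natural≃ agree

  eval-root⇒value-root : ∀ z → eval H z ≈ᶜ 0ᶜ → ℂ-alg.Recurrence.value 1ℚ weight (suc n) z ≃ᶜ 0ᶜ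
  eval-root⇒value-root z root = root⇒value-root z
    (≃ᶜ-trans {ℂ-alg.eval H z} {eval H z} {0ᶜ} (≃ᶜ-sym {eval H z} {ℂ-alg.eval H z} (eval≃ H z)) (≈ᶜ⇒≃ᶜ root))

  hasDegree : HasDegree H (suc n)
  hasDegree =
      -- The real part witnesses apartness from 0: the leading coefficient is 2ⁿ⁺¹/(n + 1)!, which
      -- is positive.
      inj₁ (inj₂ (Pos.margin 0<lead , Pos.0<margin 0<lead , eventually-map
        (λ k → ≡.subst (ℚ._< seq (re (coeff H (suc n))) k) (≡.sym (ℚ.+-identityˡ (Pos.margin 0<lead))))
        (Pos.eventually 0<lead)))
    , λ k n<k → ≡.subst (_≈ᶜ 0ᶜ) (≡.sym (coeff≡ H k)) (≃ᶜ⇒≈ᶜ (degree k n<k))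
    where
    lead : coeff H (suc n) ≃ᶜ fromℚᶜ (1/! (suc n) ℚ.* 2^ suc n)
    lead = ≡.subst (_≃ᶜ fromℚᶜ (1/! (suc n) ℚ.* 2^ suc n)) (≡.sym (coeff≡ H (suc n))) leading
    0<lead : Pos (re (coeff H (suc n)))
    0<lead = Pos-resp {fromℚ (1/! (suc n) ℚ.* 2^ suc n)} {re (coeff H (suc n))}
      (≃-sym {re (coeff H (suc n))} {fromℚ (1/! (suc n) ℚ.* 2^ suc n)} (re≃ lead))
      (Pos-fromℚ (0<p*q (0<1/! (suc n)) (0<2^ (suc n))))

  zeros⇒hasZeros : ∀ (z : Vector ℂ (suc n)) →
    (∀ i j → i Fin.< j → ℂ-alg.Regular (z j ℂ-alg.- z i)) →
    (∀ i → ℂ-alg.Recurrence.value 1ℚ weight (suc n) (z i) ≃ᶜ 0ᶜ) → HasZeros H z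
  zeros⇒hasZeros z z-regular z-root = record
    { degree = hasDegree
    ; factorisation = factorise H z
        (ℂ-alg.coeff H) (ℂ-alg.coeff H (suc n)) (ℂ-alg.coeff (ℂ-alg.∏ₚ (λ i → ℂ-alg.x- z i)))
        (coeff≡ H) (coeff≡ H (suc n)) (coeff-∏ₚ≡ z) (λ k →
        let ⟨ r ⟩ +≃i ⟨ i ⟩ = coeff-factorisation z z-regular z-root k
        in ⟨ r ⟩ +≃i ⟨ i ⟩)
    }

  hasZeros : ∀ (t : ℕ → ℝ) → (∀ {i j} → i ℕ.< j → j ℕ.< suc n → Pos (t j ℝ-alg.- t i)) →
    (∀ i → i ℕ.< suc n → ℝ-alg.Recurrence.value 0ℚ (λ k → ℚ.- weight k) (suc n) (t i) ≃ 0ᴿ) →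
    HasZeros H {suc n} (λ i → point Re=-½ (t (toℕ i)))
  hasZeros t increasing root = zeros⇒hasZeros (λ i → point Re=-½ (t (toℕ i)))
    (λ i j i<j → point-regular′ {t (toℕ i)} {t (toℕ j)}
      {point Re=-½ (t (toℕ i))} {point Re=-½ (t (toℕ j))} refl refl (increasing i<j (Fin.toℕ<n j)))
    (λ i → value-point weight (suc n) (t (toℕ i)) (root (toℕ i) (Fin.toℕ<n i)))

open Roots.Interlacing ℝ-commutativeRing fromℚ-morphism ℝ-field weight 0<weight
  using (interlaced-roots; module Interlaced)

roots-on-line : ∀ n H → IsEhrhartPolynomial (K 1 (suc n)) H → ∀ z → eval H z ≈ᶜ 0ᶜ → re z ≈ -½
roots-on-line n H isEhrhart z root =
  let t , s , interlaced = interlaced-roots n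
      open Interlaced interlaced
  in zero-on-line weight (suc n) t z
       (EhrhartPolynomial.eval-root⇒value-root n H isEhrhart z root)
       (zeros-regular weight (suc n) t t-increasing)
       (λ i → value-point weight (suc n) (t (toℕ i)) (t-root (toℕ i) (Fin.toℕ<n i)))

interlaces : ∀ n H H′ → IsEhrhartPolynomial (K 1 (suc n)) H → IsEhrhartPolynomial (K 1 (suc (suc n))) H′ →
  H Interlaces[ Re=-½ ] H′
interlaces n H H′ isEhrhart isEhrhart′ =
  -- At index n + 1 the sequence `t` lists the roots of p_{n+2}, which belongs to H′, and `s` those
  -- of p_{n+1}, which belongs to H.
  let t , s , interlaced = interlaced-roots (suc n)
      open Interlaced interlaced
  in suc n , (λ i → t (toℕ i)) , (λ i → s (toℕ i))
     , EhrhartPolynomial.hasZeros (suc n) H′ isEhrhart′ t t-increasing t-root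
     , EhrhartPolynomial.hasZeros n H isEhrhart s s-increasing s-root
     , λ i → let pos ε 0<ε t<s = t≺s (toℕ i) (Fin.toℕ<n i)
                 pos δ 0<δ s<t = s≺t (toℕ i) (Fin.toℕ<n i)
       in ≡.subst (λ k → t k ≤ s (toℕ i)) (≡.sym (Fin.toℕ-inject₁ i))
            (Pos⇒≤ {t (toℕ i)} {s (toℕ i)} (pos ε 0<ε t<s))
        , Pos⇒≤ {s (toℕ i)} {t (suc (toℕ i))} (pos δ 0<δ s<t)

lemma4p6 : (n : ℕ) → 1 ℕ.≤ n →
    (∃ λ H → IsEhrhartPolynomial (K 1 n) H)
    × (∀ H → IsEhrhartPolynomial (K 1 n) H →
    ∀ z → eval H z ≈ᶜ 0ᶜ → re z ≈ -½)
    × (∀ H H′ → IsEhrhartPolynomial (K 1 n) H →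
    IsEhrhartPolynomial (K 1 (suc n)) H′ →
    H Interlaces[ Re=-½ ] H′)
lemma4p6 (suc n) _ = (ehrhart (suc n) , ehrhart-isEhrhart n) , roots-on-line n , interlaces n
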